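{- Let $\alpha$ be a set with an involution $\tau$, let $\pi=\pi(\alpha,\tau)$, and let $\varphi:\pi\to\mathbb Z$ be an additive homomorphism such that $\varphi(a)\in\{+1,-1\}$ for all $a\in\alpha$. For any nanowords $w,v$ over $\alpha$, $$\rho_{wbr}(w,v)\ \ge\ \tfrac12\big(\sigma_\varphi(p_w\oplus p_v^-)-1\big),$$ where $p_w=p(w)$, $p_v=p(v)$ are the $\alpha$-pairings of $w,v$, $\sigma_\varphi$ is the $\varphi$-genus and $\rho_{wbr}$ is the weak bridge pseudo-metric.
   Context: **Nanowords.** $\alpha$ is a set with an involution $\tau:\alpha\to\alpha$ ($\tau^2=\mathrm{id}$). An $\alpha$-alphabet is a set $\mathcal A$ with a map $\mathcal A\to\alpha$, $A\mapsto|A|$. A nanoword of length $n$ over $\alpha$ is a pair $(\mathcal A,w)$ with $\mathcal A$ an $\alpha$-alphabet and $w:\{1,\dots,n\}\to\mathcal A$ a map (written $w(1)\cdots w(n)$) taking every value in $\mathcal A$ exactly twice; $\emptyset$ is the empty nanoword. Nanowords $(\mathcal A,w),(\mathcal A',w')$ are isomorphic if $w'=fw$ for a bijection $f:\mathcal A\to\mathcal A'$ with $|f(A)|=|A|$. The opposite word is $w^-=w(n)\cdots w(1)$. **Homotopy moves.** (1) $(\mathcal A,xAAy)\mapsto(\mathcal A-\{A\},xy)$; (2) $(\mathcal A,xAByBAz)\mapsto(\mathcal A-\{A,B\},xyz)$ if $|B|=\tau(|A|)$; (3) $(\mathcal A,xAByACzBCt)\mapsto(\mathcal A,xBAyCAzCBt)$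 for distinct $A,B,C$ with $|A|=|B|=|C|$. **Circular shift.** The shift of a nanoword $(\mathcal A,w)$ with $w=AxAy$ is $(\hat{\mathcal A},\hat w)$ with $\hat{\mathcal A}=(\mathcal A-\{A\})\cup\{\bar A\}$, $\bar A$ a new letter with $|\bar A|=\tau(|A|)$, and $\hat w=x\bar Ay\bar A$. **Bridge moves.** A factor of $(\mathcal A,w)$ is a sequence of words $\nabla=(\mathcal B,(v_1|\cdots|v_k))$ in a subset $\mathcal B\subset\mathcal A$, each letter of $\mathcal B$ occurring exactly twice in $v_1\cdots v_k$, such that $w=x_1v_1x_2v_2\cdots x_kv_kx_{k+1}$ with $x_i$ words in $\mathcal A-\mathcal B$. A quasi-bridge in $w$ is a pair $(\nabla,\kappa)$ with $\nabla=(\mathcal B,(v_1|\cdots|v_k))$ a factor of $(\mathcal A,w)$, $k\ge1$, and $\kappa$ an involutive permutation of $\{1,\dots,k\}$ such that (a) $v_r$ has even length whenever $\kappa(r)=r$; (b) there is a map $\iota:\mathcal B\to\mathcal B$ with $\iota v_r=v_{\kappa(r)}^-$ for all $r$. The occurrence of $B\in\mathcal B$ in position $j$ of $v_r$ is symmetric to the occurrence of $\iota(B)$ in position $n_r+1-j$ of $v_{\kappa(r)}$, where $n_r$ is the length of $v_r$. Put $\varepsilon(B)=1$ if the occurrence symmetric to the leftmost occurrence of $B$ in $w$ is the leftmost occurrence of $\iota(B)$ in $w$, and $\varepsilon(B)=0$ otherwise. A quasi-bridge is a bridge if $|\iota(B)|=\tau^{\varepsilon(B)}(|B|)$ for all $B\in\mathcal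 B$. The corresponding bridge move $m$ transforms $(\mathcal A,w)$ into $(\mathcal A-\mathcal B,x_1x_2\cdots x_{k+1})$; its number of arches $g(m)=g(m^{ -1})$ is the number of 2-element orbits of $\kappa$. (A bridge move is always considered together with the bridge defining it.) **Weak bridge pseudo-metric.** A circular metamorphosis $m:w\to v$ is a finite sequence $m=(m_1,\dots,m_n)$ of isomorphisms, homotopy moves, bridge moves, circular shifts, and inverses of such moves, transforming $w$ into $v$; $g(m)=\sum_ig(m_i)$ where $g(m_i)$ is the number of arches if $m_i$ is a bridge move or the inverse of one, and $g(m_i)=0$ otherwise. Set $\rho_{wbr}(w,v)=\min_mg(m)$ over all circular metamorphoses $m:w\to v$. **$\alpha$-pairings.** $\pi=\pi(\alpha,\tau)$ is the additive abelian group with generators $a\in\alpha$ and relations $a+\tau(a)=0$. An $\alpha$-pairing is a triple $p=(S,s,e)$: a set $S$ (here finite), $s\in S$, a map $S^\circ=S-\{s\}\to\alpha$, $A\mapsto|A|$, and a map $e:S\times S\to\pi$, extended to a bilinear form $\tilde e:\mathbb ZS\times\mathbb ZS\to\pi$. The opposite is $p^-=(S,s,-e)$. The sum $p_1\oplus p_2$ of $p_i=(S_i,s_i,e_i)$ is $(S_1^\circ\sqcup S_2^\circ\sqcup\{s\},s,e)$ with inherited projections, $e=e_i$ on $S_i^\circ\times S_i^\circ$, $e(S_1^\circ,S_2^\circ)=e(S_2^\circ,S_1^\circ)=0$, $e(A,s)=e_i(A,s_i)$, $e(s,A)=e_i(s_i,A)$ for $A\in S_i^\circ$, $e(s,s)=e_1(s_1,s_1)+e_2(s_2,s_2)$.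 A vector $x\in\mathbb ZS$ is short if $x=A\in S^\circ$, or $x=A+B$ with $A\ne B\in S^\circ$, $|A|=|B|$, or $x=A-B$ with $A\ne B\in S^\circ$, $|A|=\tau(|B|)$. A filling of $p$ is a finite family $\{\lambda_i\}$ in $\mathbb ZS$ such that one $\lambda_i$ equals $s$, all others are short, and every element of $S^\circ$ occurs with non-zero coefficient in exactly one $\lambda_i$. The $\varphi$-genus is $\sigma_\varphi(p)=\min_\lambda\frac12\operatorname{rk}\big(\varphi\tilde e(\lambda_i,\lambda_j)\big)_{i,j}$, the minimum over all fillings $\lambda$ of $p$ (rank over $\mathbb Q$). **The $\alpha$-pairing of a nanoword $(\mathcal A,w)$.** $p_w=p(w)=(\mathcal A\cup\{s\},s,e_w)$ with the given projection $\mathcal A\to\alpha$. For $A,B\in\mathcal A$ let $n_w(A,B)=1$ if $w=\cdots A\cdots B\cdots A\cdots B\cdots$, $-1$ if $w=\cdots B\cdots A\cdots B\cdots A\cdots$, $0$ otherwise. Let $i_A<j_A$ be the elements of $w^{ -1}(A)$, and $A\circ_wB=\sum|D|\in\pi$ over $D\in\mathcal A$ with $i_A<i_D<j_A$ and $i_B<j_D<j_B$. Then $e_w(A,B)=2(A\circ_wB-B\circ_wA)+n_w(A,B)(|A|+|B|)$, $e_w(A,s)=-e_w(s,A)=\sum_{D\in\mathcal A}n_w(A,D)|D|$, $e_w(s,s)=0$. -}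

module Defs where

open import Level using (Level; 0ℓ; _⊔_) renaming (suc to lsuc)
open import Algebra.Bundles using (AbelianGroup)
open import Algebra.Definitions using (Involutive)
open import Algebra.Morphism.Structures using (module GroupMorphisms)
import Algebra.Definitions.RawMonoid as RawMonoidDefs
import Algebra.Properties.CommutativeMonoid.Sum as CommutativeMonoidSum
open import Data.Bool.Base using (if_then_else_)
open import Data.Fin.Base as Fin using (Fin; zero; suc; opposite; cast)
import Data.Fin.Properties as Finₚ
open import Data.Integer.Base as ℤ using (ℤ; +_; -[1+_]; 0ℤ; 1ℤ; -1ℤ)
import Data.Integer.Properties as ℤₚ
open import Data.List.Base as List using (List; []; _∷_; _++_; concat; length; reverse)
import Data.List.Properties as Listₚ
open import Data.List.Membership.Propositional using (_∈_)
import Data.List.Membership.Propositional.Properties as ∈ₚ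
open import Data.List.Relation.Unary.Any using (index)
import Data.List.Relation.Unary.Any.Properties as Anyₚ
import Data.List.Relation.Unary.All as All
open import Data.List.Relation.Unary.AllPairs.Core using (_∷_)
open import Data.List.Relation.Unary.Unique.Propositional using (Unique)
import Data.List.Relation.Unary.Unique.Propositional.Properties as Uniqueₚ
open import Data.Maybe.Base using (Maybe; just; nothing; maybe)
open import Data.Nat.Base as ℕ using (ℕ; suc)
open import Data.Nat.Divisibility using (_∣_)
open import Data.Product using (Σ; ∃; ∃!; _×_; _,_; proj₂)
open import Data.Rational.Base as ℚ using (ℚ; 0ℚ; ½)
import Data.Rational.Properties as ℚₚ
open import Data.Refinement using (Refinement; value)
open import Data.Sum.Base using (_⊎_; inj₁; inj₂; [_,_]′)
open import Data.Sum.Function.Propositional using (_⊎-↔_)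
open import Data.Vec.Base as Vec using (Vec; []; _∷_; lookup)
open import Function.Base using (_∘_)
open import Function.Bundles using (_↔_; mk↔ₛ′; Inverse)
open import Function.Construct.Composition using (_↔-∘_)
open import Function.Properties.Inverse using (↔-sym; ↔⇒↣)
open import Relation.Binary.Construct.Closure.Equivalence using (EqClosure)
open import Relation.Binary.Construct.Closure.ReflexiveTransitive using (ε; _◅_)
open import Relation.Binary.Construct.Closure.Symmetric using (fwd; bwd)
open import Relation.Binary.Core using (Rel)
open import Relation.Binary.Definitions using (DecidableEquality)
open import Relation.Binary.PropositionalEquality
open import Relation.Nullary using (¬_; Dec; does; contradiction)
open import Relation.Nullary.Decidable using (_×-dec_)
open import Relation.Unary using (Pred; ∁; _∪_; ｛_｝)

private
  variable
    a ℓ ℓ′ : Level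
    A : Set a

-- Minima are given by relations rather than functions: the sets minimised
-- over below are inhabited but not decidable.
IsMinimum : {X : Set a} → Rel X ℓ → Pred X ℓ′ → Pred X (a ⊔ ℓ ⊔ ℓ′)
IsMinimum _≤_ P x = P x × (∀ y → P y → x ≤ y)

module _ where

  open CommutativeMonoidSum ℚₚ.+-0-commutativeMonoid using (sum)

  Matrix : ℕ → ℕ → Set
  Matrix m n = Fin m → Fin n → ℚ

  LinearlyIndependent : ∀ {m n} → Matrix m n → Set
  LinearlyIndependent {m} {n} v =
    (c : Fin m → ℚ) →
    (∀ j → sum (λ i → c i ℚ.* v i j) ≡ 0ℚ) →
    ∀ i → c i ≡ 0ℚ

  -- The rank is the largest size of a linearly independent family of
  -- rows.  Such a family never repeats a row.
  HasRank : ∀ {m n} → Matrix m n → ℕ → Set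
  HasRank {m} M r =
    (∃ λ (f : Fin r → Fin m) → LinearlyIndependent (M ∘ f)) ×
    (∀ k (f : Fin k → Fin m) → LinearlyIndependent (M ∘ f) → k ℕ.≤ r)

record Twice {A : Set a} (w : List A) (x : A) : Set a where
  field
    left right : Fin (length w)
    left<right : left Fin.< right
    at-left    : List.lookup w left ≡ x
    at-right   : List.lookup w right ≡ x
    only       : ∀ k → List.lookup w k ≡ x → k ≡ left ⊎ k ≡ right

open Twice

Finite : Set a → Set a
Finite A = ∃ λ n → Fin n ↔ A

lookup-injective : ∀ {xs : List A} → Unique xs →
                   ∀ i j → List.lookup xs i ≡ List.lookup xs j → i ≡ j
lookup-injective (_  ∷ _) zero    zero    _  = refl
lookup-injective (x∉ ∷ _) zero    (suc j) eq = contradiction eq (All.lookup x∉ (∈ₚ.∈-lookup j))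
lookup-injective (x∉ ∷ _) (suc i) zero    eq = contradiction (sym eq) (All.lookup x∉ (∈ₚ.∈-lookup i))
lookup-injective (_  ∷ u) (suc i) (suc j) eq = cong suc (lookup-injective u i j eq)

-- Letters are enumerated by their leftmost occurrences.
module _ {A : Set a} (w : List A) (twice : ∀ x → Twice w x) where

  private
    leftmost? : (i : Fin (length w)) → Dec (i ≡ left (twice (List.lookup w i)))
    leftmost? i = i Finₚ.≟ left (twice (List.lookup w i))

    positions : List (Fin (length w))
    positions = List.filter leftmost? (List.allFin (length w))

    positions-unique : Unique positions
    positions-unique = Uniqueₚ.filter⁺ leftmost? (Uniqueₚ.allFin⁺ (length w))

    left∈ : ∀ x → left (twice x) ∈ positions
    left∈ x = ∈ₚ.∈-filter⁺ leftmost? (∈ₚ.∈-allFin _)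
      (sym (cong (left ∘ twice) (at-left (twice x))))

    to : Fin (length positions) → A
    to i = List.lookup w (List.lookup positions i)

    from : A → Fin (length positions)
    from x = index (left∈ x)

    to-from : ∀ x → to (from x) ≡ x
    to-from x = trans
      (cong (List.lookup w) (sym (Anyₚ.lookup-index (left∈ x))))
      (at-left (twice x))

    from-to : ∀ i → from (to i) ≡ i
    from-to i = lookup-injective positions-unique _ _ (trans
      (sym (Anyₚ.lookup-index (left∈ (to i))))
      (sym (proj₂ (∈ₚ.∈-filter⁻ leftmost? {xs = List.allFin (length w)}
                    (∈ₚ.∈-lookup i)))))

  twice⇒finite : Finite A
  twice⇒finite = length positions , mk↔ₛ′ to from to-from from-to

Finite-⊎ : ∀ {A B : Set ℓ} → Finite A → Finite B → Finite (A ⊎ B)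
Finite-⊎ (_ , e) (_ , f) = _ , (e ⊎-↔ f) ↔-∘ Finₚ.+↔⊎

Finite-Maybe : Finite A → Finite (Maybe A)
Finite-Maybe {A = A} (n , e) = suc n , mk↔ₛ′ to from to-from from-to
  where
  to : Fin (suc n) → Maybe A
  to zero    = nothing
  to (suc i) = just (Inverse.to e i)
  from : Maybe A → Fin (suc n)
  from nothing  = zero
  from (just x) = suc (Inverse.from e x)
  to-from : ∀ x → to (from x) ≡ x
  to-from nothing  = refl
  to-from (just x) = cong just (Inverse.strictlyInverseˡ e x)
  from-to : ∀ i → from (to i) ≡ i
  from-to zero    = refl
  from-to (suc i) = cong suc (Inverse.strictlyInverseʳ e i)

Finite⇒≟ : Finite A → DecidableEquality A
Finite⇒≟ (_ , e) = Finₚ.inj⇒≟ (↔⇒↣ (↔-sym e))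

module Nanowords {a} (α : Set a) (τ : α → α) (τ-involutive : Involutive _≡_ τ) where

  -- The group π is the setoid of formal expressions modulo _≈_.
  infixl 6 _+π_
  infix  8 -π_
  infix  4 _≈_

  data Π : Set a where
    gen  : α → Π
    0π   : Π
    _+π_ : Π → Π → Π
    -π_  : Π → Π

  data _≈_ : Π → Π → Set a where
    ≈-refl     : ∀ {x} → x ≈ x
    ≈-sym      : ∀ {x y} → x ≈ y → y ≈ x
    ≈-trans    : ∀ {x y z} → x ≈ y → y ≈ z → x ≈ z
    +-cong     : ∀ {x x′ y y′} → x ≈ x′ → y ≈ y′ → x +π y ≈ x′ +π y′
    neg-cong   : ∀ {x x′} → x ≈ x′ → -π x ≈ -π x′
    +-assoc    : ∀ x y z → (x +π y) +π z ≈ x +π (y +π z)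
    +-comm     : ∀ x y → x +π y ≈ y +π x
    +-identity : ∀ x → 0π +π x ≈ x
    +-inverse  : ∀ x → -π x +π x ≈ 0π
    relation   : ∀ a → gen a +π gen (τ a) ≈ 0π

  π : AbelianGroup a a
  π = record
    { Carrier = Π ; _≈_ = _≈_ ; _∙_ = _+π_ ; ε = 0π ; _⁻¹ = -π_
    ; isAbelianGroup = record
      { isGroup = record
        { isMonoid = record
          { isSemigroup = record
            { isMagma = record
              { isEquivalence = record { refl = ≈-refl ; sym = ≈-sym ; trans = ≈-trans }
              ; ∙-cong = +-cong }
            ; assoc = +-assoc }
          ; identity = +-identity , λ x → ≈-trans (+-comm x 0π) (+-identity x) }
        ; inverse = +-inverse , λ x → ≈-trans (+-comm x (-π x)) (+-inverse x)
        ; ⁻¹-cong = neg-cong }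
      ; comm = +-comm } }

  open AbelianGroup π using (rawGroup; rawMonoid; commutativeMonoid)
  open RawMonoidDefs rawMonoid using () renaming (_×_ to _×ⁿ_)
  open CommutativeMonoidSum commutativeMonoid using (sum)

  infixr 7 _·_

  _·_ : ℤ → Π → Π
  (+ n)    · x = n ×ⁿ x
  -[1+ n ] · x = -π (suc n ×ⁿ x)

  ∑ : {A : Set ℓ} → Finite A → (A → Π) → Π
  ∑ (_ , e) f = sum (f ∘ Inverse.to e)

  IsAdditive : (Π → ℤ) → Set a
  IsAdditive φ = IsGroupHomomorphism φ
    where open GroupMorphisms rawGroup (AbelianGroup.rawGroup ℤₚ.+-0-abelianGroup)

  record Alphabet : Set (lsuc 0ℓ ⊔ a) where
    field
      Letter : Set
      label  : Letter → α   -- A ↦ |A|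

  open Alphabet

  record NanowordOver (𝒜 : Alphabet) : Set where
    field
      word  : List (Letter 𝒜)
      twice : ∀ A → Twice word A

    finite : Finite (Letter 𝒜)
    finite = twice⇒finite word twice

  open NanowordOver using (word)

  Nanoword : Set (lsuc 0ℓ ⊔ a)
  Nanoword = Σ Alphabet NanowordOver

  infixl 6 _↾_ _∖_

  _↾_ : (𝒜 : Alphabet) → Pred (Letter 𝒜) 0ℓ → Alphabet
  𝒜 ↾ ℬ = record
    { Letter = Refinement (Letter 𝒜) ℬ
    ; label  = label 𝒜 ∘ value }

  _∖_ : (𝒜 : Alphabet) → Pred (Letter 𝒜) 0ℓ → Alphabet
  𝒜 ∖ ℬ = 𝒜 ↾ ∁ ℬ

  ⟪_⟫ : {L : Set} {ℬ : Pred L 0ℓ} → List (Refinement L ℬ) → List L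
  ⟪_⟫ = List.map value

  -- (𝒜 − {A}) ∪ {Ā}, where Ā = nothing
  shiftAlphabet : (𝒜 : Alphabet) → Letter 𝒜 → Alphabet
  shiftAlphabet 𝒜 A = record
    { Letter = Maybe (Letter (𝒜 ∖ ｛ A ｝))
    ; label  = maybe (label (𝒜 ∖ ｛ A ｝)) (τ (label 𝒜 A)) }

  interleave : ∀ {A : Set ℓ} {k} → Vec (List A) (suc k) → Vec (List A) k → List A
  interleave (x ∷ [])      []      = x
  interleave (x ∷ y ∷ xs)  (v ∷ vs) = x ++ v ++ interleave (y ∷ xs) vs

  record Factor {𝒜} (w : NanowordOver 𝒜) : Set₁ where
    field
      ℬ         : Pred (Letter 𝒜) 0ℓ
      k         : ℕ
      v         : Vec (List (Letter (𝒜 ↾ ℬ))) k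
      x         : Vec (List (Letter (𝒜 ∖ ℬ))) (suc k)
      v-twice   : ∀ B → Twice (concat (Vec.toList v)) B
      decompose : word w ≡ interleave (Vec.map ⟪_⟫ x) (Vec.map ⟪_⟫ v)

    Occurrence : Set
    Occurrence = Σ (Fin k) λ r → Fin (length (lookup v r))

    letterAt : Occurrence → Letter (𝒜 ↾ ℬ)
    letterAt (r , j) = List.lookup (lookup v r) j

    -- Letters of ℬ occur in w only inside the v_r, so this lexicographic order
    -- is the order of their occurrences in w.
    _⊑_ : Rel Occurrence 0ℓ
    (r , j) ⊑ (r′ , j′) = r Fin.< r′ ⊎ (r ≡ r′ × Fin.toℕ j ℕ.≤ Fin.toℕ j′)

    Leftmost : Pred Occurrence 0ℓ
    Leftmost o = ∀ o′ → letterAt o′ ≡ letterAt o → o ⊑ o′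

  record QuasiBridge {𝒜} (w : NanowordOver 𝒜) : Set₁ where
    field
      factor : Factor w
    open Factor factor public
    field
      k≥1          : 1 ℕ.≤ k
      κ            : Fin k → Fin k
      κ-involutive : Involutive _≡_ κ
      fixed-even   : ∀ r → κ r ≡ r → 2 ∣ length (lookup v r)
      ι            : Letter (𝒜 ↾ ℬ) → Letter (𝒜 ↾ ℬ)
      ι-reverses   : ∀ r → List.map ι (lookup v r) ≡ reverse (lookup v (κ r))

    length-κ : ∀ r → length (lookup v r) ≡ length (lookup v (κ r))
    length-κ r = trans (sym (Listₚ.length-map ι (lookup v r)))
      (trans (cong length (ι-reverses r)) (Listₚ.length-reverse (lookup v (κ r))))

    symmetric : Occurrence → Occurrence
    symmetric (r , j) = κ r , opposite (cast (length-κ r) j)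

    -- The number of 2-element orbits of κ; each is counted at its smaller
    -- element.
    arches : ℕ
    arches = length (List.filter (λ r → r Finₚ.<? κ r) (List.allFin k))

  record Bridge {𝒜} (w : NanowordOver 𝒜) : Set (lsuc 0ℓ ⊔ a) where
    field
      quasiBridge : QuasiBridge w
    open QuasiBridge quasiBridge public
    field
      -- |ι (B)| = τ^ε(B) (|B|), where o is the leftmost occurrence of B:
      -- ε(B) = 1 in labels₁ and ε(B) = 0 in labels₀.
      labels₁ : ∀ o → Leftmost o → Leftmost (symmetric o) →
                label (𝒜 ↾ ℬ) (ι (letterAt o)) ≡ τ (label (𝒜 ↾ ℬ) (letterAt o))
      labels₀ : ∀ o → Leftmost o → ¬ Leftmost (symmetric o) →
                label (𝒜 ↾ ℬ) (ι (letterAt o)) ≡ label (𝒜 ↾ ℬ) (letterAt o)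

  -- In homotopy₁, homotopy₂, shift and bridge, the words x, y, z (resp. x_r)
  -- are words in the letters that remain; ⟪_⟫ reads them as words in 𝒜.
  data Move : Nanoword → Nanoword → Set (lsuc 0ℓ ⊔ a) where

    isomorphism : ∀ {𝒜 𝒜′} {w : NanowordOver 𝒜} {w′ : NanowordOver 𝒜′}
      (f : Letter 𝒜 ↔ Letter 𝒜′) →
      (∀ A → label 𝒜′ (Inverse.to f A) ≡ label 𝒜 A) →
      word w′ ≡ List.map (Inverse.to f) (word w) →
      Move (𝒜 , w) (𝒜′ , w′)

    homotopy₁ : ∀ {𝒜 A} {w : NanowordOver 𝒜} {w′ : NanowordOver (𝒜 ∖ ｛ A ｝)} x y →
      word w  ≡ ⟪ x ⟫ ++ A ∷ A ∷ ⟪ y ⟫ →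
      word w′ ≡ x ++ y →
      Move (𝒜 , w) (_ , w′)

    homotopy₂ : ∀ {𝒜 A B} {w : NanowordOver 𝒜}
      {w′ : NanowordOver (𝒜 ∖ (｛ A ｝ ∪ ｛ B ｝))} x y z →
      label 𝒜 B ≡ τ (label 𝒜 A) →
      word w  ≡ ⟪ x ⟫ ++ A ∷ B ∷ ⟪ y ⟫ ++ B ∷ A ∷ ⟪ z ⟫ →
      word w′ ≡ x ++ y ++ z →
      Move (𝒜 , w) (_ , w′)

    homotopy₃ : ∀ {𝒜 A B C} {w w′ : NanowordOver 𝒜} x y z t →
      A ≢ B → A ≢ C → B ≢ C →
      label 𝒜 A ≡ label 𝒜 B → label 𝒜 B ≡ label 𝒜 C →
      word w  ≡ x ++ A ∷ B ∷ y ++ A ∷ C ∷ z ++ B ∷ C ∷ t →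
      word w′ ≡ x ++ B ∷ A ∷ y ++ C ∷ A ∷ z ++ C ∷ B ∷ t →
      Move (𝒜 , w) (𝒜 , w′)

    shift : ∀ {𝒜 A} {w : NanowordOver 𝒜} {w′ : NanowordOver (shiftAlphabet 𝒜 A)} x y →
      word w  ≡ A ∷ ⟪ x ⟫ ++ A ∷ ⟪ y ⟫ →
      word w′ ≡ List.map just x ++ nothing ∷ List.map just y ++ nothing ∷ [] →
      Move (𝒜 , w) (_ , w′)

    bridge : ∀ {𝒜} {w : NanowordOver 𝒜} (b : Bridge w)
      {w′ : NanowordOver (𝒜 ∖ Bridge.ℬ b)} →
      word w′ ≡ concat (Vec.toList (Bridge.x b)) →
      Move (𝒜 , w) (_ , w′)

  g : ∀ {w v} → Move w v → ℕ
  g (bridge b _) = Bridge.arches b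
  g _            = 0

  CircularMetamorphosis : Rel Nanoword (lsuc 0ℓ ⊔ a)
  CircularMetamorphosis = EqClosure Move

  totalArches : ∀ {w v} → CircularMetamorphosis w v → ℕ
  totalArches ε              = 0
  totalArches (fwd m ◅ rest) = g m ℕ.+ totalArches rest
  totalArches (bwd m ◅ rest) = g m ℕ.+ totalArches rest

  -- IsRhoWbr w v ρ states ρ = ρ_wbr (w , v).
  IsRhoWbr : Nanoword → Nanoword → Pred ℕ (lsuc 0ℓ ⊔ a)
  IsRhoWbr w v = IsMinimum ℕ._≤_ λ n →
    ∃ λ (m : CircularMetamorphosis w v) → totalArches m ≡ n

  -- The finite pointed set (S , s) is presented as S = S° ⊔ {s}.
  record Pairing : Set (lsuc 0ℓ ⊔ a) where
    field
      S°      : Set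
      finite° : Finite S°
      label°  : S° → α

    S : Set
    S = Maybe S°

    s : S
    s = nothing

    field
      e : S → S → Π

    finite : Finite S
    finite = Finite-Maybe finite°

    _≟_ : DecidableEquality S
    _≟_ = Finite⇒≟ finite

    ℤS : Set
    ℤS = S → ℤ

    δ : S → ℤS
    δ A B = if does (A ≟ B) then 1ℤ else 0ℤ

    ẽ : ℤS → ℤS → Π
    ẽ x y = ∑ finite λ A → ∑ finite λ B → (x A ℤ.* y B) · e A B

    data Short (x : ℤS) : Set a where
      letter  : ∀ A → x ≗ δ (just A) → Short x
      letter+ : ∀ A B → A ≢ B → label° A ≡ label° B →
                (∀ C → x C ≡ δ (just A) C ℤ.+ δ (just B) C) → Short x
      letter- : ∀ A B → A ≢ B → label° A ≡ τ (label° B) →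
                (∀ C → x C ≡ δ (just A) C ℤ.- δ (just B) C) → Short x

    record Filling : Set a where
      field
        size   : ℕ
        λs     : Fin size → ℤS
        i₀     : Fin size
        is-s   : λs i₀ ≗ δ s
        short  : ∀ i → i ≢ i₀ → Short (λs i)
        covers : ∀ A → ∃! _≡_ λ i → λs i (just A) ≢ 0ℤ

      gram : (Π → ℤ) → Matrix size size
      gram φ i j = φ (ẽ (λs i) (λs j)) ℚ./ 1

  open Pairing

  opposite-pairing : Pairing → Pairing
  opposite-pairing p = record
    { S° = S° p ; finite° = finite° p ; label° = label° p
    ; e = λ A B → -π e p A B }

  infixl 6 _⊕_

  _⊕_ : Pairing → Pairing → Pairing
  p₁ ⊕ p₂ = record
    { S°      = S° p₁ ⊎ S° p₂
    ; finite° = Finite-⊎ (finite° p₁) (finite° p₂)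
    ; label°  = [ label° p₁ , label° p₂ ]′
    ; e       = e⊕ }
    where
    e⊕ : Maybe (S° p₁ ⊎ S° p₂) → Maybe (S° p₁ ⊎ S° p₂) → Π
    e⊕ (just (inj₁ A)) (just (inj₁ B)) = e p₁ (just A) (just B)
    e⊕ (just (inj₁ A)) (just (inj₂ B)) = 0π
    e⊕ (just (inj₂ A)) (just (inj₁ B)) = 0π
    e⊕ (just (inj₂ A)) (just (inj₂ B)) = e p₂ (just A) (just B)
    e⊕ (just (inj₁ A)) nothing         = e p₁ (just A) (s p₁)
    e⊕ (just (inj₂ A)) nothing         = e p₂ (just A) (s p₂)
    e⊕ nothing         (just (inj₁ B)) = e p₁ (s p₁) (just B)
    e⊕ nothing         (just (inj₂ B)) = e p₂ (s p₂) (just B)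
    e⊕ nothing         nothing         = e p₁ (s p₁) (s p₁) +π e p₂ (s p₂) (s p₂)

  -- IsGenus φ p σ states σ = σ_φ (p).
  IsGenus : (Π → ℤ) → Pairing → Pred ℚ a
  IsGenus φ p = IsMinimum ℚ._≤_ λ q →
    ∃ λ (f : Filling p) → ∃ λ r →
      HasRank (Filling.gram f φ) r × ½ ℚ.* (+ r ℚ./ 1) ≡ q

  module _ {𝒜 : Alphabet} (w : NanowordOver 𝒜) where

    open NanowordOver w using (twice) renaming (finite to letters)

    private
      i j : (A : Letter 𝒜) → Fin (length (word w))
      i A = left (twice A)
      j A = right (twice A)

    n⟨_,_⟩ : Letter 𝒜 → Letter 𝒜 → ℤ
    n⟨ A , B ⟩ =
      if does ((i A Finₚ.<? i B) ×-dec (i B Finₚ.<? j A) ×-dec (j A Finₚ.<? j B)) then 1ℤ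
      else if does ((i B Finₚ.<? i A) ×-dec (i A Finₚ.<? j B) ×-dec (j B Finₚ.<? j A)) then -1ℤ
      else 0ℤ

    _∘ʷ_ : Letter 𝒜 → Letter 𝒜 → Π
    A ∘ʷ B = ∑ letters λ D →
      if does (((i A Finₚ.<? i D) ×-dec (i D Finₚ.<? j A)) ×-dec
               ((i B Finₚ.<? j D) ×-dec (j D Finₚ.<? j B)))
      then gen (label 𝒜 D) else 0π

    pairing-e : Maybe (Letter 𝒜) → Maybe (Letter 𝒜) → Π
    pairing-e (just A) (just B) =
      (+ 2) · ((A ∘ʷ B) +π -π (B ∘ʷ A)) +π n⟨ A , B ⟩ · (gen (label 𝒜 A) +π gen (label 𝒜 B))
    pairing-e (just A) nothing  = ∑ letters λ D → n⟨ A , D ⟩ · gen (label 𝒜 D)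
    pairing-e nothing  (just A) = -π ∑ letters λ D → n⟨ A , D ⟩ · gen (label 𝒜 D)
    pairing-e nothing  nothing  = 0π

  pairing : Nanoword → Pairing
  pairing (𝒜 , w) = record
    { S° = Letter 𝒜 ; finite° = NanowordOver.finite w ; label° = label 𝒜
    ; e = pairing-e w }

{-# OPTIONS --safe #-}
-- Fix φ.  A vector of ℤS determines an integer function on the positions of a nanoword, and twice the pairing
-- φẽ turns into an alternating form in the values of two such functions at the two occurrences of each letter.
-- The homotopy moves preserve this form on suitably matched functions, and so does the circular shift once a
-- multiple of s has been added.  A bridge move with g arches changes it, on the functions invariant under ι,
-- by a sum of 4g products of functionals.
--
-- Along a circular metamorphosis w → v the matching of letters composes to a partition of the letters of w and v
-- into classes of at most two elements, that is, to a filling of p(w) ⊕ p(v)⁻: a bridge move removes letters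
-- B, ι(B), and then the class of B is united with that of ι(B).  The multiples of s contributed by the shifts
-- cost two further products however many shifts there are.  So the Gram matrix of the filling has rank at most
-- 4ρ + 2, and its half is at most 2ρ + 1.
module Submission where

open import Defs
open import Level using (Level; 0ℓ; _⊔_)
open import Algebra.Bundles using (AbelianGroup)
open import Algebra.Definitions using (Involutive)
open import Algebra.Morphism.Structures using (module GroupMorphisms)
import Algebra.Properties.CommutativeMonoid.Sum as CommutativeMonoidSum
open import Data.Bool.Base using (true; false; if_then_else_)
open import Data.Empty using (⊥; ⊥-elim; ⊥-elim-irr)
open import Data.Fin.Base as Fin using (Fin; zero; suc; toℕ; opposite; cast; punchIn)
open import Data.Fin.Permutation using (permutation)
import Data.Fin.Properties as Finₚ
open import Data.Integer.Base as ℤ using (ℤ; 0ℤ; 1ℤ; -1ℤ)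
import Data.Integer.Properties as ℤₚ
open import Data.Integer.Tactic.RingSolver using (solve-∀)
open import Data.Irrelevant using (Irrelevant; [_])
open import Data.List.Base as List using (List; []; _∷_; _++_; concat; length; reverse; tabulate)
import Data.List.Properties as Listₚ
open import Data.List.Membership.Propositional using (_∈_; _∉_; find; lose)
import Data.List.Membership.Propositional.Properties as ∈ₚ
open import Data.List.Relation.Unary.All as All using (All; []; _∷_)
import Data.List.Relation.Unary.All.Properties as Allₚ
open import Data.List.Relation.Unary.Any as Any using (here; there; index)
import Data.List.Relation.Unary.Any.Properties as Anyₚ
open import Data.List.Relation.Unary.Unique.Propositional using (Unique)
import Data.List.Relation.Unary.Unique.DecPropositional.Properties as DecUniqueₚ
open import Data.Maybe.Base using (Maybe; just; nothing)
open import Data.Nat.Base as ℕ using (ℕ; zero; suc)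
import Data.Nat.Properties as ℕₚ
import Data.Nat.Tactic.RingSolver as ℕ-RingSolver
open import Data.Product using (Σ; ∃; ∃!; _×_; _,_; proj₁; proj₂)
open import Data.Rational.Base as ℚ using (ℚ)
import Data.Rational.Properties as ℚₚ
import Data.Rational.Unnormalised.Base as ℚᵘ
import Data.Rational.Unnormalised.Properties as ℚᵘₚ
open import Data.Refinement using (Refinement; value; proof; value-injective)
import Data.Refinement.Properties as Refinementₚ
open import Data.Sum.Base as Sum using (_⊎_; inj₁; inj₂)
import Data.Sum.Properties as Sumₚ
open import Data.Vec.Base as Vec using (Vec; []; _∷_)
import Data.Vec.Properties as Vecₚ
open import Function.Base using (_∘_; id)
open import Function.Bundles using (_↔_; Inverse)
open import Relation.Binary.Construct.Closure.ReflexiveTransitive using (ε; _◅_)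
open import Relation.Binary.Construct.Closure.Symmetric using (fwd; bwd)
open import Relation.Binary.Definitions using (DecidableEquality; tri<; tri≈; tri>)
open import Relation.Binary.PropositionalEquality hiding ([_])
open import Relation.Nullary using (¬_; Dec; yes; no; does; contradiction; recompute)
open import Relation.Nullary.Decidable using (dec-true; dec-false; decidable-stable; ¬?; _×-dec_; _⊎-dec_)
open import Relation.Unary using (_∪_; ｛_｝)

-- The signs shape the set-up. The vectors A, A + B, A - B are told apart by labels, but φ(|A|) is 1
-- or -1, so writing x(A) = φ(|A|)·z(A) turns each of them, up to an overall sign, into the
-- indicator function z of a class of letters. Matchings and ι-invariance can then be stated for
-- functions on letters without signs. The same units charge the occurrences, and the label
-- condition on ι(B) in a bridge then says exactly that symmetric occurrences carry opposite
-- charges: the symmetry reverses the sign of the form, which therefore vanishes on functions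
-- symmetric along the bridge.
--
-- The 4 per arch is 2·2. An arch makes a function deviate by one constant outside the bridge and by
-- one constant from symmetry inside it, and adding a multiple of one fixed functional to the
-- argument of a bilinear form costs two products.
--
-- Smallness of rank is expressed as a sum of N products f(a)·h(b) over an arbitrary parameter set,
-- with no linearity required. Such bounds pull back along any map of parameters, so the moves of a
-- metamorphosis can be composed although each comes with its own letters, its own invariance
-- condition and its own shift of the start value.

module Conditionals where

  if-yes : ∀ {p ℓ} {P : Set p} {A : Set ℓ} (d : Dec P) {x y : A} → P → (if does d then x else y) ≡ x
  if-yes d {x} {y} p = cong (λ b → if b then x else y) (dec-true d p)

  if-no : ∀ {p ℓ} {P : Set p} {A : Set ℓ} (d : Dec P) {x y : A} → ¬ P → (if does d then x else y) ≡ y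
  if-no d {x} {y} ¬p = cong (λ b → if b then x else y) (dec-false d ¬p)

-- Integer sums, sums over the orbits of an involution, integral linear systems.

module FiniteSums where

  open Conditionals

  import Algebra.Properties.Semiring.Sum ℤₚ.+-*-semiring as S
  open import Data.Integer.Base using (_+_; _*_; -_; _-_)

  private
    variable
      n : ℕ

  2ℤ : ℤ
  2ℤ = ℤ.+ 2

  -- Opaque, so that unification does not unfold sums over Fin n for unknown n.
  opaque

    sum : (Fin n → ℤ) → ℤ
    sum = S.sum

    sum-nil : (f : Fin 0 → ℤ) → sum f ≡ 0ℤ
    sum-nil f = refl

    sum-cons : (f : Fin (suc n) → ℤ) → sum f ≡ f zero + sum (f ∘ suc)
    sum-cons f = refl

    sum-cong : {f g : Fin n → ℤ} → f ≗ g → sum f ≡ sum g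
    sum-cong = S.sum-cong-≗

    sum-zero : {f : Fin n → ℤ} → (∀ i → f i ≡ 0ℤ) → sum f ≡ 0ℤ
    sum-zero {n} f≡0 = trans (S.sum-cong-≗ f≡0) (S.sum-replicate-zero n)

    sum-+ : (f g : Fin n → ℤ) → sum (λ i → f i + g i) ≡ sum f + sum g
    sum-+ = S.∑-distrib-+

    sum-*ˡ : (k : ℤ) (f : Fin n → ℤ) → sum (λ i → k * f i) ≡ k * sum f
    sum-*ˡ k f = sym (S.*-distribˡ-sum k f)

    sum-*ʳ : (k : ℤ) (f : Fin n → ℤ) → sum (λ i → f i * k) ≡ sum f * k
    sum-*ʳ k f = sym (S.*-distribʳ-sum k f)

    sum-comm : ∀ {m} (f : Fin m → Fin n → ℤ) → sum (λ i → sum (f i)) ≡ sum (λ j → sum λ i → f i j)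
    sum-comm = S.∑-comm

    sum-punchIn : (f : Fin (suc n) → ℤ) (i : Fin (suc n)) → sum f ≡ f i + sum (f ∘ punchIn i)
    sum-punchIn f i = S.sum-remove {i = i} f

  sum-single : (f : Fin n → ℤ) (i : Fin n) → (∀ j → j ≢ i → f j ≡ 0ℤ) → sum f ≡ f i
  sum-single {suc n} f i f≡0 = begin
    sum f                       ≡⟨ sum-punchIn f i ⟩
    f i + sum (f ∘ punchIn i)   ≡⟨ cong (λ s → f i + s) (sum-zero λ j → f≡0 _ (Finₚ.punchInᵢ≢i i j)) ⟩
    f i + 0ℤ                    ≡⟨ ℤₚ.+-identityʳ _ ⟩
    f i                         ∎
    where open ≡-Reasoning

  opaque
    unfolding sum

    sum-permute : (f : Fin n → ℤ) (κ : Fin n → Fin n) → Involutive _≡_ κ → sum f ≡ sum (f ∘ κ)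
    sum-permute f κ inv = S.sum-permute f (permutation κ κ inv inv)

  sum-filter : ∀ {ℓ} {A : Set ℓ} {P : A → Set} (P? : ∀ x → Dec (P x)) (f : Fin n → A) (H : A → ℤ) →
    sum (λ i → if does (P? (f i)) then H (f i) else 0ℤ) ≡
    sum (λ j → H (List.lookup (List.filter P? (tabulate f)) j))
  sum-filter {zero}  P? f H = trans (sum-nil _) (sym (sum-nil _))
  sum-filter {suc n} P? f H with P? (f zero) in eq
  ... | yes _ = trans (sum-cons _) (trans
    (cong₂ _+_ (cong (λ d → if does d then H (f zero) else 0ℤ) eq) (sum-filter P? (f ∘ suc) H)) (sym (sum-cons _)))
  ... | no _  = trans (sum-cons _) (trans
    (cong₂ _+_ (cong (λ d → if does d then H (f zero) else 0ℤ) eq) (sum-filter P? (f ∘ suc) H)) (ℤₚ.+-identityˡ _))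

  module _ (κ : Fin n → Fin n) (κ-involutive : Involutive _≡_ κ) where

    -- The same filter as in `arches`, so that its length is the number of arches by definition.
    ascents : List (Fin n)
    ascents = List.filter (λ r → r Finₚ.<? κ r) (List.allFin n)

    ascent : Fin (length ascents) → Fin n
    ascent = List.lookup ascents

    -- Each term goes to `up` or to `down` according to whether its index is the smaller or the
    -- larger one of its orbit; reindexing `down` by `κ` brings both to the smaller index.
    sum-orbits : (F : Fin n → ℤ) → (∀ r → κ r ≡ r → F r ≡ 0ℤ) →
                 sum F ≡ sum (λ j → F (ascent j) + F (κ (ascent j)))
    sum-orbits F F≡0 = begin
      sum F                                     ≡⟨ sum-cong split ⟩
      sum (λ r → up r + down r)                 ≡⟨ sum-+ up down ⟩
      sum up + sum down                         ≡⟨ cong (λ x → sum up + x) (sum-permute down κ κ-involutive) ⟩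
      sum up + sum (down ∘ κ)                   ≡⟨ sum-+ up (down ∘ κ) ⟨
      sum (λ r → up r + down (κ r))             ≡⟨ sum-cong join ⟩
      sum (λ r → if does (r Finₚ.<? κ r) then F r + F (κ r) else 0ℤ)
        ≡⟨ sum-filter (λ r → r Finₚ.<? κ r) id (λ r → F r + F (κ r)) ⟩
      sum (λ j → F (ascent j) + F (κ (ascent j))) ∎
      where
      open ≡-Reasoning
      up down : Fin n → ℤ
      up r   = if does (r Finₚ.<? κ r) then F r else 0ℤ
      down r = if does (κ r Finₚ.<? r) then F r else 0ℤ
      split : ∀ r → F r ≡ up r + down r
      split r with Finₚ.<-cmp r (κ r)
      ... | tri< p _ ¬q = sym (trans (cong₂ _+_ (if-yes (r Finₚ.<? κ r) p) (if-no (κ r Finₚ.<? r) ¬q)) (ℤₚ.+-identityʳ (F r)))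
      ... | tri≈ ¬p e ¬q = trans (F≡0 r (sym e)) (sym (cong₂ _+_ (if-no (r Finₚ.<? κ r) ¬p) (if-no (κ r Finₚ.<? r) ¬q)))
      ... | tri> ¬p _ q = sym (trans (cong₂ _+_ (if-no (r Finₚ.<? κ r) ¬p) (if-yes (κ r Finₚ.<? r) q)) (ℤₚ.+-identityˡ (F r)))
      join : ∀ r → up r + down (κ r) ≡ (if does (r Finₚ.<? κ r) then F r + F (κ r) else 0ℤ)
      join r rewrite κ-involutive r = split-if (r Finₚ.<? κ r)
        where
        split-if : (d : Dec (r Fin.< κ r)) → (if does d then F r else 0ℤ) + (if does d then F (κ r) else 0ℤ) ≡
                   (if does d then F r + F (κ r) else 0ℤ)
        split-if (yes _) = refl
        split-if (no _)  = refl

    -- An odd coefficient vanishes where `κ` is fixed. This is why the factors of a bridge with κ(r)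
    -- = r cost nothing and only arches are counted.
    sum-odd : (a G : Fin n → ℤ) → (∀ r → a (κ r) ≡ - a r) →
              sum (λ r → a r * G r) ≡ sum (λ j → a (ascent j) * (G (ascent j) - G (κ (ascent j))))
    sum-odd a G odd = trans
      (sum-orbits (λ r → a r * G r) (λ r fix → cong (_* G r) (self-neg (a r) (trans (cong a (sym fix)) (odd r)))))
      (sum-cong λ j → trans (cong (λ x → a (ascent j) * G (ascent j) + x * G (κ (ascent j))) (odd (ascent j)))
                            (factor (a (ascent j)) (G (ascent j)) (G (κ (ascent j)))))
      where
      self-neg : ∀ x → x ≡ - x → x ≡ 0ℤ
      self-neg (ℤ.+ zero) _ = refl
      factor : ∀ a g h → a * g + - a * h ≡ a * (g - h)
      factor = solve-∀

  -- Fraction-free Gaussian elimination: fewer equations than unknowns leave a nonzero solution, and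
  -- avoiding division keeps it integral.
  kernel : ∀ {n r} (M : Fin n → Fin r → ℤ) → n ℕ.< r →
           ∃ λ (c : Fin r → ℤ) → (∃ λ i → c i ≢ 0ℤ) × (∀ k → sum (λ i → c i * M k i) ≡ 0ℤ)
  kernel {zero}  {suc r} M _ = (λ _ → 1ℤ) , (zero , λ ()) , λ ()
  kernel {suc n} {suc r} M (ℕ.s≤s n<r) with Finₚ.all? (λ i → M zero i ℤₚ.≟ 0ℤ)
  ... | yes M₀≡0 with kernel (M ∘ suc) (ℕₚ.m<n⇒m<1+n n<r)
  ...   | c , c≢0 , eqs = c , c≢0 , λ where
    zero    → sum-zero λ i → trans (cong (c i *_) (M₀≡0 i)) (ℤₚ.*-zeroʳ (c i))
    (suc k) → eqs k
  kernel {suc n} {suc r} M (ℕ.s≤s n<r) | no ¬M₀≡0 with Finₚ.¬∀⟶∃¬ _ _ (λ i → M zero i ℤₚ.≟ 0ℤ) ¬M₀≡0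
  -- With the pivot m = `M zero p`, cross-multiplication clears column `p` from the other rows. A
  -- solution `c` of the smaller system is lifted by scaling it by m and solving row `zero` for the
  -- unknown at `p`, which gives `- T`; it stays nonzero because m is.
  ... | p , Mp≢0 with kernel (λ k i → M zero p * M (suc k) (punchIn p i) - M (suc k) p * M zero (punchIn p i)) n<r
  ...   | c , (i₀ , ci₀≢0) , eqs = c′ , (punchIn p i₀ , c′i₀≢0) , eqs′
    where
    m : ℤ
    m = M zero p
    T : ℤ
    T = sum (λ i → c i * M zero (punchIn p i))
    c′ : Fin (suc r) → ℤ
    c′ i with p Finₚ.≟ i
    ... | yes _  = - T
    ... | no p≢i = m * c (Fin.punchOut p≢i)
    c′-p : c′ p ≡ - T
    c′-p with p Finₚ.≟ p
    ... | yes _  = refl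
    ... | no p≢p = contradiction refl p≢p
    c′-in : ∀ i → c′ (punchIn p i) ≡ m * c i
    c′-in i with p Finₚ.≟ punchIn p i
    ... | yes eq = contradiction (sym eq) (Finₚ.punchInᵢ≢i p i)
    ... | no p≢  = cong (λ j → m * c j) (trans (Finₚ.punchOut-cong p refl) (Finₚ.punchOut-punchIn p))
    c′i₀≢0 : c′ (punchIn p i₀) ≢ 0ℤ
    c′i₀≢0 eq with ℤₚ.i*j≡0⇒i≡0∨j≡0 m (trans (sym (c′-in i₀)) eq)
    ... | inj₁ m≡0 = Mp≢0 m≡0
    ... | inj₂ c≡0 = ci₀≢0 c≡0
    expand : ∀ k → sum (λ i → c′ i * M k i) ≡ m * sum (λ i → c i * M k (punchIn p i)) - T * M k p
    expand k = begin
      sum (λ i → c′ i * M k i)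
        ≡⟨ sum-punchIn _ p ⟩
      c′ p * M k p + sum (λ i → c′ (punchIn p i) * M k (punchIn p i))
        ≡⟨ cong₂ _+_ (cong (_* M k p) c′-p)
             (trans (sum-cong (λ i → trans (cong (_* M k (punchIn p i)) (c′-in i))
                                             (ℤₚ.*-assoc m (c i) _)))
                    (sum-*ˡ m _)) ⟩
      - T * M k p + m * sum (λ i → c i * M k (punchIn p i))
        ≡⟨ swap T (M k p) _ ⟩
      m * sum (λ i → c i * M k (punchIn p i)) - T * M k p ∎
      where
      open ≡-Reasoning
      swap : ∀ t a b → - t * a + b ≡ b - t * a
      swap = solve-∀
    eqs′ : ∀ k → sum (λ i → c′ i * M k i) ≡ 0ℤ
    eqs′ zero    = trans (expand zero) (cancel m T)
      where
      cancel : ∀ m t → m * t - t * m ≡ 0ℤ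
      cancel = solve-∀
    eqs′ (suc k) = begin
      sum (λ i → c′ i * M (suc k) i)
        ≡⟨ expand (suc k) ⟩
      m * sum (λ i → c i * M (suc k) (punchIn p i)) - T * b
        ≡⟨ rearrange (m * sum (λ i → c i * M (suc k) (punchIn p i))) T b ⟩
      m * sum (λ i → c i * M (suc k) (punchIn p i)) + (- b) * T
        ≡⟨ cong₂ _+_ (sym (sum-*ˡ m _)) (sym (sum-*ˡ (- b) _)) ⟩
      sum (λ i → m * (c i * M (suc k) (punchIn p i))) + sum (λ i → (- b) * (c i * M zero (punchIn p i)))
        ≡⟨ sym (sum-+ (λ i → m * (c i * M (suc k) (punchIn p i))) _) ⟩
      sum (λ i → m * (c i * M (suc k) (punchIn p i)) + (- b) * (c i * M zero (punchIn p i)))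
        ≡⟨ sum-cong (λ i → collect m b (c i) (M (suc k) (punchIn p i)) (M zero (punchIn p i))) ⟩
      sum (λ i → c i * (m * M (suc k) (punchIn p i) - b * M zero (punchIn p i)))
        ≡⟨ eqs k ⟩
      0ℤ ∎
      where
      open ≡-Reasoning
      b : ℤ
      b = M (suc k) p
      rearrange : ∀ x t b → x - t * b ≡ x + (- b) * t
      rearrange = solve-∀
      collect : ∀ m b c x y → m * (c * x) + (- b) * (c * y) ≡ c * (m * x - b * y)
      collect = solve-∀

-- Forms that are sums of few products.

module LowRank where

  open FiniteSums
  open import Data.Integer.Base using (_+_; _*_; -_; _-_)

  private
    variable
      ℓ : Level
      A B : Set ℓ
      m n : ℕ

  -- An upper bound for a rank, over parameters without any linear structure; the factors `f` and
  -- `h` are arbitrary functions.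
  data Low {A : Set ℓ} : ℕ → (A → A → ℤ) → Set ℓ where
    low-zero : ∀ {F} → (∀ a b → F a b ≡ 0ℤ) → Low 0 F
    low-suc  : ∀ {n F G} (f h : A → ℤ) → Low n G → (∀ a b → F a b ≡ f a * h b + G a b) → Low (suc n) F

  low-cong : {F G : A → A → ℤ} → (∀ a b → F a b ≡ G a b) → Low n G → Low n F
  low-cong eq (low-zero z)      = low-zero λ a b → trans (eq a b) (z a b)
  low-cong eq (low-suc f h l e) = low-suc f h l λ a b → trans (eq a b) (e a b)

  low-+ : {F G : A → A → ℤ} → Low m F → Low n G → Low (m ℕ.+ n) (λ a b → F a b + G a b)
  low-+ (low-zero z)      l′ = low-cong (λ a b → trans (cong (_+ _) (z a b)) (ℤₚ.+-identityˡ _)) l′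
  low-+ (low-suc f h l e) l′ = low-suc f h (low-+ l l′) λ a b →
    trans (cong (_+ _) (e a b)) (ℤₚ.+-assoc (f a * h b) _ _)

  low-* : (k : ℤ) {F : A → A → ℤ} → Low n F → Low n (λ a b → k * F a b)
  low-* k (low-zero z)      = low-zero λ a b → trans (cong (k *_) (z a b)) (ℤₚ.*-zeroʳ k)
  low-* k (low-suc f h l e) = low-suc (λ a → k * f a) h (low-* k l) λ a b →
    trans (cong (k *_) (e a b)) (distrib k (f a) (h b) _)
    where
    distrib : ∀ k x y z → k * (x * y + z) ≡ k * x * y + k * z
    distrib = solve-∀

  low-pull : (θ : B → A) {F : A → A → ℤ} → Low n F → Low n (λ a b → F (θ a) (θ b))
  low-pull θ (low-zero z)      = low-zero λ a b → z (θ a) (θ b)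
  low-pull θ (low-suc f h l e) = low-suc (f ∘ θ) (h ∘ θ) (low-pull θ l) λ a b → e (θ a) (θ b)

  -- The left factors of the products act as test functions: a combination that all of them
  -- annihilate is annihilated by every product.
  low-comb : {F : A → A → ℤ} → Low n F →
             ∃ λ (fs : Fin n → A → ℤ) → ∀ {r} (c : Fin r → ℤ) (x : Fin r → A) →
             (∀ k → sum (λ i → c i * fs k (x i)) ≡ 0ℤ) → ∀ b → sum (λ i → c i * F (x i) b) ≡ 0ℤ
  low-comb (low-zero z) = (λ ()) , λ c x _ b →
    sum-zero λ i → trans (cong (c i *_) (z (x i) b)) (ℤₚ.*-zeroʳ (c i))
  low-comb {A = A} {F = F} (low-suc {n} {G = G} f h l e) with low-comb l
  ... | fs , comb = fs′ , λ c x eqs b → begin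
    sum (λ i → c i * F (x i) b)
      ≡⟨ sum-cong (λ i → trans (cong (c i *_) (e (x i) b)) (distrib (c i) (f (x i)) (h b) _)) ⟩
    sum (λ i → c i * f (x i) * h b + c i * G (x i) b)
      ≡⟨ sum-+ (λ i → c i * f (x i) * h b) _ ⟩
    sum (λ i → c i * f (x i) * h b) + sum (λ i → c i * G (x i) b)
      ≡⟨ cong₂ _+_ (trans (sum-*ʳ (h b) _) (cong (_* h b) (eqs zero))) (comb c x (eqs ∘ suc) b) ⟩
    0ℤ * h b + 0ℤ ∎
    where
    open ≡-Reasoning
    fs′ : Fin (suc n) → A → ℤ
    fs′ zero    = f
    fs′ (suc k) = fs k
    distrib : ∀ c x y z → c * (x * y + z) ≡ c * x * y + c * z
    distrib = solve-∀

  -- The `n` test functions impose `n` linear conditions on more than `n` coefficients.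
  low-dependent : {F : A → A → ℤ} → Low n F → ∀ {r} (x : Fin r → A) → n ℕ.< r →
                  ∃ λ (c : Fin r → ℤ) → (∃ λ i → c i ≢ 0ℤ) × (∀ b → sum (λ i → c i * F (x i) b) ≡ 0ℤ)
  low-dependent l x n<r with low-comb l
  ... | fs , comb with kernel (λ k i → fs k (x i)) n<r
  ...   | c , c≢0 , eqs = c , c≢0 , comb c x eqs

  low-sum : ∀ {n} (f h : Fin n → A → ℤ) → Low n (λ a b → sum λ j → f j a * h j b)
  low-sum {n = zero}  f h = low-zero λ a b → sum-nil _
  low-sum {n = suc n} f h = low-suc (f zero) (h zero) (low-sum (f ∘ suc) (h ∘ suc)) λ a b → sum-cons _

-- Charged words and the alternating form on functions along them.

-- The integer in an occurrence is its charge: in the word of a nanoword the left occurrence of a letter A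
-- has charge φ(|A|), the right one -φ(|A|).
module ChargedWords {L : Set} (_≟_ : DecidableEquality L) where

  open FiniteSums
  open import Data.Integer.Base using (_+_; _*_; -_; _-_)

  Occ : Set
  Occ = L × ℤ

  private
    variable
      P Q : L → Set
      s t : List Occ
      z z′ : L → ℤ
      f g : Occ → ℤ

  δ : L → L → ℤ
  δ A B = if does (A ≟ B) then 1ℤ else 0ℤ

  δ-refl : ∀ A → δ A A ≡ 1ℤ
  δ-refl A with A ≟ A
  ... | yes _ = refl
  ... | no ¬e = contradiction refl ¬e

  δ-≢ : ∀ {A B} → A ≢ B → δ A B ≡ 0ℤ
  δ-≢ {A} {B} ¬e with A ≟ B
  ... | yes e = contradiction e ¬e
  ... | no _  = refl

  -- Zero except between the two occurrences of one letter, where charges `q` and `- q` give ±2q.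
  -- Extended bilinearly it is a sum of area forms, one for each letter, weighted by the charges.
  ω : Occ → Occ → ℤ
  ω (A , p) (B , q) = δ A B * (p - q)

  -- A formal combination of occurrences, known only through its action on functions of occurrences.
  -- Combinations that differ in the order or grouping of their terms thus agree under `_≋_`, and
  -- the occurrences of a word can be collected letter by letter.
  record Functional : Set where
    no-eta-equality
    field
      ap      : (Occ → ℤ) → ℤ
      ap-cong : ∀ {f g} → f ≗ g → ap f ≡ ap g
      ap-+    : ∀ f g → ap (λ o → f o + g o) ≡ ap f + ap g
      ap-*    : ∀ k f → ap (λ o → k * f o) ≡ k * ap f

    ap-0 : (∀ o → f o ≡ 0ℤ) → ap f ≡ 0ℤ
    ap-0 {f = f} f≡0 = trans (ap-cong f≡0) (ap-* 0ℤ (λ _ → 0ℤ))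

    ap-neg : ∀ f → ap (λ o → - f o) ≡ - ap f
    ap-neg f = trans (ap-cong (λ o → sym (ℤₚ.-1*i≡-i (f o))))
      (trans (ap-* -1ℤ f) (ℤₚ.-1*i≡-i (ap f)))

    ap-sum : ∀ {n} (F : Fin n → Occ → ℤ) → ap (λ o → sum λ i → F i o) ≡ sum (λ i → ap (F i))
    ap-sum {zero}  F = trans (ap-0 (λ o → sum-nil _)) (sym (sum-nil _))
    ap-sum {suc n} F = trans (ap-cong (λ o → sum-cons (λ i → F i o)))
      (trans (ap-+ (F zero) _)
        (trans (cong (λ x → ap (F zero) + x) (ap-sum (F ∘ suc))) (sym (sum-cons (λ i → ap (F i))))))

  open Functional

  infix 4 _≋_
  infixl 6 _⊞_

  record _≋_ (X Y : Functional) : Set where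
    constructor ap-≡
    field
      ap≡ : ∀ f → ap X f ≡ ap Y f

  open _≋_ public

  _⊞_ : Functional → Functional → Functional
  (X ⊞ Y) .ap f = ap X f + ap Y f
  (X ⊞ Y) .ap-cong e = cong₂ _+_ (ap-cong X e) (ap-cong Y e)
  (X ⊞ Y) .ap-* k f = trans (cong₂ _+_ (ap-* X k f) (ap-* Y k f)) (sym (ℤₚ.*-distribˡ-+ k (ap X f) (ap Y f)))
  (X ⊞ Y) .ap-+ f g = trans (cong₂ _+_ (ap-+ X f g) (ap-+ Y f g)) (mid (ap X f) (ap X g) (ap Y f) (ap Y g))
    where
    mid : ∀ a b c d → a + b + (c + d) ≡ a + c + (b + d)
    mid = solve-∀

  ⨁ : ∀ {n} → (Fin n → Functional) → Functional
  (⨁ X) .ap f = sum λ i → ap (X i) f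
  (⨁ X) .ap-cong e = sum-cong λ i → ap-cong (X i) e
  (⨁ X) .ap-+ f g = trans (sum-cong λ i → ap-+ (X i) f g) (sum-+ (λ i → ap (X i) f) _)
  (⨁ X) .ap-* k f = trans (sum-cong λ i → ap-* (X i) k f) (sum-*ˡ k _)

  record Supported (P : L → Set) (X : Functional) : Set where
    constructor vanishing
    field
      vanish : ∀ f → (∀ A q → P A → f (A , q) ≡ 0ℤ) → ap X f ≡ 0ℤ

  open Supported public

  supported-⊞ : ∀ {X Y} → Supported P X → Supported P Y → Supported P (X ⊞ Y)
  supported-⊞ sX sY .vanish f v = cong₂ _+_ (vanish sX f v) (vanish sY f v)

  supported-⨁ : ∀ {n} {X : Fin n → Functional} → (∀ i → Supported P (X i)) → Supported P (⨁ X)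
  supported-⨁ sX .vanish f v = sum-zero λ i → vanish (sX i) f v

  supported-⊆ : ∀ {X} → (∀ {A} → P A → Q A) → Supported P X → Supported Q X
  supported-⊆ sub sX .vanish f v = vanish sX f (λ A q PA → v A q (sub PA))

  opaque

    ⟪_,_⟫ : Functional → Functional → ℤ
    ⟪ X , Y ⟫ = ap X (λ o → ap Y (ω o))

    ⟪⟫-cong : ∀ {X X′ Y Y′} → X ≋ X′ → Y ≋ Y′ → ⟪ X , Y ⟫ ≡ ⟪ X′ , Y′ ⟫
    ⟪⟫-cong {X} eX eY = trans (ap-cong X λ o → ap≡ eY (ω o)) (ap≡ eX _)

    ⟪⟫-disjoint : ∀ {X Y} → Supported P X → Supported Q Y → (∀ {A} → P A → Q A → ⊥) → ⟪ X , Y ⟫ ≡ 0ℤ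
    ⟪⟫-disjoint sX sY dis = vanish sX _ λ A p PA → vanish sY _ λ B q QB →
      cong (_* (p - q)) (δ-≢ λ { refl → dis PA QB })

    ⟪⟫-⊞ : ∀ X X′ Y Y′ → ⟪ X ⊞ Y , X′ ⊞ Y′ ⟫ ≡ ⟪ X , X′ ⟫ + ⟪ X , Y′ ⟫ + (⟪ Y , X′ ⟫ + ⟪ Y , Y′ ⟫)
    ⟪⟫-⊞ X X′ Y Y′ = cong₂ _+_ (ap-+ X _ _) (ap-+ Y _ _)

    ⟪⟫-def : ∀ X Y → ⟪ X , Y ⟫ ≡ ap X (λ o → ap Y (ω o))
    ⟪⟫-def X Y = refl

  ⟪⟫-orthogonal : ∀ {X X′ Y Y′} → Supported P X → Supported P X′ → Supported Q Y → Supported Q Y′ →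
                  (∀ {A} → P A → Q A → ⊥) → ⟪ X ⊞ Y , X′ ⊞ Y′ ⟫ ≡ ⟪ X , X′ ⟫ + ⟪ Y , Y′ ⟫
  ⟪⟫-orthogonal {X = X} {X′} {Y} {Y′} sX sX′ sY sY′ dis = trans (⟪⟫-⊞ X X′ Y Y′)
    (trans (cong₂ (λ u v → ⟪ X , X′ ⟫ + u + (v + ⟪ Y , Y′ ⟫))
              (⟪⟫-disjoint sX sY′ dis) (⟪⟫-disjoint sY sX′ λ QA PA → dis PA QA))
      (drop ⟪ X , X′ ⟫ ⟪ Y , Y′ ⟫))
    where
    drop : ∀ a b → a + 0ℤ + (0ℤ + b) ≡ a + b
    drop = solve-∀

  -- The contribution of a single letter to `V`, with the values `u` and `v` of the function at its
  -- two occurrences.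
  duo : L → ℤ → ℤ → ℤ → Functional
  duo A q u v .ap f = u * f (A , q) + v * f (A , - q)
  duo A q u v .ap-cong e = cong₂ (λ x y → u * x + v * y) (e _) (e _)
  duo A q u v .ap-+ f g = add u v (f (A , q)) (g (A , q)) (f (A , - q)) (g (A , - q))
    where
    add : ∀ u v a b c d → u * (a + b) + v * (c + d) ≡ u * a + v * c + (u * b + v * d)
    add = solve-∀
  duo A q u v .ap-* k f = mul u v k (f (A , q)) (f (A , - q))
    where
    mul : ∀ u v k a b → u * (k * a) + v * (k * b) ≡ k * (u * a + v * b)
    mul = solve-∀

  duo-supported : ∀ A q u v → Supported (_≡ A) (duo A q u v)
  duo-supported A q u v .vanish f f≡0 = trans
    (cong₂ (λ x y → u * x + v * y) (f≡0 A q refl) (f≡0 A (- q) refl))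
    (cong₂ _+_ (ℤₚ.*-zeroʳ u) (ℤₚ.*-zeroʳ v))

  -- The determinant of the values at the two occurrences; the factor 2q is the difference of the
  -- charges.
  ⟪duo,duo⟫ : ∀ A q u v u′ v′ → ⟪ duo A q u v , duo A q u′ v′ ⟫ ≡ 2ℤ * q * (u * v′ - v * u′)
  ⟪duo,duo⟫ A q u v u′ v′ = trans (⟪⟫-def (duo A q u v) (duo A q u′ v′)) (trans
    (cong (λ d → u * (u′ * (d * (q - q)) + v′ * (d * (q - - q)))
               + v * (u′ * (d * (- q - q)) + v′ * (d * (- q - - q)))) (δ-refl A))
    (expand q u v u′ v′))
    where
    expand : ∀ q u v u′ v′ →
      u * (u′ * (1ℤ * (q - q)) + v′ * (1ℤ * (q - - q))) + v * (u′ * (1ℤ * (- q - q)) + v′ * (1ℤ * (- q - - q)))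
      ≡ 2ℤ * q * (u * v′ - v * u′)
    expand = solve-∀

  total : (L → ℤ) → List Occ → ℤ
  total z []            = 0ℤ
  total z ((A , q) ∷ s) = q * z A + total z s

  mass : List Occ → (Occ → ℤ) → ℤ
  mass []      f = 0ℤ
  mass (o ∷ s) f = f o + mass s f

  -- A vector c·s + ∑ x(A)·A of ℤS gives the integer function on the positions of the word that starts
  -- at c, jumps by 2x(A) at the left and by -2x(A) at the right occurrence of A, and takes the mean value
  -- at the jumps.  Here x(A) = φ(|A|)·z(A), so that every jump is charge times 2z(A).
  val : (L → ℤ) → ℤ → List Occ → (Occ → ℤ) → ℤ
  val z c []            f = 0ℤ
  val z c ((A , q) ∷ s) f = (c + q * z A) * f (A , q) + val z (c + 2ℤ * (q * z A)) s f

  val-cong : z ≗ z′ → ∀ c s → f ≗ g → val z c s f ≡ val z′ c s g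
  val-cong e c []            e′ = refl
  val-cong {z} {z′} {f} {g} e c ((A , q) ∷ s) e′ rewrite e A =
    cong₂ (λ x y → (c + q * z′ A) * x + y) (e′ (A , q)) (val-cong e _ s e′)

  val-+ : ∀ z c s f g → val z c s (λ o → f o + g o) ≡ val z c s f + val z c s g
  val-+ z c []            f g = refl
  val-+ z c ((A , q) ∷ s) f g = trans
    (cong ((c + q * z A) * (f (A , q) + g (A , q)) +_) (val-+ z _ s f g))
    (regroup (c + q * z A) (f (A , q)) (g (A , q)) _ _)
    where
    regroup : ∀ c x y v w → c * (x + y) + (v + w) ≡ c * x + v + (c * y + w)
    regroup = solve-∀

  val-* : ∀ z c s k f → val z c s (λ o → k * f o) ≡ k * val z c s f
  val-* z c []            k f = sym (ℤₚ.*-zeroʳ k)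
  val-* z c ((A , q) ∷ s) k f = trans
    (cong ((c + q * z A) * (k * f (A , q)) +_) (val-* z _ s k f))
    (regroup (c + q * z A) k (f (A , q)) _)
    where
    regroup : ∀ c k x v → c * (k * x) + k * v ≡ k * (c * x + v)
    regroup = solve-∀

  V : (L → ℤ) → ℤ → List Occ → Functional
  V z c s .ap      = val z c s
  V z c s .ap-cong = val-cong (λ _ → refl) c s
  V z c s .ap-+    = val-+ z c s
  V z c s .ap-*    = val-* z c s

  V-supported : ∀ z c → All (P ∘ proj₁) s → Supported P (V z c s)
  V-supported z c [] .vanish f f≡0 = refl
  V-supported z c (_∷_ {(A , q)} {s} PA Ps) .vanish f f≡0 = cong₂ _+_
    (trans (cong ((c + q * z A) *_) (f≡0 A q PA)) (ℤₚ.*-zeroʳ (c + q * z A)))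
    (V-supported z _ Ps .vanish f f≡0)

  massF : List Occ → Functional
  massF s .ap         = mass s
  massF [] .ap-cong e = refl
  massF (o ∷ s) .ap-cong e = cong₂ _+_ (e o) (massF s .ap-cong e)
  massF [] .ap-+ f g  = refl
  massF (o ∷ s) .ap-+ f g = trans (cong (f o + g o +_) (massF s .ap-+ f g)) (mid (f o) (g o) _ _)
    where
    mid : ∀ a b c d → a + b + (c + d) ≡ a + c + (b + d)
    mid = solve-∀
  massF [] .ap-* k f  = sym (ℤₚ.*-zeroʳ k)
  massF (o ∷ s) .ap-* k f = trans (cong (k * f o +_) (massF s .ap-* k f)) (sym (ℤₚ.*-distribˡ-+ k (f o) _))

  total-++ : ∀ z s t → total z (s ++ t) ≡ total z s + total z t
  total-++ z []            t = sym (ℤₚ.+-identityˡ _)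
  total-++ z ((A , q) ∷ s) t = trans (cong (q * z A +_) (total-++ z s t)) (sym (ℤₚ.+-assoc (q * z A) _ _))

  val-++ : ∀ z c s t f → val z c (s ++ t) f ≡ val z c s f + val z (c + 2ℤ * total z s) t f
  val-++ z c []            t f = trans (cong (λ d → val z d t f) (plus0 c)) (sym (ℤₚ.+-identityˡ _))
    where
    plus0 : ∀ c → c ≡ c + 2ℤ * 0ℤ
    plus0 = solve-∀
  val-++ z c ((A , q) ∷ s) t f = trans
    (cong ((c + q * z A) * f (A , q) +_)
      (trans (val-++ z _ s t f)
        (cong (λ d → val z (c + 2ℤ * (q * z A)) s f + val z d t f) (state c (q * z A) (total z s)))))
    (sym (ℤₚ.+-assoc ((c + q * z A) * f (A , q)) _ _))
    where
    state : ∀ c x y → c + 2ℤ * x + 2ℤ * y ≡ c + 2ℤ * (x + y)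
    state = solve-∀

  -- Jumps do not depend on the start value, so a change of it raises the whole function by a
  -- constant. Bridges and shifts enter only through such constants, each of which costs one
  -- multiple of `massF`.
  val-shift : ∀ z c d s f → val z (c + d) s f ≡ val z c s f + d * mass s f
  val-shift z c d []            f = sym (trans (ℤₚ.+-identityˡ _) (ℤₚ.*-zeroʳ d))
  val-shift z c d ((A , q) ∷ s) f = trans
    (cong ((c + d + q * z A) * f (A , q) +_)
      (trans (cong (λ e → val z e s f) (state c d (q * z A))) (val-shift z _ d s f)))
    (regroup c d (q * z A) (f (A , q)) _ _)
    where
    state : ∀ c d x → c + d + 2ℤ * x ≡ c + 2ℤ * x + d
    state = solve-∀
    regroup : ∀ c d x y v m → (c + d + x) * y + (v + d * m) ≡ (c + x) * y + v + d * (y + m)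
    regroup = solve-∀

  form : List Occ → (L → ℤ) → ℤ → (L → ℤ) → ℤ → ℤ
  form s z c z′ c′ = ⟪ V z c s , V z′ c′ s ⟫

  form-cong : ∀ s {z₁ z₂ z₁′ z₂′ : L → ℤ} c c′ → z₁ ≗ z₂ → z₁′ ≗ z₂′ → form s z₁ c z₁′ c′ ≡ form s z₂ c z₂′ c′
  form-cong s c c′ e e′ = ⟪⟫-cong (ap-≡ λ f → val-cong e c s λ _ → refl) (ap-≡ λ f → val-cong e′ c′ s λ _ → refl)

-- Invariance of the form under the homotopy moves and under rotation.

module ChargedHomotopy {L : Set} (_≟_ : DecidableEquality L) where

  open ChargedWords _≟_
  open import Data.Integer.Base using (_+_; _*_; -_; _-_)

  open FiniteSums using (2ℤ)

  Avoids : List L → List Occ → Set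
  Avoids ls = All λ o → proj₁ o ∉ ls

  module _ (A : L) (q : ℤ) {U V′ : List Occ} (aU : Avoids (A ∷ []) U) (aV : Avoids (A ∷ []) V′) where

    private
      word : List Occ
      word = U ++ (A , q) ∷ (A , - q) ∷ V′
      duo₁ : (L → ℤ) → ℤ → Functional
      duo₁ z c = duo A q u u
        where u = c + 2ℤ * total z U + q * z A
      split : ∀ z c → V z c word ≋ V z c (U ++ V′) ⊞ duo₁ z c
      split z c .ap≡ f = begin
        val z c word f
          ≡⟨ val-++ z c U _ f ⟩
        val z c U f + ((c₁ + q * z A) * f (A , q) + ((c₁ + 2ℤ * (q * z A) + - q * z A) * f (A , - q)
          + val z (c₁ + 2ℤ * (q * z A) + 2ℤ * (- q * z A)) V′ f))
          ≡⟨ cong (λ d → val z c U f + ((c₁ + q * z A) * f (A , q) + ((c₁ + 2ℤ * (q * z A) + - q * z A) * f (A , - q)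
               + val z d V′ f))) (back c₁ q (z A)) ⟩
        val z c U f + ((c₁ + q * z A) * f (A , q) + ((c₁ + 2ℤ * (q * z A) + - q * z A) * f (A , - q) + val z c₁ V′ f))
          ≡⟨ regroup (val z c U f) c₁ q (z A) (f (A , q)) (f (A , - q)) (val z c₁ V′ f) ⟩
        val z c U f + val z c₁ V′ f + ap′ f
          ≡⟨ cong (_+ ap′ f) (sym (val-++ z c U V′ f)) ⟩
        val z c (U ++ V′) f + ap′ f ∎
        where
        open ≡-Reasoning
        c₁ : ℤ
        c₁ = c + 2ℤ * total z U
        ap′ : (Occ → ℤ) → ℤ
        ap′ = Functional.ap (duo₁ z c)
        back : ∀ c q x → c + 2ℤ * (q * x) + 2ℤ * (- q * x) ≡ c
        back = solve-∀
        regroup : ∀ a c q x f g b → a + ((c + q * x) * f + ((c + 2ℤ * (q * x) + - q * x) * g + b))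
          ≡ a + b + ((c + q * x) * f + (c + q * x) * g)
        regroup = solve-∀

    -- Adjacent occurrences with opposite jumps are met at the same mean value, so the determinant
    -- of `A` has equal entries in each function and vanishes. The state behind them is the one
    -- before, so the rest of the word is unaffected.
    form-homotopy₁ : ∀ z c z′ c′ → form word z c z′ c′ ≡ form (U ++ V′) z c z′ c′
    form-homotopy₁ z c z′ c′ = begin
      ⟪ V z c word , V z′ c′ word ⟫
        ≡⟨ ⟪⟫-cong (split z c) (split z′ c′) ⟩
      ⟪ V z c (U ++ V′) ⊞ duo₁ z c , V z′ c′ (U ++ V′) ⊞ duo₁ z′ c′ ⟫
        ≡⟨ ⟪⟫-orthogonal
             (rest z c) (rest z′ c′) (duo-supported A q _ _) (duo-supported A q _ _) (λ { A∉ refl → A∉ (here refl) }) ⟩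
      ⟪ V z c (U ++ V′) , V z′ c′ (U ++ V′) ⟫ + ⟪ duo₁ z c , duo₁ z′ c′ ⟫
        ≡⟨ cong (⟪ V z c (U ++ V′) , V z′ c′ (U ++ V′) ⟫ +_) (trans (⟪duo,duo⟫ A q u u u′ u′) (cancel q u u′)) ⟩
      ⟪ V z c (U ++ V′) , V z′ c′ (U ++ V′) ⟫ + 0ℤ
        ≡⟨ ℤₚ.+-identityʳ _ ⟩
      ⟪ V z c (U ++ V′) , V z′ c′ (U ++ V′) ⟫ ∎
      where
      open ≡-Reasoning
      u u′ : ℤ
      u = c + 2ℤ * total z U + q * z A
      u′ = c′ + 2ℤ * total z′ U + q * z′ A
      rest : ∀ z c → Supported (_∉ (A ∷ [])) (V z c (U ++ V′))
      rest z c = V-supported z c (Allₚ.++⁺ aU aV)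
      cancel : ∀ q u v → 2ℤ * q * (u * v - u * v) ≡ 0ℤ
      cancel = solve-∀

  module _ {A B : L} (A≢B : A ≢ B) (q : ℤ) {U V′ W : List Occ}
           (aU : Avoids (A ∷ B ∷ []) U) (aV : Avoids (A ∷ B ∷ []) V′) (aW : Avoids (A ∷ B ∷ []) W) where

    private
      word : List Occ
      word = U ++ (A , q) ∷ (B , - q) ∷ V′ ++ (B , - - q) ∷ (A , - q) ∷ W
      word′ : List Occ
      word′ = U ++ V′ ++ W
      left right : (L → ℤ) → ℤ → ℤ
      left  z c = c + 2ℤ * total z U + q * z A
      right z c = c + 2ℤ * total z U + 2ℤ * total z V′ + q * z A
      duos : (L → ℤ) → ℤ → Functional
      duos z c = duo A q (left z c) (right z c) ⊞ duo B (- q) (left z c) (right z c)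

      split : ∀ z c → z A ≡ z B → V z c word ≋ V z c word′ ⊞ duos z c
      split z c zA≡zB .ap≡ f = begin
        val z c word f
          ≡⟨ val-++ z c U _ f ⟩
        val z c U f + ((c₁ + q * z A) * fA + ((c₁ + 2ℤ * (q * z A) + - q * z B) * fB + val z d₁ (V′ ++ rest) f))
          ≡⟨ cong (λ b → val z c U f + ((c₁ + q * z A) * fA + ((c₁ + 2ℤ * (q * z A) + - q * b) * fB
               + val z (c₁ + 2ℤ * (q * z A) + 2ℤ * (- q * b)) (V′ ++ rest) f))) (sym zA≡zB) ⟩
        val z c U f + ((c₁ + q * z A) * fA + ((c₁ + 2ℤ * (q * z A) + - q * z A) * fB
          + val z (c₁ + 2ℤ * (q * z A) + 2ℤ * (- q * z A)) (V′ ++ rest) f))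
          ≡⟨ cong (λ x → val z c U f + ((c₁ + q * z A) * fA + ((c₁ + 2ℤ * (q * z A) + - q * z A) * fB + x)))
               (trans (cong (λ d → val z d (V′ ++ rest) f) (back c₁ q (z A))) (val-++ z c₁ V′ rest f)) ⟩
        val z c U f + ((c₁ + q * z A) * fA + ((c₁ + 2ℤ * (q * z A) + - q * z A) * fB + (val z c₁ V′ f +
          ((c₂ + - - q * z B) * fB′ + ((c₂ + 2ℤ * (- - q * z B) + - q * z A) * fA′
            + val z (c₂ + 2ℤ * (- - q * z B) + 2ℤ * (- q * z A)) W f)))))
          ≡⟨ cong (λ b → val z c U f + ((c₁ + q * z A) * fA + ((c₁ + 2ℤ * (q * z A) + - q * z A) * fB + (val z c₁ V′ f +
               ((c₂ + - - q * b) * fB′ + ((c₂ + 2ℤ * (- - q * b) + - q * z A) * fA′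
                 + val z (c₂ + 2ℤ * (- - q * b) + 2ℤ * (- q * z A)) W f)))))) (sym zA≡zB) ⟩
        val z c U f + ((c₁ + q * z A) * fA + ((c₁ + 2ℤ * (q * z A) + - q * z A) * fB + (val z c₁ V′ f +
          ((c₂ + - - q * z A) * fB′ + ((c₂ + 2ℤ * (- - q * z A) + - q * z A) * fA′
            + val z (c₂ + 2ℤ * (- - q * z A) + 2ℤ * (- q * z A)) W f)))))
          ≡⟨ cong (λ d → val z c U f + ((c₁ + q * z A) * fA + ((c₁ + 2ℤ * (q * z A) + - q * z A) * fB + (val z c₁ V′ f +
               ((c₂ + - - q * z A) * fB′ + ((c₂ + 2ℤ * (- - q * z A) + - q * z A) * fA′ + val z d W f)))))
               ) (forth c₂ q (z A)) ⟩
        val z c U f + ((c₁ + q * z A) * fA + ((c₁ + 2ℤ * (q * z A) + - q * z A) * fB + (val z c₁ V′ f +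
          ((c₂ + - - q * z A) * fB′ + ((c₂ + 2ℤ * (- - q * z A) + - q * z A) * fA′ + val z c₂ W f)))))
          ≡⟨ regroup (val z c U f) c₁ c₂ q (z A) fA fB fB′ fA′ (val z c₁ V′ f) (val z c₂ W f) ⟩
        val z c U f + (val z c₁ V′ f + val z c₂ W f) + ap′ f
          ≡⟨ cong (_+ ap′ f) (sym (trans (val-++ z c U (V′ ++ W) f) (cong (val z c U f +_) (val-++ z c₁ V′ W f)))) ⟩
        val z c word′ f + ap′ f ∎
        where
        open ≡-Reasoning
        rest : List Occ
        rest = (B , - - q) ∷ (A , - q) ∷ W
        c₁ c₂ d₁ fA fB fA′ fB′ : ℤ
        c₁ = c + 2ℤ * total z U
        c₂ = c₁ + 2ℤ * total z V′
        d₁ = c₁ + 2ℤ * (q * z A) + 2ℤ * (- q * z B)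
        fA = f (A , q)
        fB = f (B , - q)
        fA′ = f (A , - q)
        fB′ = f (B , - - q)
        ap′ : (Occ → ℤ) → ℤ
        ap′ = Functional.ap (duos z c)
        back : ∀ c q x → c + 2ℤ * (q * x) + 2ℤ * (- q * x) ≡ c
        back = solve-∀
        forth : ∀ c q x → c + 2ℤ * (- - q * x) + 2ℤ * (- q * x) ≡ c
        forth = solve-∀
        regroup : ∀ u c d q x a b b′ a′ v w →
          u + ((c + q * x) * a + ((c + 2ℤ * (q * x) + - q * x) * b + (v +
            ((d + - - q * x) * b′ + ((d + 2ℤ * (- - q * x) + - q * x) * a′ + w)))))
          ≡ u + (v + w) + ((c + q * x) * a + (d + q * x) * a′ + ((c + q * x) * b + (d + q * x) * b′))
        regroup = solve-∀

    -- When z(A) = z(B), the jumps of `A` and `B` cancel, and both letters see the same pair of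
    -- values. Their determinants agree and are weighted by the opposite charges `q` and `- q`.
    form-homotopy₂ : ∀ z c z′ c′ → z A ≡ z B → z′ A ≡ z′ B → form word z c z′ c′ ≡ form word′ z c z′ c′
    form-homotopy₂ z c z′ c′ e e′ = begin
      ⟪ V z c word , V z′ c′ word ⟫
        ≡⟨ ⟪⟫-cong (split z c e) (split z′ c′ e′) ⟩
      ⟪ V z c word′ ⊞ duos z c , V z′ c′ word′ ⊞ duos z′ c′ ⟫
        ≡⟨ ⟪⟫-orthogonal
             (rest z c) (rest z′ c′) (sup z c) (sup z′ c′) (λ A∉ A∈ → A∉ A∈) ⟩
      ⟪ V z c word′ , V z′ c′ word′ ⟫ + ⟪ duos z c , duos z′ c′ ⟫
        ≡⟨ cong (⟪ V z c word′ , V z′ c′ word′ ⟫ +_) (trans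
             (⟪⟫-orthogonal
               (duo-supported A q u v) (duo-supported A q u′ v′) (duo-supported B (- q) u v) (duo-supported B (- q) u′ v′)
               (λ { refl refl → A≢B refl }))
             (trans (cong₂ _+_ (⟪duo,duo⟫ A q u v u′ v′) (⟪duo,duo⟫ B (- q) u v u′ v′)) (cancel q (u * v′ - v * u′)))) ⟩
      ⟪ V z c word′ , V z′ c′ word′ ⟫ + 0ℤ
        ≡⟨ ℤₚ.+-identityʳ _ ⟩
      ⟪ V z c word′ , V z′ c′ word′ ⟫ ∎
      where
      open ≡-Reasoning
      u v u′ v′ : ℤ
      u = left z c
      v = right z c
      u′ = left z′ c′
      v′ = right z′ c′
      rest : ∀ z c → Supported (_∉ (A ∷ B ∷ [])) (V z c word′)
      rest z c = V-supported z c (Allₚ.++⁺ aU (Allₚ.++⁺ aV aW))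
      sup : ∀ z c → Supported (_∈ (A ∷ B ∷ [])) (duos z c)
      sup z c = supported-⊞ 
        (supported-⊆ here (duo-supported A q _ _))
        (supported-⊆ (there ∘ here) (duo-supported B (- q) _ _))
      cancel : ∀ q d → 2ℤ * q * d + 2ℤ * - q * d ≡ 0ℤ
      cancel = solve-∀

  val-pair : ∀ z c U A q B p R f → let c₁ = c + 2ℤ * total z U in
    val z c (U ++ (A , q) ∷ (B , p) ∷ R) f ≡ val z c U f + ((c₁ + q * z A) * f (A , q) +
      ((c₁ + 2ℤ * (q * z A) + p * z B) * f (B , p) + val z (c₁ + 2ℤ * (q * z A) + 2ℤ * (p * z B)) R f))
  val-pair z c U A q B p R f = val-++ z c U ((A , q) ∷ (B , p) ∷ R) f

  -- The two words of the third move differ by swapping three pairs of adjacent occurrences, which does not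
  -- affect the states outside these pairs.
  module _ {A B C : L} (A≢B : A ≢ B) (A≢C : A ≢ C) (B≢C : B ≢ C) (q : ℤ) {U Y Z T : List Occ}
           (aU : Avoids (A ∷ B ∷ C ∷ []) U) (aY : Avoids (A ∷ B ∷ C ∷ []) Y)
           (aZ : Avoids (A ∷ B ∷ C ∷ []) Z) (aT : Avoids (A ∷ B ∷ C ∷ []) T) where

    private
      word word′ : List Occ
      word  = U ++ (A , q) ∷ (B , q) ∷ Y ++ (A , - q) ∷ (C , q) ∷ Z ++ (B , - q) ∷ (C , - q) ∷ T
      word′ = U ++ (B , q) ∷ (A , q) ∷ Y ++ (C , q) ∷ (A , - q) ∷ Z ++ (C , - q) ∷ (B , - q) ∷ T

      module State (z : L → ℤ) (c : ℤ) where

        c₁ d₁ c₂ d₂ c₃ d₃ : ℤ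
        c₁ = c + 2ℤ * total z U
        d₁ = c₁ + 2ℤ * (q * z A) + 2ℤ * (q * z B)
        c₂ = d₁ + 2ℤ * total z Y
        d₂ = c₂ + 2ℤ * (- q * z A) + 2ℤ * (q * z C)
        c₃ = d₂ + 2ℤ * total z Z
        d₃ = c₃ + 2ℤ * (- q * z B) + 2ℤ * (- q * z C)

        outside : Functional
        outside = V z c U ⊞ (V z d₁ Y ⊞ (V z d₂ Z ⊞ V z d₃ T))

        A₁ A₂ B₁ B₂ C₁ C₂ A₁′ A₂′ B₁′ B₂′ C₁′ C₂′ : ℤ
        A₁ = c₁ + q * z A
        B₁ = c₁ + 2ℤ * (q * z A) + q * z B
        A₂ = c₂ + - q * z A
        C₁ = c₂ + 2ℤ * (- q * z A) + q * z C
        B₂ = c₃ + - q * z B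
        C₂ = c₃ + 2ℤ * (- q * z B) + - q * z C
        B₁′ = c₁ + q * z B
        A₁′ = c₁ + 2ℤ * (q * z B) + q * z A
        C₁′ = c₂ + q * z C
        A₂′ = c₂ + 2ℤ * (q * z C) + - q * z A
        C₂′ = c₃ + - q * z C
        B₂′ = c₃ + 2ℤ * (- q * z C) + - q * z B

        inside inside′ : Functional
        inside  = duo A q A₁ A₂ ⊞ (duo B q B₁ B₂ ⊞ duo C q C₁ C₂)
        inside′ = duo A q A₁′ A₂′ ⊞ (duo B q B₁′ B₂′ ⊞ duo C q C₁′ C₂′)

        split : V z c word ≋ outside ⊞ inside
        split .ap≡ f = begin
          val z c word f
            ≡⟨ val-pair z c U A q B q R₁ f ⟩
          val z c U f + (A₁ * fA + (B₁ * fB + val z d₁ R₁ f))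
            ≡⟨ cong (λ x → val z c U f + (A₁ * fA + (B₁ * fB + x))) (val-pair z d₁ Y A (- q) C q R₂ f) ⟩
          val z c U f + (A₁ * fA + (B₁ * fB + (val z d₁ Y f + (A₂ * fA′ + (C₁ * fC
            + val z d₂ R₂ f)))))
            ≡⟨ cong (λ x → val z c U f + (A₁ * fA + (B₁ * fB + (val z d₁ Y f + (A₂ * fA′ + (C₁ * fC + x))))))
                 (val-pair z d₂ Z B (- q) C (- q) T f) ⟩
          val z c U f + (A₁ * fA + (B₁ * fB + (val z d₁ Y f + (A₂ * fA′ + (C₁ * fC
            + (val z d₂ Z f + (B₂ * fB′ + (C₂ * fC′ + val z d₃ T f))))))))
            ≡⟨ regroup (val z c U f) (A₁ * fA) (B₁ * fB) (val z d₁ Y f) (A₂ * fA′) (C₁ * fC)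
                 (val z d₂ Z f) (B₂ * fB′) (C₂ * fC′) (val z d₃ T f) ⟩
          val z c U f + (val z d₁ Y f + (val z d₂ Z f + val z d₃ T f))
            + (A₁ * fA + A₂ * fA′ + (B₁ * fB + B₂ * fB′ + (C₁ * fC + C₂ * fC′))) ∎
          where
          open ≡-Reasoning
          R₁ R₂ : List Occ
          R₁ = Y ++ (A , - q) ∷ (C , q) ∷ Z ++ (B , - q) ∷ (C , - q) ∷ T
          R₂ = Z ++ (B , - q) ∷ (C , - q) ∷ T
          fA fA′ fB fB′ fC fC′ : ℤ
          fA = f (A , q)
          fA′ = f (A , - q)
          fB = f (B , q)
          fB′ = f (B , - q)
          fC = f (C , q)
          fC′ = f (C , - q)
          regroup : ∀ u a b y a′ c w b′ c′ t →
            u + (a + (b + (y + (a′ + (c + (w + (b′ + (c′ + t)))))))) ≡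
            u + (y + (w + t)) + (a + a′ + (b + b′ + (c + c′)))
          regroup = solve-∀

        split′ : V z c word′ ≋ outside ⊞ inside′
        split′ .ap≡ f = begin
          val z c word′ f
            ≡⟨ val-pair z c U B q A q R₁ f ⟩
          val z c U f + (B₁′ * fB + (A₁′ * fA + val z (c₁ + 2ℤ * (q * z B) + 2ℤ * (q * z A)) R₁ f))
            ≡⟨ cong (λ d → val z c U f + (B₁′ * fB + (A₁′ * fA + val z d R₁ f))) (commute c₁ (q * z B) (q * z A)) ⟩
          val z c U f + (B₁′ * fB + (A₁′ * fA + val z d₁ R₁ f))
            ≡⟨ cong (λ x → val z c U f + (B₁′ * fB + (A₁′ * fA + x))) (trans (val-pair z d₁ Y C q A (- q) R₂ f)
                 (cong (λ d → val z d₁ Y f + (C₁′ * fC + (A₂′ * fA′ + val z d R₂ f))) (commute c₂ (q * z C) (- q * z A)))) ⟩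
          val z c U f + (B₁′ * fB + (A₁′ * fA + (val z d₁ Y f + (C₁′ * fC + (A₂′ * fA′ + val z d₂ R₂ f)))))
            ≡⟨ cong (λ x → val z c U f + (B₁′ * fB + (A₁′ * fA + (val z d₁ Y f + (C₁′ * fC + (A₂′ * fA′ + x))))))
                 (trans (val-pair z d₂ Z C (- q) B (- q) T f)
                   (cong (λ d → val z d₂ Z f + (C₂′ * fC′ + (B₂′ * fB′ + val z d T f))) (commute c₃ (- q * z C) (- q * z B)))) ⟩
          val z c U f + (B₁′ * fB + (A₁′ * fA + (val z d₁ Y f + (C₁′ * fC + (A₂′ * fA′
            + (val z d₂ Z f + (C₂′ * fC′ + (B₂′ * fB′ + val z d₃ T f))))))))
            ≡⟨ regroup (val z c U f) (B₁′ * fB) (A₁′ * fA) (val z d₁ Y f) (C₁′ * fC) (A₂′ * fA′)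
                 (val z d₂ Z f) (C₂′ * fC′) (B₂′ * fB′) (val z d₃ T f) ⟩
          val z c U f + (val z d₁ Y f + (val z d₂ Z f + val z d₃ T f))
            + (A₁′ * fA + A₂′ * fA′ + (B₁′ * fB + B₂′ * fB′ + (C₁′ * fC + C₂′ * fC′))) ∎
          where
          open ≡-Reasoning
          R₁ R₂ : List Occ
          R₁ = Y ++ (C , q) ∷ (A , - q) ∷ Z ++ (C , - q) ∷ (B , - q) ∷ T
          R₂ = Z ++ (C , - q) ∷ (B , - q) ∷ T
          fA fA′ fB fB′ fC fC′ : ℤ
          fA = f (A , q)
          fA′ = f (A , - q)
          fB = f (B , q)
          fB′ = f (B , - q)
          fC = f (C , q)
          fC′ = f (C , - q)
          commute : ∀ c x y → c + 2ℤ * x + 2ℤ * y ≡ c + 2ℤ * y + 2ℤ * x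
          commute = solve-∀
          regroup : ∀ u b a y c a′ w c′ b′ t →
            u + (b + (a + (y + (c + (a′ + (w + (c′ + (b′ + t)))))))) ≡
            u + (y + (w + t)) + (a + a′ + (b + b′ + (c + c′)))
          regroup = solve-∀

        outside-supported : Supported (_∉ (A ∷ B ∷ C ∷ [])) outside
        outside-supported = supported-⊞ (V-supported z _ aU) (supported-⊞ (V-supported z _ aY)
          (supported-⊞ (V-supported z _ aZ) (V-supported z _ aT)))

      trio-supported : ∀ {u v u′ v′ u″ v″} →
        Supported (_∈ (A ∷ B ∷ C ∷ [])) (duo A q u v ⊞ (duo B q u′ v′ ⊞ duo C q u″ v″))
      trio-supported = supported-⊞ (supported-⊆ here (duo-supported A q _ _))
        (supported-⊞ (supported-⊆ (there ∘ here) (duo-supported B q _ _))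
                     (supported-⊆ (there ∘ there ∘ here) (duo-supported C q _ _)))

      ⟪trio,trio⟫ : ∀ a₁ a₂ b₁ b₂ c₁ c₂ a₁′ a₂′ b₁′ b₂′ c₁′ c₂′ →
        ⟪ duo A q a₁ a₂ ⊞ (duo B q b₁ b₂ ⊞ duo C q c₁ c₂) , duo A q a₁′ a₂′ ⊞ (duo B q b₁′ b₂′ ⊞ duo C q c₁′ c₂′) ⟫
        ≡ 2ℤ * q * (a₁ * a₂′ - a₂ * a₁′) + (2ℤ * q * (b₁ * b₂′ - b₂ * b₁′) + 2ℤ * q * (c₁ * c₂′ - c₂ * c₁′))
      ⟪trio,trio⟫ a₁ a₂ b₁ b₂ c₁ c₂ a₁′ a₂′ b₁′ b₂′ c₁′ c₂′ = trans
        (⟪⟫-orthogonal {P = _≡ A} {Q = _∈ (B ∷ C ∷ [])} (duo-supported A q _ _) (duo-supported A q _ _) BC BC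
          λ { refl (here A≡B) → A≢B A≡B ; refl (there (here A≡C)) → A≢C A≡C })
        (cong₂ _+_ (⟪duo,duo⟫ A q a₁ a₂ a₁′ a₂′) (trans
          (⟪⟫-orthogonal {P = _≡ B} {Q = _≡ C} (duo-supported B q _ _) (duo-supported B q _ _)
            (duo-supported C q _ _) (duo-supported C q _ _) λ { refl B≡C → B≢C B≡C })
          (cong₂ _+_ (⟪duo,duo⟫ B q b₁ b₂ b₁′ b₂′) (⟪duo,duo⟫ C q c₁ c₂ c₁′ c₂′))))
        where
        BC : ∀ {u v u′ v′} → Supported (_∈ (B ∷ C ∷ [])) (duo B q u v ⊞ duo C q u′ v′)
        BC = supported-⊞ (supported-⊆ here (duo-supported B q _ _)) (supported-⊆ (there ∘ here) (duo-supported C q _ _))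

    -- The determinants of `A`, `B`, `C` change individually, but their sum does not: `exchange` is
    -- a polynomial identity in the states before the three pairs and the three jumps. No relation
    -- between the values of `z` at the three letters enters, only their common charge.
    form-homotopy₃ : ∀ z c z′ c′ → form word z c z′ c′ ≡ form word′ z c z′ c′
    form-homotopy₃ z c z′ c′ = begin
      form word z c z′ c′
        ≡⟨ ⟪⟫-cong S.split S′.split ⟩
      ⟪ S.outside ⊞ S.inside , S′.outside ⊞ S′.inside ⟫
        ≡⟨ ⟪⟫-orthogonal S.outside-supported S′.outside-supported trio-supported trio-supported (λ ∉ ∈ → ∉ ∈) ⟩
      ⟪ S.outside , S′.outside ⟫ + ⟪ S.inside , S′.inside ⟫
        ≡⟨ cong (⟪ S.outside , S′.outside ⟫ +_) (begin
             ⟪ S.inside , S′.inside ⟫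
               ≡⟨ ⟪trio,trio⟫ S.A₁ S.A₂ S.B₁ S.B₂ S.C₁ S.C₂ S′.A₁ S′.A₂ S′.B₁ S′.B₂ S′.C₁ S′.C₂ ⟩
             _ ≡⟨ factor q (S.A₁ * S′.A₂ - S.A₂ * S′.A₁) (S.B₁ * S′.B₂ - S.B₂ * S′.B₁) (S.C₁ * S′.C₂ - S.C₂ * S′.C₁) ⟩
             2ℤ * q * (S.A₁ * S′.A₂ - S.A₂ * S′.A₁ + (S.B₁ * S′.B₂ - S.B₂ * S′.B₁ + (S.C₁ * S′.C₂ - S.C₂ * S′.C₁)))
               ≡⟨ cong (2ℤ * q *_) (exchange q S.c₁ S.c₂ S.c₃ (z A) (z B) (z C) S′.c₁ S′.c₂ S′.c₃ (z′ A) (z′ B) (z′ C)) ⟩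
             2ℤ * q * (S.A₁′ * S′.A₂′ - S.A₂′ * S′.A₁′ + (S.B₁′ * S′.B₂′ - S.B₂′ * S′.B₁′ + (S.C₁′ * S′.C₂′ - S.C₂′ * S′.C₁′)))
               ≡⟨ factor q (S.A₁′ * S′.A₂′ - S.A₂′ * S′.A₁′) (S.B₁′ * S′.B₂′ - S.B₂′ * S′.B₁′) (S.C₁′ * S′.C₂′ - S.C₂′ * S′.C₁′) ⟨
             _ ≡⟨ ⟪trio,trio⟫ S.A₁′ S.A₂′ S.B₁′ S.B₂′ S.C₁′ S.C₂′ S′.A₁′ S′.A₂′ S′.B₁′ S′.B₂′ S′.C₁′ S′.C₂′ ⟨
             ⟪ S.inside′ , S′.inside′ ⟫ ∎) ⟩
      ⟪ S.outside , S′.outside ⟫ + ⟪ S.inside′ , S′.inside′ ⟫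
        ≡⟨ ⟪⟫-orthogonal S.outside-supported S′.outside-supported trio-supported trio-supported (λ ∉ ∈ → ∉ ∈) ⟨
      ⟪ S.outside ⊞ S.inside′ , S′.outside ⊞ S′.inside′ ⟫
        ≡⟨ ⟪⟫-cong S.split′ S′.split′ ⟨
      form word′ z c z′ c′ ∎
      where
      open ≡-Reasoning
      module S  = State z c
      module S′ = State z′ c′
      factor : ∀ q a b c → 2ℤ * q * a + (2ℤ * q * b + 2ℤ * q * c) ≡ 2ℤ * q * (a + (b + c))
      factor = solve-∀
      exchange : ∀ q c₁ c₂ c₃ a b c c₁′ c₂′ c₃′ a′ b′ c′ →
        (c₁ + q * a) * (c₂′ + - q * a′) - (c₂ + - q * a) * (c₁′ + q * a′)
        + ((c₁ + 2ℤ * (q * a) + q * b) * (c₃′ + - q * b′) - (c₃ + - q * b) * (c₁′ + 2ℤ * (q * a′) + q * b′)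
        + ((c₂ + 2ℤ * (- q * a) + q * c) * (c₃′ + 2ℤ * (- q * b′) + - q * c′)
          - (c₃ + 2ℤ * (- q * b) + - q * c) * (c₂′ + 2ℤ * (- q * a′) + q * c′)))
        ≡
        (c₁ + 2ℤ * (q * b) + q * a) * (c₂′ + 2ℤ * (q * c′) + - q * a′)
          - (c₂ + 2ℤ * (q * c) + - q * a) * (c₁′ + 2ℤ * (q * b′) + q * a′)
        + ((c₁ + q * b) * (c₃′ + 2ℤ * (- q * c′) + - q * b′) - (c₃ + 2ℤ * (- q * c) + - q * b) * (c₁′ + q * b′)
        + ((c₂ + q * c) * (c₃′ + - q * c′) - (c₃ + - q * c) * (c₂′ + q * c′)))
      exchange = solve-∀

  -- Total zero means that the function returns to its start value at the end of the word. The first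
  -- occurrence can therefore be visited last with the same value, and the remaining word starts
  -- behind its jump.
  form-rotate : ∀ {A q U} z c z′ c′ → total z ((A , q) ∷ U) ≡ 0ℤ → total z′ ((A , q) ∷ U) ≡ 0ℤ →
    form ((A , q) ∷ U) z c z′ c′ ≡ form (U ++ (A , q) ∷ []) z (c + 2ℤ * (q * z A)) z′ (c′ + 2ℤ * (q * z′ A))
  form-rotate {A} {q} {U} z c z′ c′ t t′ = ⟪⟫-cong (rotate z c t) (rotate z′ c′ t′)
    where
    open ≡-Reasoning
    rotate : ∀ z c → total z ((A , q) ∷ U) ≡ 0ℤ → V z c ((A , q) ∷ U) ≋ V z (c + 2ℤ * (q * z A)) (U ++ (A , q) ∷ [])
    rotate z c t .ap≡ f = begin
      (c + x) * fA + val z d U f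
        ≡⟨ ring c x fA (val z d U f) ⟩
      val z d U f + ((c + 2ℤ * 0ℤ + x) * fA + 0ℤ)
        ≡⟨ cong (λ T → val z d U f + ((c + 2ℤ * T + x) * fA + 0ℤ)) (sym t) ⟩
      val z d U f + ((c + 2ℤ * (x + total z U) + x) * fA + 0ℤ)
        ≡⟨ cong (λ e → val z d U f + ((e + x) * fA + 0ℤ)) (state c x (total z U)) ⟩
      val z d U f + ((d + 2ℤ * total z U + x) * fA + 0ℤ)
        ≡⟨ val-++ z d U ((A , q) ∷ []) f ⟨
      val z d (U ++ (A , q) ∷ []) f ∎
      where
      x d fA : ℤ
      x = q * z A
      d = c + 2ℤ * x
      fA = f (A , q)
      ring : ∀ c x f v → (c + x) * f + v ≡ v + ((c + 2ℤ * 0ℤ + x) * f + 0ℤ)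
      ring = solve-∀
      state : ∀ c x t → c + 2ℤ * (x + t) ≡ c + 2ℤ * x + 2ℤ * t
      state = solve-∀

module ChargedRenaming {L L′ : Set} (_≟_ : DecidableEquality L) (_≟′_ : DecidableEquality L′) where

  private
    module C  = ChargedWords _≟_
    module C′ = ChargedWords _≟′_
  open C using (ap-≡)
  open import Data.Integer.Base using (_+_; _*_; -_; _-_)

  rename : (L′ → L) → C′.Occ → C.Occ
  rename h (A , q) = h A , q

  val-rename : ∀ (h : L′ → L) z c s f → C.val z c (List.map (rename h) s) f ≡ C′.val (z ∘ h) c s (f ∘ rename h)
  val-rename h z c []            f = refl
  val-rename h z c ((A , q) ∷ s) f = cong ((c + q * z (h A)) * f (h A , q) +_) (val-rename h z _ s f)

  -- Letters enter `ω` only through their equality, which an injection preserves and reflects.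
  form-rename : ∀ (h : L′ → L) → (∀ {A B} → h A ≡ h B → A ≡ B) → ∀ s z c z′ c′ →
    C.form (List.map (rename h) s) z c z′ c′ ≡ C′.form s (z ∘ h) c (z′ ∘ h) c′
  form-rename h inj s z c z′ c′ = begin
    C.form (List.map (rename h) s) z c z′ c′
      ≡⟨ C.⟪⟫-def (C.V z c (List.map (rename h) s)) (C.V z′ c′ (List.map (rename h) s)) ⟩
    C.val z c (List.map (rename h) s) (λ o → C.val z′ c′ (List.map (rename h) s) (C.ω o))
      ≡⟨ val-rename h z c s _ ⟩
    C′.val (z ∘ h) c s (λ o → C.val z′ c′ (List.map (rename h) s) (C.ω (rename h o)))
      ≡⟨ C′.val-cong (λ _ → refl) c s (λ o → trans (val-rename h z′ c′ s _)
           (C′.val-cong (λ _ → refl) c′ s (λ o′ → ω-rename o o′))) ⟩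
    C′.val (z ∘ h) c s (λ o → C′.val (z′ ∘ h) c′ s (C′.ω o))
      ≡⟨ C′.⟪⟫-def (C′.V (z ∘ h) c s) (C′.V (z′ ∘ h) c′ s) ⟨
    C′.form s (z ∘ h) c (z′ ∘ h) c′ ∎
    where
    open ≡-Reasoning
    δ-rename : ∀ A B → C.δ (h A) (h B) ≡ C′.δ A B
    δ-rename A B with A ≟′ B
    ... | yes refl = C.δ-refl (h A)
    ... | no A≢B   = C.δ-≢ (A≢B ∘ inj)
    ω-rename : ∀ o o′ → C.ω (rename h o) (rename h o′) ≡ C′.ω o o′
    ω-rename (A , p) (B , q) = cong (_* (p - q)) (δ-rename A B)

-- The change of the form under a bridge move.

module ChargedBridge {a} (α : Set a) (τ : α → α) (τ-involutive : Involutive _≡_ τ)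
                     {L : Set} (_≟_ : DecidableEquality L) where

  open Nanowords α τ τ-involutive using (interleave)
  open FiniteSums
  open LowRank
  open ChargedWords _≟_
  open Functional
  open import Data.Integer.Base using (_+_; _*_; -_; _-_)

  private
    variable
      k : ℕ

  infixr 7 _⊙_

  _⊙_ : ℤ → Functional → Functional
  (m ⊙ X) .ap f      = m * ap X f
  (m ⊙ X) .ap-cong e = cong (m *_) (ap-cong X e)
  (m ⊙ X) .ap-+ f g  = trans (cong (m *_) (ap-+ X f g)) (ℤₚ.*-distribˡ-+ m (ap X f) (ap X g))
  (m ⊙ X) .ap-* n f  = trans (cong (m *_) (ap-* X n f)) (swap m n (ap X f))
    where
    swap : ∀ m n x → m * (n * x) ≡ n * (m * x)
    swap = solve-∀

  -- Pairing the perturbation of the first argument with the full `X b`, and that of the second with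
  -- the unperturbed `R a`, absorbs the term quadratic in the perturbation. Each of the `g`
  -- functionals then costs two products.
  low-perturbed : ∀ {ℓ} {A : Set ℓ} {g} {X R : A → Functional} (u : Fin g → A → ℤ) (G : Fin g → Functional) →
    (∀ a → X a ≋ R a ⊞ ⨁ (λ j → u j a ⊙ G j)) → Low (g ℕ.+ g) (λ a b → ⟪ X a , X b ⟫ - ⟪ R a , R b ⟫)
  low-perturbed {X = X} {R} u G X≋ = low-cong expand
    (low-+ (low-sum u (λ j b → ⟪ G j , X b ⟫)) (low-sum (λ j a → ⟪ R a , G j ⟫) u))
    where
    open ≡-Reasoning
    expand : ∀ a b → ⟪ X a , X b ⟫ - ⟪ R a , R b ⟫ ≡
             sum (λ j → u j a * ⟪ G j , X b ⟫) + sum (λ j → ⟪ R a , G j ⟫ * u j b)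
    expand a b = begin
      ⟪ X a , X b ⟫ - r
        ≡⟨ cong (_- r) (trans (⟪⟫-def (X a) (X b)) (ap≡ (X≋ a) _)) ⟩
      ap (R a) (λ o → ap (X b) (ω o)) + s₁ - r
        ≡⟨ cong (λ x → x + s₁ - r) (trans (ap-cong (R a) λ o → ap≡ (X≋ b) (ω o)) (ap-+ (R a) _ _)) ⟩
      ap (R a) (λ o → ap (R b) (ω o)) + ap (R a) (λ o → sum λ j → u j b * ap (G j) (ω o)) + s₁ - r
        ≡⟨ cong₂ (λ x y → x + y + s₁ - r) (sym (⟪⟫-def (R a) (R b)))
             (trans (ap-sum (R a) λ j o → u j b * ap (G j) (ω o)) (sum-cong λ j → trans (ap-* (R a) (u j b) _)
               (trans (cong (u j b *_) (sym (⟪⟫-def (R a) (G j)))) (ℤₚ.*-comm (u j b) _)))) ⟩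
      r + sum (λ j → ⟪ R a , G j ⟫ * u j b) + s₁ - r
        ≡⟨ collect r (sum λ j → ⟪ R a , G j ⟫ * u j b) s₁ ⟩
      s₁ + sum (λ j → ⟪ R a , G j ⟫ * u j b)
        ≡⟨ cong (_+ sum (λ j → ⟪ R a , G j ⟫ * u j b))
             (sum-cong λ j → cong (u j a *_) (sym (⟪⟫-def (G j) (X b)))) ⟩
      sum (λ j → u j a * ⟪ G j , X b ⟫) + sum (λ j → ⟪ R a , G j ⟫ * u j b) ∎
      where
      r s₁ : ℤ
      r  = ⟪ R a , R b ⟫
      s₁ = sum (λ j → u j a * ap (G j) (λ o → ap (X b) (ω o)))
      collect : ∀ r s t → r + s + t - r ≡ t + s
      collect = solve-∀

  -- Values of the function on entering a segment: `stateˣ` and `stateᵛ` for x_i and v_r in the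
  -- interleaved word, `stateᶜ` for x_i in the word left after the v_r are deleted.
  stateˣ : (L → ℤ) → ℤ → Vec (List Occ) (suc k) → Vec (List Occ) k → Fin (suc k) → ℤ
  stateˣ z c (x ∷ xs)     vs       zero    = c
  stateˣ z c (x ∷ y ∷ ys) (v ∷ vs) (suc i) = stateˣ z (c + 2ℤ * total z x + 2ℤ * total z v) (y ∷ ys) vs i

  stateᵛ : (L → ℤ) → ℤ → Vec (List Occ) (suc k) → Vec (List Occ) k → Fin k → ℤ
  stateᵛ z c (x ∷ xs)     (v ∷ vs) zero    = c + 2ℤ * total z x
  stateᵛ z c (x ∷ y ∷ ys) (v ∷ vs) (suc r) = stateᵛ z (c + 2ℤ * total z x + 2ℤ * total z v) (y ∷ ys) vs r

  stateᶜ : (L → ℤ) → ℤ → Vec (List Occ) k → Fin k → ℤ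
  stateᶜ z c (x ∷ xs) zero    = c
  stateᶜ z c (x ∷ xs) (suc i) = stateᶜ z (c + 2ℤ * total z x) xs i

  -- The indicator of v_t standing before x_i: counted from zero, v_t lies between x_t and its
  -- successor.
  after : Fin k → Fin (suc k) → ℤ
  after t       zero    = 0ℤ
  after zero    (suc i) = 1ℤ
  after (suc t) (suc i) = after t i

  val-interleave : ∀ z c (xs : Vec (List Occ) (suc k)) vs f → val z c (interleave xs vs) f ≡
    sum (λ i → val z (stateˣ z c xs vs i) (Vec.lookup xs i) f) + sum (λ r → val z (stateᵛ z c xs vs r) (Vec.lookup vs r) f)
  val-interleave z c (x ∷ []) [] f = trans (pad (val z c x f)) (sym (cong₂ _+_
    (trans (sum-cons _) (cong (val z c x f +_) (sum-nil _))) (sum-nil _)))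
    where
    pad : ∀ x → x ≡ x + 0ℤ + 0ℤ
    pad = solve-∀
  val-interleave z c (x ∷ y ∷ ys) (v ∷ vs) f = begin
    val z c (x ++ v ++ rest) f
      ≡⟨ val-++ z c x (v ++ rest) f ⟩
    val z c x f + val z c₁ (v ++ rest) f
      ≡⟨ cong (val z c x f +_) (trans (val-++ z c₁ v rest f) (cong (val z c₁ v f +_) (val-interleave z c₂ (y ∷ ys) vs f))) ⟩
    val z c x f + (val z c₁ v f + (sum F + sum G))
      ≡⟨ regroup (val z c x f) (val z c₁ v f) (sum F) (sum G) ⟩
    val z c x f + sum F + (val z c₁ v f + sum G)
      ≡⟨ cong₂ _+_ (sum-cons _) (sum-cons _) ⟨
    sum (λ i → val z (stateˣ z c (x ∷ y ∷ ys) (v ∷ vs) i) (Vec.lookup (x ∷ y ∷ ys) i) f)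
      + sum (λ r → val z (stateᵛ z c (x ∷ y ∷ ys) (v ∷ vs) r) (Vec.lookup (v ∷ vs) r) f) ∎
    where
    open ≡-Reasoning
    rest : List Occ
    rest = interleave (y ∷ ys) vs
    c₁ c₂ : ℤ
    c₁ = c + 2ℤ * total z x
    c₂ = c₁ + 2ℤ * total z v
    F : Fin _ → ℤ
    F i = val z (stateˣ z c₂ (y ∷ ys) vs i) (Vec.lookup (y ∷ ys) i) f
    G : Fin _ → ℤ
    G r = val z (stateᵛ z c₂ (y ∷ ys) vs r) (Vec.lookup vs r) f
    regroup : ∀ a b s t → a + (b + (s + t)) ≡ a + s + (b + t)
    regroup = solve-∀

  val-concat : ∀ z c (xs : Vec (List Occ) k) f →
    val z c (concat (Vec.toList xs)) f ≡ sum (λ i → val z (stateᶜ z c xs i) (Vec.lookup xs i) f)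
  val-concat z c []       f = sym (sum-nil _)
  val-concat z c (x ∷ xs) f = trans (val-++ z c x _ f)
    (trans (cong (val z c x f +_) (val-concat z _ xs f)) (sym (sum-cons _)))

  -- The offset `d` carries the jumps of the factors already passed; without it the induction would
  -- not go through.
  stateˣ-stateᶜ : ∀ z c d (xs : Vec (List Occ) (suc k)) vs i →
    stateˣ z (c + d) xs vs i ≡ stateᶜ z c xs i + (d + sum (λ t → total z (Vec.lookup vs t) * (2ℤ * after t i)))
  stateˣ-stateᶜ z c d (x ∷ xs) vs zero = sym (cong (c +_) (trans
    (cong (d +_) (sum-zero λ t → ℤₚ.*-zeroʳ (total z (Vec.lookup vs t)))) (ℤₚ.+-identityʳ d)))
  stateˣ-stateᶜ z c d (x ∷ y ∷ ys) (v ∷ vs) (suc i) = begin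
    stateˣ z (c + d + 2ℤ * total z x + 2ℤ * total z v) (y ∷ ys) vs i
      ≡⟨ cong (λ e → stateˣ z e (y ∷ ys) vs i) (shuffle c d (total z x) (total z v)) ⟩
    stateˣ z (c + 2ℤ * total z x + (d + total z v * (2ℤ * 1ℤ))) (y ∷ ys) vs i
      ≡⟨ stateˣ-stateᶜ z (c + 2ℤ * total z x) _ (y ∷ ys) vs i ⟩
    s + (d + total z v * (2ℤ * 1ℤ) + sum G)
      ≡⟨ cong (s +_) (ℤₚ.+-assoc d _ (sum G)) ⟩
    s + (d + (total z v * (2ℤ * 1ℤ) + sum G))
      ≡⟨ cong (λ x → s + (d + x)) (sym (sum-cons _)) ⟩
    s + (d + sum (λ t → total z (Vec.lookup (v ∷ vs) t) * (2ℤ * after t (suc i)))) ∎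
    where
    open ≡-Reasoning
    s : ℤ
    s = stateᶜ z (c + 2ℤ * total z x) (y ∷ ys) i
    G : Fin _ → ℤ
    G t = total z (Vec.lookup vs t) * (2ℤ * after t i)
    shuffle : ∀ c d x v → c + d + 2ℤ * x + 2ℤ * v ≡ c + 2ℤ * x + (d + v * (2ℤ * 1ℤ))
    shuffle = solve-∀

  module _ (ι : L → L) (ι-involutive : Involutive _≡_ ι) where

    -- The symmetry of a bridge acting on occurrences. The negated charge is what the label
    -- condition on ι(B) amounts to.
    σ : Occ → Occ
    σ (A , q) = ι A , - q

    push : Functional → Functional
    push X .ap f      = ap X (f ∘ σ)
    push X .ap-cong e = ap-cong X (e ∘ σ)
    push X .ap-+ f g  = ap-+ X (f ∘ σ) (g ∘ σ)
    push X .ap-* m f  = ap-* X m (f ∘ σ)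

    ω-σ : ∀ o o′ → ω (σ o) (σ o′) ≡ - ω o o′
    ω-σ (A , p) (B , q) = trans (cong (_* (- p - - q)) δ-ι) (flip (δ A B) p q)
      where
      flip : ∀ d p q → d * (- p - - q) ≡ - (d * (p - q))
      flip = solve-∀
      δ-ι : δ (ι A) (ι B) ≡ δ A B
      δ-ι with A ≟ B
      ... | yes refl = δ-refl (ι A)
      ... | no A≢B   = δ-≢ λ e → A≢B (trans (sym (ι-involutive A)) (trans (cong ι e) (ι-involutive B)))

    ⟪push,push⟫ : ∀ X Y → ⟪ push X , push Y ⟫ ≡ - ⟪ X , Y ⟫
    ⟪push,push⟫ X Y = begin
      ⟪ push X , push Y ⟫
        ≡⟨ ⟪⟫-def (push X) (push Y) ⟩
      ap X (λ o → ap Y (λ o′ → ω (σ o) (σ o′)))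
        ≡⟨ ap-cong X (λ o → trans (ap-cong Y (ω-σ o)) (ap-neg Y (ω o))) ⟩
      ap X (λ o → - ap Y (ω o))
        ≡⟨ ap-neg X _ ⟩
      - ap X (λ o → ap Y (ω o))
        ≡⟨ cong -_ (sym (⟪⟫-def X Y)) ⟩
      - ⟪ X , Y ⟫ ∎
      where open ≡-Reasoning

    module _ (z : L → ℤ) (z-ι : ∀ A → z (ι A) ≡ z A) where

      total-reverse : ∀ u → total z (reverse (List.map σ u)) ≡ - total z u
      total-reverse []            = refl
      total-reverse ((A , q) ∷ u) = begin
        total z (reverse (List.map σ ((A , q) ∷ u)))
          ≡⟨ cong (total z) (Listₚ.unfold-reverse (σ (A , q)) (List.map σ u)) ⟩
        total z (reverse (List.map σ u) ++ σ (A , q) ∷ [])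
          ≡⟨ total-++ z (reverse (List.map σ u)) _ ⟩
        total z (reverse (List.map σ u)) + (- q * z (ι A) + 0ℤ)
          ≡⟨ cong₂ (λ x y → x + (- q * y + 0ℤ)) (total-reverse u) (z-ι A) ⟩
        - total z u + (- q * z A + 0ℤ)
          ≡⟨ combine q (z A) (total z u) ⟩
        - (q * z A + total z u) ∎
        where
        open ≡-Reasoning
        combine : ∀ q x t → - t + (- q * x + 0ℤ) ≡ - (q * x + t)
        combine = solve-∀

      -- Running backwards with negated charges undoes the jumps of `u`, and the mean value at a
      -- jump does not depend on the direction. Hence `c` is the value at the end of `u`, and its
      -- start value is lower by twice the total.
      val-reverse : ∀ c u f → val z c (reverse (List.map σ u)) f ≡ val z (c - 2ℤ * total z u) u (f ∘ σ)
      val-reverse c []            f = refl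
      val-reverse c ((A , q) ∷ u) f = begin
        val z c (reverse (List.map σ ((A , q) ∷ u))) f
          ≡⟨ cong (λ s → val z c s f) (Listₚ.unfold-reverse (σ (A , q)) (List.map σ u)) ⟩
        val z c (reverse (List.map σ u) ++ σ (A , q) ∷ []) f
          ≡⟨ val-++ z c (reverse (List.map σ u)) _ f ⟩
        val z c (reverse (List.map σ u)) f + ((c + 2ℤ * total z (reverse (List.map σ u)) + - q * z (ι A)) * y + 0ℤ)
          ≡⟨ cong₂ (λ r s → r + ((c + 2ℤ * s + - q * z (ι A)) * y + 0ℤ)) (val-reverse c u f) (total-reverse u) ⟩
        val z (c - 2ℤ * T) u (f ∘ σ) + ((c + 2ℤ * - T + - q * z (ι A)) * y + 0ℤ)
          ≡⟨ cong₂ (λ d w → val z d u (f ∘ σ) + ((c + 2ℤ * - T + - q * w) * y + 0ℤ)) (state c T q (z A)) (z-ι A) ⟩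
        val z (c - 2ℤ * (q * z A + T) + 2ℤ * (q * z A)) u (f ∘ σ) + ((c + 2ℤ * - T + - q * z A) * y + 0ℤ)
          ≡⟨ combine (val z (c - 2ℤ * (q * z A + T) + 2ℤ * (q * z A)) u (f ∘ σ)) c T q (z A) y ⟩
        (c - 2ℤ * (q * z A + T) + q * z A) * y + val z (c - 2ℤ * (q * z A + T) + 2ℤ * (q * z A)) u (f ∘ σ) ∎
        where
        open ≡-Reasoning
        T y : ℤ
        T = total z u
        y = f (σ (A , q))
        state : ∀ c t q x → c - 2ℤ * t ≡ c - 2ℤ * (q * x + t) + 2ℤ * (q * x)
        state = solve-∀
        combine : ∀ v c t q x y → v + ((c + 2ℤ * - t + - q * x) * y + 0ℤ) ≡ (c - 2ℤ * (q * x + t) + q * x) * y + v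
        combine = solve-∀

    Parameter : Set
    Parameter = (Σ (L → ℤ) λ z → ∀ A → z (ι A) ≡ z A) × ℤ

    module _ (κ : Fin k → Fin k) (κ-involutive : Involutive _≡_ κ)
             (xs : Vec (List Occ) (suc k)) (vs : Vec (List Occ) k)
             (symmetric : ∀ r → Vec.lookup vs (κ r) ≡ reverse (List.map σ (Vec.lookup vs r)))
             {P Q : L → Set} (P∩Q : ∀ {A} → P A → Q A → ⊥)
             (xs-P : ∀ i → All (P ∘ proj₁) (Vec.lookup xs i)) (vs-Q : ∀ r → All (Q ∘ proj₁) (Vec.lookup vs r)) where

      private
        arches : ℕ
        arches = length (ascents κ κ-involutive)
        arch : Fin arches → Fin k
        arch = ascent κ κ-involutive
        tot : Fin k → Parameter → ℤ
        tot r ((z , _) , c) = total z (Vec.lookup vs r)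
        X W R : Parameter → Functional
        X ((z , _) , c) = ⨁ λ i → V z (stateˣ z c xs vs i) (Vec.lookup xs i)
        W ((z , _) , c) = ⨁ λ r → V z (stateᵛ z c xs vs r) (Vec.lookup vs r)
        R ((z , _) , c) = V z c (concat (Vec.toList xs))

        tot-κ : ∀ r p → tot (κ r) p ≡ - tot r p
        tot-κ r ((z , z-ι) , c) = trans (cong (total z) (symmetric r)) (total-reverse z z-ι (Vec.lookup vs r))

        between : Fin k → Functional
        between t = ⨁ λ i → (2ℤ * after t i) ⊙ massF (Vec.lookup xs i)

        -- Passing v_r changes the state by twice its total.  As v_κ(r) undoes the change, each arch contributes a
        -- constant on the words x_i between its ends.
        X≋ : ∀ p → X p ≋ R p ⊞ ⨁ (λ j → tot (arch j) p ⊙ (between (arch j) ⊞ -1ℤ ⊙ between (κ (arch j))))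
        X≋ p@((z , z-ι) , c) .ap≡ f = begin
          sum (λ i → val z (stateˣ z c xs vs i) (x i) f)
            ≡⟨ sum-cong step ⟩
          sum (λ i → val z (stateᶜ z c xs i) (x i) f + sum (λ t → tot t p * (2ℤ * after t i * mass (x i) f)))
            ≡⟨ sum-+ (λ i → val z (stateᶜ z c xs i) (x i) f) _ ⟩
          sum (λ i → val z (stateᶜ z c xs i) (x i) f) + sum (λ i → sum (λ t → tot t p * (2ℤ * after t i * mass (x i) f)))
            ≡⟨ cong₂ _+_ (sym (val-concat z c xs f)) (begin
                 sum (λ i → sum (λ t → tot t p * (2ℤ * after t i * mass (x i) f)))
                   ≡⟨ sum-comm (λ i t → tot t p * (2ℤ * after t i * mass (x i) f)) ⟩
                 sum (λ t → sum (λ i → tot t p * (2ℤ * after t i * mass (x i) f)))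
                   ≡⟨ sum-cong (λ t → sum-*ˡ (tot t p) _) ⟩
                 sum (λ t → tot t p * ap (between t) f)
                   ≡⟨ sum-odd κ κ-involutive (λ t → tot t p) (λ t → ap (between t) f) (λ t → tot-κ t p) ⟩
                 sum (λ j → tot (arch j) p * (ap (between (arch j)) f - ap (between (κ (arch j))) f))
                   ≡⟨ sum-cong (λ j → cong (λ y → tot (arch j) p * (ap (between (arch j)) f + y)) (sym (ℤₚ.-1*i≡-i _))) ⟩
                 sum (λ j → tot (arch j) p * (ap (between (arch j)) f + -1ℤ * ap (between (κ (arch j))) f)) ∎) ⟩
          val z c (concat (Vec.toList xs)) f
            + sum (λ j → tot (arch j) p * (ap (between (arch j)) f + -1ℤ * ap (between (κ (arch j))) f)) ∎
          where
          open ≡-Reasoning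
          x : Fin (suc k) → List Occ
          x = Vec.lookup xs
          step : ∀ i → val z (stateˣ z c xs vs i) (x i) f ≡
                 val z (stateᶜ z c xs i) (x i) f + sum (λ t → tot t p * (2ℤ * after t i * mass (x i) f))
          step i = begin
            val z (stateˣ z c xs vs i) (x i) f
              ≡⟨ cong (λ d → val z d (x i) f) (trans (cong (λ e → stateˣ z e xs vs i) (sym (ℤₚ.+-identityʳ c)))
                   (trans (stateˣ-stateᶜ z c 0ℤ xs vs i) (cong (stateᶜ z c xs i +_) (ℤₚ.+-identityˡ _)))) ⟩
            val z (stateᶜ z c xs i + sum (λ t → tot t p * (2ℤ * after t i))) (x i) f
              ≡⟨ val-shift z (stateᶜ z c xs i) _ (x i) f ⟩
            val z (stateᶜ z c xs i) (x i) f + sum (λ t → tot t p * (2ℤ * after t i)) * mass (x i) f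
              ≡⟨ cong (val z (stateᶜ z c xs i) (x i) f +_) (trans (sym (sum-*ʳ (mass (x i) f) _))
                   (sum-cong λ t → ℤₚ.*-assoc (tot t p) (2ℤ * after t i) _)) ⟩
            val z (stateᶜ z c xs i) (x i) f + sum (λ t → tot t p * (2ℤ * after t i * mass (x i) f)) ∎

        -- The failure of the function to be symmetric on v_r and v_κ(r): the start value of v_κ(r)
        -- read backwards, minus that of v_r. Being odd under `κ`, it leaves one constant for each
        -- arch.
        mismatch : Fin k → Parameter → ℤ
        mismatch r ((z , _) , c) = stateᵛ z c xs vs (κ r) - 2ℤ * total z (Vec.lookup vs r) - stateᵛ z c xs vs r

        mismatch-κ : ∀ r p → mismatch (κ r) p ≡ - mismatch r p
        mismatch-κ r p@((z , _) , c) = trans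
          (cong₂ (λ r′ t → stateᵛ z c xs vs r′ - 2ℤ * t - stateᵛ z c xs vs (κ r)) (κ-involutive r) (tot-κ r p))
          (flip (stateᵛ z c xs vs r) (stateᵛ z c xs vs (κ r)) (tot r p))
          where
          flip : ∀ s s′ t → s - 2ℤ * - t - s′ ≡ - (s′ - 2ℤ * t - s)
          flip = solve-∀

        vmass : Fin k → Functional
        vmass r = push (massF (Vec.lookup vs r))

        -- On v_r and v_κ(r) the function is symmetric up to a constant for each arch, and on symmetric functions
        -- the form vanishes because σ reverses the sign of ω.
        W≋ : ∀ p → W p ≋ push (W p) ⊞ ⨁ (λ j → mismatch (arch j) p ⊙ (vmass (arch j) ⊞ -1ℤ ⊙ vmass (κ (arch j))))
        W≋ p@((z , z-ι) , c) .ap≡ f = begin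
          sum (λ r → val z (st r) (v r) f)
            ≡⟨ sum-permute _ κ κ-involutive ⟩
          sum (λ r → val z (st (κ r)) (v (κ r)) f)
            ≡⟨ sum-cong step ⟩
          sum (λ r → val z (st r) (v r) (f ∘ σ) + mismatch r p * ap (vmass r) f)
            ≡⟨ sum-+ (λ r → val z (st r) (v r) (f ∘ σ)) _ ⟩
          ap (push (W p)) f + sum (λ r → mismatch r p * ap (vmass r) f)
            ≡⟨ cong (ap (push (W p)) f +_) (trans
                 (sum-odd κ κ-involutive (λ r → mismatch r p) (λ r → ap (vmass r) f) (λ r → mismatch-κ r p))
                 (sum-cong (λ j → cong (λ y → mismatch (arch j) p * (ap (vmass (arch j)) f + y)) (sym (ℤₚ.-1*i≡-i _))))) ⟩
          ap (push (W p)) f + sum (λ j → mismatch (arch j) p * (ap (vmass (arch j)) f + -1ℤ * ap (vmass (κ (arch j))) f)) ∎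
          where
          open ≡-Reasoning
          v : Fin k → List Occ
          v = Vec.lookup vs
          st : Fin k → ℤ
          st = stateᵛ z c xs vs
          step : ∀ r → val z (st (κ r)) (v (κ r)) f ≡ val z (st r) (v r) (f ∘ σ) + mismatch r p * ap (vmass r) f
          step r = begin
            val z (st (κ r)) (v (κ r)) f
              ≡⟨ cong (λ s → val z (st (κ r)) s f) (symmetric r) ⟩
            val z (st (κ r)) (reverse (List.map σ (v r))) f
              ≡⟨ val-reverse z z-ι (st (κ r)) (v r) f ⟩
            val z (st (κ r) - 2ℤ * total z (v r)) (v r) (f ∘ σ)
              ≡⟨ cong (λ d → val z d (v r) (f ∘ σ)) (offset (st r) (st (κ r) - 2ℤ * total z (v r))) ⟩
            val z (st r + mismatch r p) (v r) (f ∘ σ)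
              ≡⟨ val-shift z (st r) (mismatch r p) (v r) (f ∘ σ) ⟩
            val z (st r) (v r) (f ∘ σ) + mismatch r p * mass (v r) (f ∘ σ) ∎
            where
            offset : ∀ s u → u ≡ s + (u - s)
            offset = solve-∀

      -- The letters of the x_i and of the v_r are disjoint, so the form splits into an outer and an
      -- inner part, each at a cost of two products per arch. The factor 2 comes from the inner
      -- part: as `push` reverses the sign, twice the form at `W` is its difference from the form at
      -- `push (W p)`, to which `low-perturbed` applies.
      form-bridge : Low ((arches ℕ.+ arches) ℕ.+ (arches ℕ.+ arches))
        (λ ((z , _) , c) ((z′ , _) , c′) →
          2ℤ * (form (interleave xs vs) z c z′ c′ - form (concat (Vec.toList xs)) z c z′ c′))
      form-bridge = low-cong expand
        (low-+ (low-* 2ℤ (low-perturbed {X = X} {R} _ _ X≋)) (low-perturbed {X = W} {push ∘ W} _ _ W≋))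
        where
        open ≡-Reasoning
        XP : ∀ p → Supported P (X p)
        XP p = supported-⨁ λ i → V-supported _ _ (xs-P i)
        WQ : ∀ p → Supported Q (W p)
        WQ p = supported-⨁ λ r → V-supported _ _ (vs-Q r)
        expand : ∀ p p′ → let ((z , _) , c) = p ; ((z′ , _) , c′) = p′ in
          2ℤ * (form (interleave xs vs) z c z′ c′ - form (concat (Vec.toList xs)) z c z′ c′) ≡
          2ℤ * (⟪ X p , X p′ ⟫ - ⟪ R p , R p′ ⟫) + (⟪ W p , W p′ ⟫ - ⟪ push (W p) , push (W p′) ⟫)
        expand p@((z , _) , c) p′@((z′ , _) , c′) = begin
          2ℤ * (form (interleave xs vs) z c z′ c′ - r)
            ≡⟨ cong (λ x → 2ℤ * (x - r)) (trans
                 (⟪⟫-cong (ap-≡ (val-interleave z c xs vs)) (ap-≡ (val-interleave z′ c′ xs vs)))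
                 (⟪⟫-orthogonal (XP p) (XP p′) (WQ p) (WQ p′) P∩Q)) ⟩
          2ℤ * (⟪ X p , X p′ ⟫ + w - r)
            ≡⟨ ring ⟪ X p , X p′ ⟫ w r ⟩
          2ℤ * (⟪ X p , X p′ ⟫ - r) + (w - - w)
            ≡⟨ cong (λ x → 2ℤ * (⟪ X p , X p′ ⟫ - r) + (w - x)) (sym (⟪push,push⟫ (W p) (W p′))) ⟩
          2ℤ * (⟪ X p , X p′ ⟫ - r) + (w - ⟪ push (W p) , push (W p′) ⟫) ∎
          where
          r w : ℤ
          r = ⟪ R p , R p′ ⟫
          w = ⟪ W p , W p′ ⟫
          ring : ∀ x w r → 2ℤ * (x + w - r) ≡ 2ℤ * (x - r) + (w - - w)
          ring = solve-∀

-- Charges of the occurrences in an uncharged word.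

module Charging {L : Set} (_≟_ : DecidableEquality L) (charge : L → ℤ) where

  open Conditionals
  open FiniteSums
  open ChargedWords _≟_
  open import Data.List.Membership.DecPropositional _≟_ using (_∈?_)
  open import Data.Integer.Base using (_+_; _*_; -_; _-_)

  private
    variable
      A B C : L
      r r′ u v w x y : List L

  sign-if : ∀ {p} {P : Set p} → Dec P → L → ℤ
  sign-if d A = if does d then charge A else - charge A

  sign-if-cong : ∀ {p q} {P : Set p} {Q : Set q} (d : Dec P) (e : Dec Q) → (P → Q) → (Q → P) → ∀ A → sign-if d A ≡ sign-if e A
  sign-if-cong (yes p) e to from A = sym (if-yes e (to p))
  sign-if-cong (no ¬p) e to from A = sym (if-no e (¬p ∘ from))

  -- w is part of a word in which it is followed by r.
  charges : List L → List L → List Occ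
  charges r []      = []
  charges r (A ∷ w) = (A , sign-if (A ∈? (w ++ r)) A) ∷ charges r w

  charges-++ : ∀ r x y → charges r (x ++ y) ≡ charges (y ++ r) x ++ charges r y
  charges-++ r []      y = refl
  charges-++ r (A ∷ x) y = cong₂ _∷_
    (cong (λ v → A , sign-if (A ∈? v) A) (Listₚ.++-assoc x y r)) (charges-++ r x y)

  charges-cong : ∀ w → (∀ {A} → A ∈ w → (A ∈ r → A ∈ r′) × (A ∈ r′ → A ∈ r)) → charges r w ≡ charges r′ w
  charges-cong []      iff = refl
  charges-cong {r} {r′} (A ∷ w) iff = cong₂ _∷_
    (cong (A ,_) (sign-if-cong (A ∈? (w ++ r)) (A ∈? (w ++ r′)) (go proj₁) (go proj₂) A))
    (charges-cong w (iff ∘ there))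
    where
    go : ∀ {s t} → (((A ∈ r → A ∈ r′) × (A ∈ r′ → A ∈ r)) → A ∈ s → A ∈ t) → A ∈ w ++ s → A ∈ w ++ t
    go f A∈ with ∈ₚ.∈-++⁻ w A∈
    ... | inj₁ A∈w = ∈ₚ.∈-++⁺ˡ A∈w
    ... | inj₂ A∈s = ∈ₚ.∈-++⁺ʳ w (f (iff (here refl)) A∈s)

  charges-letters : ∀ {P : L → Set} → All P w → All (P ∘ proj₁) (charges r w)
  charges-letters []       = []
  charges-letters (p ∷ ps) = p ∷ charges-letters ps

  charges-skip : ∀ u v → A ∉ w → charges (u ++ A ∷ v) w ≡ charges (u ++ v) w
  charges-skip {A} {w} u v A∉w = charges-cong w λ B∈w → to B∈w , from
    where
    to : ∀ {B} → B ∈ w → B ∈ u ++ A ∷ v → B ∈ u ++ v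
    to B∈w B∈ with ∈ₚ.∈-++⁻ u B∈
    ... | inj₁ B∈u         = ∈ₚ.∈-++⁺ˡ B∈u
    ... | inj₂ (here refl) = contradiction B∈w A∉w
    ... | inj₂ (there B∈v) = ∈ₚ.∈-++⁺ʳ u B∈v
    from : ∀ {B} → B ∈ u ++ v → B ∈ u ++ A ∷ v
    from B∈ with ∈ₚ.∈-++⁻ u B∈
    ... | inj₁ B∈u = ∈ₚ.∈-++⁺ˡ B∈u
    ... | inj₂ B∈v = ∈ₚ.∈-++⁺ʳ u (there B∈v)

  charges-first : A ∈ w ++ r → charges r (A ∷ w) ≡ (A , charge A) ∷ charges r w
  charges-first {A} {w} {r} A∈ = cong (λ q → (A , q) ∷ charges r w) (if-yes (A ∈? (w ++ r)) A∈)

  charges-second : A ∉ w ++ r → charges r (A ∷ w) ≡ (A , - charge A) ∷ charges r w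
  charges-second {A} {w} {r} A∉ = cong (λ q → (A , q) ∷ charges r w) (if-no (A ∈? (w ++ r)) A∉)

  ∉-++ : A ∉ u → A ∉ v → A ∉ u ++ v
  ∉-++ {u = u} A∉u A∉v A∈ with ∈ₚ.∈-++⁻ u A∈
  ... | inj₁ A∈u = A∉u A∈u
  ... | inj₂ A∈v = A∉v A∈v

  ∉-∷ : A ≢ B → A ∉ u → A ∉ B ∷ u
  ∉-∷ A≢B A∉ (here A≡B) = A≢B A≡B
  ∉-∷ A≢B A∉ (there A∈) = A∉ A∈

  private
    nil : ∀ {u : List L} → A ∉ u → A ∉ u ++ []
    nil A∉ = ∉-++ A∉ λ ()

  charges-homotopy₁ : A ∉ x → A ∉ y →
    charges [] (x ++ A ∷ A ∷ y) ≡ charges y x ++ (A , charge A) ∷ (A , - charge A) ∷ charges [] y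
  charges-homotopy₁ {A} {x} {y} A∉x A∉y = begin
    charges [] (x ++ A ∷ A ∷ y)
      ≡⟨ charges-++ [] x (A ∷ A ∷ y) ⟩
    charges (A ∷ A ∷ y ++ []) x ++ charges [] (A ∷ A ∷ y)
      ≡⟨ cong₂ _++_ (trans (charges-skip [] (A ∷ y ++ []) A∉x) (trans (charges-skip [] (y ++ []) A∉x)
                      (cong (λ r → charges r x) (Listₚ.++-identityʳ y))))
           (trans (charges-first {A} {A ∷ y} (here refl)) (cong ((A , charge A) ∷_) (charges-second {A} {y} (nil A∉y)))) ⟩
    charges y x ++ (A , charge A) ∷ (A , - charge A) ∷ charges [] y ∎
    where open ≡-Reasoning

  charges-homotopy₂ : ∀ {z} → A ≢ B → A ∉ x → A ∉ y → A ∉ z → B ∉ x → B ∉ y → B ∉ z →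
    charges [] (x ++ A ∷ B ∷ y ++ B ∷ A ∷ z) ≡
    charges (y ++ z) x ++ (A , charge A) ∷ (B , charge B) ∷ charges z y ++ (B , - charge B) ∷ (A , - charge A) ∷ charges [] z
  charges-homotopy₂ {A} {B} {x} {y} {z} A≢B A∉x A∉y A∉z B∉x B∉y B∉z = begin
    charges [] (x ++ A ∷ B ∷ y ++ B ∷ A ∷ z)
      ≡⟨ charges-++ [] x (A ∷ B ∷ y ++ B ∷ A ∷ z) ⟩
    charges (A ∷ B ∷ (y ++ B ∷ A ∷ z) ++ []) x ++ charges [] (A ∷ B ∷ y ++ B ∷ A ∷ z)
      ≡⟨ cong₂ _++_ ctx-x (trans
           (charges-first {A} {B ∷ y ++ B ∷ A ∷ z} (there (∈ₚ.∈-++⁺ˡ (∈ₚ.∈-++⁺ʳ y (there (here refl))))))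
           (cong ((A , charge A) ∷_) (trans
             (charges-first {B} {y ++ B ∷ A ∷ z} (∈ₚ.∈-++⁺ˡ (∈ₚ.∈-++⁺ʳ y (here refl))))
             (cong ((B , charge B) ∷_) (trans (charges-++ [] y (B ∷ A ∷ z)) (cong₂ _++_ ctx-y (trans
               (charges-second {B} {A ∷ z} (∉-∷ (A≢B ∘ sym) (nil B∉z)))
               (cong ((B , - charge B) ∷_) (charges-second {A} {z} (nil A∉z)))))))))) ⟩
    charges (y ++ z) x ++ (A , charge A) ∷ (B , charge B) ∷ charges z y ++ (B , - charge B) ∷ (A , - charge A) ∷ charges [] z ∎
    where
    open ≡-Reasoning
    ctx-x : charges (A ∷ B ∷ (y ++ B ∷ A ∷ z) ++ []) x ≡ charges (y ++ z) x
    ctx-x = trans (cong (λ r → charges (A ∷ B ∷ r) x) (Listₚ.++-identityʳ _))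
      (trans (charges-skip [] _ A∉x) (trans (charges-skip [] _ B∉x)
      (trans (charges-skip y _ B∉x) (charges-skip y z A∉x))))
    ctx-y : charges (B ∷ A ∷ z ++ []) y ≡ charges z y
    ctx-y = trans (charges-skip [] _ B∉y) (trans (charges-skip [] _ A∉y) (cong (λ r → charges r y) (Listₚ.++-identityʳ z)))

  charges-homotopy₃ : ∀ {x y z t} → A ≢ B → A ≢ C → B ≢ C →
    (∀ {D} → D ∈ A ∷ B ∷ C ∷ [] → (D ∉ x) × (D ∉ y) × (D ∉ z) × (D ∉ t)) →
    charges [] (x ++ A ∷ B ∷ y ++ A ∷ C ∷ z ++ B ∷ C ∷ t) ≡
    charges (y ++ z ++ t) x ++ (A , charge A) ∷ (B , charge B) ∷ charges (z ++ t) y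
      ++ (A , - charge A) ∷ (C , charge C) ∷ charges t z ++ (B , - charge B) ∷ (C , - charge C) ∷ charges [] t
  charges-homotopy₃ {A} {B} {C} {x} {y} {z} {t} A≢B A≢C B≢C new = begin
    charges [] (x ++ A ∷ B ∷ w₁)
      ≡⟨ charges-++ [] x (A ∷ B ∷ w₁) ⟩
    charges (A ∷ B ∷ w₁ ++ []) x ++ charges [] (A ∷ B ∷ w₁)
      ≡⟨ cong₂ _++_ ctx-x (trans (charges-first {A} {B ∷ w₁} (there (∈ₚ.∈-++⁺ˡ (∈ₚ.∈-++⁺ʳ y (here refl)))))
           (cong ((A , charge A) ∷_) (trans
             (charges-first {B} {w₁} (∈ₚ.∈-++⁺ˡ (∈ₚ.∈-++⁺ʳ y (there (there (∈ₚ.∈-++⁺ʳ z (here refl)))))))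
             (cong ((B , charge B) ∷_) tail₁)))) ⟩
    charges (y ++ z ++ t) x ++ (A , charge A) ∷ (B , charge B) ∷ charges (z ++ t) y
      ++ (A , - charge A) ∷ (C , charge C) ∷ charges t z ++ (B , - charge B) ∷ (C , - charge C) ∷ charges [] t ∎
    where
    open ≡-Reasoning
    w₁ w₂ : List L
    w₂ = z ++ B ∷ C ∷ t
    w₁ = y ++ A ∷ C ∷ w₂
    iA : A ∈ A ∷ B ∷ C ∷ []
    iA = here refl
    iB : B ∈ A ∷ B ∷ C ∷ []
    iB = there (here refl)
    iC : C ∈ A ∷ B ∷ C ∷ []
    iC = there (there (here refl))
    nx : ∀ {D} → D ∈ A ∷ B ∷ C ∷ [] → D ∉ x
    nx i = proj₁ (new i)
    ny : ∀ {D} → D ∈ A ∷ B ∷ C ∷ [] → D ∉ y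
    ny i = proj₁ (proj₂ (new i))
    nz : ∀ {D} → D ∈ A ∷ B ∷ C ∷ [] → D ∉ z
    nz i = proj₁ (proj₂ (proj₂ (new i)))
    nt : ∀ {D} → D ∈ A ∷ B ∷ C ∷ [] → D ∉ t
    nt i = proj₂ (proj₂ (proj₂ (new i)))
    skip₂ : ∀ {u} → B ∉ u → C ∉ u → ∀ p → charges (p ++ w₂) u ≡ charges (p ++ z ++ t) u
    skip₂ {u} B∉ C∉ p = trans (cong (λ r → charges r u) (sym (Listₚ.++-assoc p z _)))
      (trans (charges-skip (p ++ z) _ B∉) (trans (charges-skip (p ++ z) t C∉)
        (cong (λ r → charges r u) (Listₚ.++-assoc p z t))))
    ctx-x : charges (A ∷ B ∷ w₁ ++ []) x ≡ charges (y ++ z ++ t) x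
    ctx-x = trans (cong (λ r → charges (A ∷ B ∷ r) x) (Listₚ.++-identityʳ w₁))
      (trans (charges-skip [] _ (nx iA)) (trans (charges-skip [] _ (nx iB))
      (trans (charges-skip y _ (nx iA)) (trans (charges-skip y _ (nx iC)) (skip₂ (nx iB) (nx iC) y)))))
    tail₂ : charges [] w₂ ≡ charges t z ++ (B , - charge B) ∷ (C , - charge C) ∷ charges [] t
    tail₂ = trans (charges-++ [] z (B ∷ C ∷ t)) (cong₂ _++_
      (trans (cong (λ r → charges (B ∷ C ∷ r) z) (Listₚ.++-identityʳ t))
        (trans (charges-skip [] _ (nz iB)) (charges-skip [] _ (nz iC))))
      (trans (charges-second {B} {C ∷ t} (∉-∷ B≢C (nil (nt iB))))
        (cong ((B , - charge B) ∷_) (charges-second {C} {t} (nil (nt iC))))))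
    tail₁ : charges [] w₁ ≡ charges (z ++ t) y ++ (A , - charge A) ∷ (C , charge C) ∷ charges t z
            ++ (B , - charge B) ∷ (C , - charge C) ∷ charges [] t
    tail₁ = trans (charges-++ [] y (A ∷ C ∷ w₂)) (cong₂ _++_
      (trans (cong (λ r → charges (A ∷ C ∷ r) y) (Listₚ.++-identityʳ w₂))
        (trans (charges-skip [] _ (ny iA)) (trans (charges-skip [] _ (ny iC)) (skip₂ (ny iB) (ny iC) []))))
      (trans (charges-second {A} {C ∷ w₂} (∉-∷ A≢C (nil (∉-++ (nz iA) (∉-∷ A≢B (∉-∷ A≢C (nt iA)))))))
        (cong ((A , - charge A) ∷_) (trans
          (charges-first {C} {w₂} (∈ₚ.∈-++⁺ˡ (∈ₚ.∈-++⁺ʳ z (there (here refl)))))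
          (cong ((C , charge C) ∷_) tail₂)))))

  -- Reversing the three pairs gives a pattern that is not a relabelling of the previous one. In
  -- both, `A` and `B` open in the first pair and `C` in the second, so the charges travel with the
  -- occurrences.
  charges-homotopy₃′ : ∀ {x y z t} → A ≢ B → A ≢ C → B ≢ C →
    (∀ {D} → D ∈ A ∷ B ∷ C ∷ [] → (D ∉ x) × (D ∉ y) × (D ∉ z) × (D ∉ t)) →
    charges [] (x ++ B ∷ A ∷ y ++ C ∷ A ∷ z ++ C ∷ B ∷ t) ≡
    charges (y ++ z ++ t) x ++ (B , charge B) ∷ (A , charge A) ∷ charges (z ++ t) y
      ++ (C , charge C) ∷ (A , - charge A) ∷ charges t z ++ (C , - charge C) ∷ (B , - charge B) ∷ charges [] t
  charges-homotopy₃′ {A} {B} {C} {x} {y} {z} {t} A≢B A≢C B≢C new = begin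
    charges [] (x ++ B ∷ A ∷ w₁)
      ≡⟨ charges-++ [] x (B ∷ A ∷ w₁) ⟩
    charges (B ∷ A ∷ w₁ ++ []) x ++ charges [] (B ∷ A ∷ w₁)
      ≡⟨ cong₂ _++_ ctx-x (trans (charges-first {B} {A ∷ w₁}
             (there (∈ₚ.∈-++⁺ˡ (∈ₚ.∈-++⁺ʳ y (there (there (∈ₚ.∈-++⁺ʳ z (there (here refl)))))))))
           (cong ((B , charge B) ∷_) (trans
             (charges-first {A} {w₁} (∈ₚ.∈-++⁺ˡ (∈ₚ.∈-++⁺ʳ y (there (here refl)))))
             (cong ((A , charge A) ∷_) tail₁)))) ⟩
    charges (y ++ z ++ t) x ++ (B , charge B) ∷ (A , charge A) ∷ charges (z ++ t) y
      ++ (C , charge C) ∷ (A , - charge A) ∷ charges t z ++ (C , - charge C) ∷ (B , - charge B) ∷ charges [] t ∎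
    where
    open ≡-Reasoning
    w₁ w₂ : List L
    w₂ = z ++ C ∷ B ∷ t
    w₁ = y ++ C ∷ A ∷ w₂
    iA : A ∈ A ∷ B ∷ C ∷ []
    iA = here refl
    iB : B ∈ A ∷ B ∷ C ∷ []
    iB = there (here refl)
    iC : C ∈ A ∷ B ∷ C ∷ []
    iC = there (there (here refl))
    nx : ∀ {D} → D ∈ A ∷ B ∷ C ∷ [] → D ∉ x
    nx i = proj₁ (new i)
    ny : ∀ {D} → D ∈ A ∷ B ∷ C ∷ [] → D ∉ y
    ny i = proj₁ (proj₂ (new i))
    nz : ∀ {D} → D ∈ A ∷ B ∷ C ∷ [] → D ∉ z
    nz i = proj₁ (proj₂ (proj₂ (new i)))
    nt : ∀ {D} → D ∈ A ∷ B ∷ C ∷ [] → D ∉ t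
    nt i = proj₂ (proj₂ (proj₂ (new i)))
    skip₂ : ∀ {u} → B ∉ u → C ∉ u → ∀ p → charges (p ++ w₂) u ≡ charges (p ++ z ++ t) u
    skip₂ {u} B∉ C∉ p = trans (cong (λ r → charges r u) (sym (Listₚ.++-assoc p z _)))
      (trans (charges-skip (p ++ z) _ C∉) (trans (charges-skip (p ++ z) t B∉)
        (cong (λ r → charges r u) (Listₚ.++-assoc p z t))))
    ctx-x : charges (B ∷ A ∷ w₁ ++ []) x ≡ charges (y ++ z ++ t) x
    ctx-x = trans (cong (λ r → charges (B ∷ A ∷ r) x) (Listₚ.++-identityʳ w₁))
      (trans (charges-skip [] _ (nx iB)) (trans (charges-skip [] _ (nx iA))
      (trans (charges-skip y _ (nx iC)) (trans (charges-skip y _ (nx iA)) (skip₂ (nx iB) (nx iC) y)))))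
    tail₂ : charges [] w₂ ≡ charges t z ++ (C , - charge C) ∷ (B , - charge B) ∷ charges [] t
    tail₂ = trans (charges-++ [] z (C ∷ B ∷ t)) (cong₂ _++_
      (trans (cong (λ r → charges (C ∷ B ∷ r) z) (Listₚ.++-identityʳ t))
        (trans (charges-skip [] _ (nz iC)) (charges-skip [] _ (nz iB))))
      (trans (charges-second {C} {B ∷ t} (∉-∷ (B≢C ∘ sym) (nil (nt iC))))
        (cong ((C , - charge C) ∷_) (charges-second {B} {t} (nil (nt iB))))))
    tail₁ : charges [] w₁ ≡ charges (z ++ t) y ++ (C , charge C) ∷ (A , - charge A) ∷ charges t z
            ++ (C , - charge C) ∷ (B , - charge B) ∷ charges [] t
    tail₁ = trans (charges-++ [] y (C ∷ A ∷ w₂)) (cong₂ _++_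
      (trans (cong (λ r → charges (C ∷ A ∷ r) y) (Listₚ.++-identityʳ w₂))
        (trans (charges-skip [] _ (ny iC)) (trans (charges-skip [] _ (ny iA)) (skip₂ (ny iB) (ny iC) []))))
      (trans (charges-first {C} {A ∷ w₂} (there (∈ₚ.∈-++⁺ˡ (∈ₚ.∈-++⁺ʳ z (here refl)))))
        (cong ((C , charge C) ∷_) (trans
          (charges-second {A} {w₂} (nil (∉-++ (nz iA) (∉-∷ A≢C (∉-∷ A≢B (nt iA))))))
          (cong ((A , - charge A) ∷_) tail₂)))))

  charges-shift : A ∉ x → A ∉ y →
    charges [] (A ∷ x ++ A ∷ y) ≡ (A , charge A) ∷ charges y x ++ (A , - charge A) ∷ charges [] y
  charges-shift {A} {x} {y} A∉x A∉y = trans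
    (charges-first {A} {x ++ A ∷ y} (∈ₚ.∈-++⁺ˡ (∈ₚ.∈-++⁺ʳ x (here refl))))
    (cong ((A , charge A) ∷_) (trans (charges-++ [] x (A ∷ y)) (cong₂ _++_
      (trans (charges-skip [] _ A∉x) (cong (λ r → charges r x) (Listₚ.++-identityʳ y)))
      (charges-second {A} {y} (nil A∉y)))))

  charges-shifted : A ∉ x → A ∉ y →
    charges [] (x ++ A ∷ y ++ A ∷ []) ≡ charges y x ++ (A , charge A) ∷ charges [] y ++ (A , - charge A) ∷ []
  charges-shifted {A} {x} {y} A∉x A∉y = trans (charges-++ [] x (A ∷ y ++ A ∷ [])) (cong₂ _++_
    (trans (charges-skip [] _ A∉x) (trans (cong (λ r → charges r x) (Listₚ.++-identityʳ (y ++ A ∷ [])))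
      (trans (charges-skip y [] A∉x) (cong (λ r → charges r x) (Listₚ.++-identityʳ y)))))
    (trans (charges-first {A} {y ++ A ∷ []} (∈ₚ.∈-++⁺ˡ (∈ₚ.∈-++⁺ʳ y (here refl))))
      (cong ((A , charge A) ∷_) (trans (charges-++ [] y (A ∷ [])) (cong₂ _++_
        (charges-skip [] [] A∉y) (charges-second {A} {[]} {[]} λ ()))))))

  suffix : (w : List L) → Fin (length w) → List L
  suffix (A ∷ w) zero    = w
  suffix (A ∷ w) (suc k) = suffix w k

  charges-tabulate : ∀ r w → charges r w ≡
    tabulate λ k → List.lookup w k , sign-if (List.lookup w k ∈? (suffix w k ++ r)) (List.lookup w k)
  charges-tabulate r []      = refl
  charges-tabulate r (A ∷ w) = cong ((A , sign-if (A ∈? (w ++ r)) A) ∷_) (charges-tabulate r w)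

  ∈-suffix⁺ : ∀ w (k l : Fin (length w)) → k Fin.< l → List.lookup w l ∈ suffix w k
  ∈-suffix⁺ (A ∷ w) zero    (suc l) _         = ∈ₚ.∈-lookup l
  ∈-suffix⁺ (A ∷ w) (suc k) (suc l) (ℕ.s≤s p) = ∈-suffix⁺ w k l p

  ∈-suffix⁻ : ∀ w k → B ∈ suffix w k → ∃ λ l → k Fin.< l × List.lookup w l ≡ B
  ∈-suffix⁻ (A ∷ w) zero    B∈ = suc (index B∈) , ℕ.z<s , sym (Anyₚ.lookup-index B∈)
  ∈-suffix⁻ (A ∷ w) (suc k) B∈ with ∈-suffix⁻ w k B∈
  ... | l , k<l , e = suc l , ℕ.s<s k<l , e

  module _ (twice : ∀ A → Twice w A) where

    open Twice

    isLeft? : (k : Fin (length w)) → Dec (k ≡ left (twice (List.lookup w k)))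
    isLeft? k = k Finₚ.≟ left (twice (List.lookup w k))

    ∈-suffix⇒left : ∀ k → List.lookup w k ∈ suffix w k → k ≡ left (twice (List.lookup w k))
    ∈-suffix⇒left k A∈ with only (twice (List.lookup w k)) k refl
    ... | inj₁ k≡l = k≡l
    ... | inj₂ k≡r with ∈-suffix⁻ w k A∈
    ...   | l , k<l , e with only (twice (List.lookup w k)) l e
    ...     | inj₁ l≡l = contradiction (left<right (twice (List.lookup w k))) (Finₚ.<-asym (subst₂ Fin._<_ k≡r l≡l k<l))
    ...     | inj₂ l≡r = contradiction (trans k≡r (sym l≡r)) (Finₚ.<⇒≢ k<l)

    left⇒∈-suffix : ∀ k → k ≡ left (twice (List.lookup w k)) → List.lookup w k ∈ suffix w k
    left⇒∈-suffix k k≡l = subst (_∈ suffix w k) (at-right (twice (List.lookup w k)))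
      (∈-suffix⁺ w k _ (subst (Fin._< right (twice (List.lookup w k))) (sym k≡l) (left<right (twice (List.lookup w k)))))

    -- The link between the recursive charges, which suit concatenation, and the positions `left`
    -- and `right`, in terms of which the pairing of a nanoword is defined. A letter recurs in the
    -- suffix exactly at its left occurrence.
    charges-twice : charges [] w ≡ tabulate λ k → List.lookup w k , sign-if (isLeft? k) (List.lookup w k)
    charges-twice = trans (charges-tabulate [] w) (Listₚ.tabulate-cong λ k → cong (List.lookup w k ,_)
      (sign-if-cong (List.lookup w k ∈? (suffix w k ++ [])) (isLeft? k)
        (∈-suffix⇒left k ∘ subst (List.lookup w k ∈_) (Listₚ.++-identityʳ _))
        (subst (List.lookup w k ∈_) (sym (Listₚ.++-identityʳ _)) ∘ left⇒∈-suffix k)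
        (List.lookup w k)))

-- Counting the occurrences of a letter.

module Counting {L : Set} (_≟_ : DecidableEquality L) where

  open Conditionals
  open Twice

  count : L → List L → ℕ
  count A []      = 0
  count A (B ∷ w) = (if does (A ≟ B) then 1 else 0) ℕ.+ count A w

  count-++ : ∀ A u v → count A (u ++ v) ≡ count A u ℕ.+ count A v
  count-++ A []      v = refl
  count-++ A (B ∷ u) v = trans (cong (_ ℕ.+_) (count-++ A u v)) (sym (ℕₚ.+-assoc (if does (A ≟ B) then 1 else 0) _ _))

  count-here : ∀ A w → count A (A ∷ w) ≡ suc (count A w)
  count-here A w = cong (ℕ._+ count A w) (if-yes (A ≟ A) refl)

  count-there : ∀ {A B} → A ≢ B → ∀ w → count A (B ∷ w) ≡ count A w
  count-there {A} {B} A≢B w = cong (ℕ._+ count A w) (if-no (A ≟ B) A≢B)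

  count≡0⇒∉ : ∀ {A} w → count A w ≡ 0 → A ∉ w
  count≡0⇒∉ {A} (B ∷ w) e (here refl) = contradiction (trans (sym (count-here A w)) e) λ ()
  count≡0⇒∉ {A} (B ∷ w) e (there A∈)  = count≡0⇒∉ w (ℕₚ.m+n≡0⇒n≡0 (if does (A ≟ B) then 1 else 0) e) A∈

  ∉⇒count≡0 : ∀ {A} w → A ∉ w → count A w ≡ 0
  ∉⇒count≡0 []      _  = refl
  ∉⇒count≡0 (B ∷ w) A∉ = trans (count-there (A∉ ∘ here) w) (∉⇒count≡0 w (A∉ ∘ there))

  once : ∀ {A} w (i : Fin (length w)) → List.lookup w i ≡ A → (∀ k → List.lookup w k ≡ A → k ≡ i) → count A w ≡ 1
  once (B ∷ w) zero    refl uniq = trans (count-here B w) (cong suc (∉⇒count≡0 w λ B∈ →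
    contradiction (uniq (suc (index B∈)) (sym (Anyₚ.lookup-index B∈))) λ ()))
  once (B ∷ w) (suc i) e    uniq = trans (count-there (λ { refl → contradiction (uniq zero refl) λ () }) w)
    (once w i e λ k e′ → Finₚ.suc-injective (uniq (suc k) e′))

  -- Serves the third homotopy move: there x, y, z, t are words in the full alphabet, and the
  -- absence of A, B, C from them has to be recovered by counting.
  count-twice : ∀ {A} w → Twice w A → count A w ≡ 2
  count-twice {A} (B ∷ w) t = go (left t) (right t) (left<right t) (at-left t) (at-right t) (only t)
    where
    go : ∀ i j → i Fin.< j → List.lookup (B ∷ w) i ≡ A → List.lookup (B ∷ w) j ≡ A →
         (∀ k → List.lookup (B ∷ w) k ≡ A → k ≡ i ⊎ k ≡ j) → count A (B ∷ w) ≡ 2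
    go zero    (suc j) _       refl eⱼ only = trans (count-here B w) (cong suc (once w j eⱼ unique))
      where
      unique : ∀ k → List.lookup w k ≡ B → k ≡ j
      unique k e with only (suc k) e
      ... | inj₂ p = Finₚ.suc-injective p
    go (suc i) (suc j) (ℕ.s≤s i<j) eᵢ eⱼ only = trans (count-there A≢B w)
      (count-twice w record { left = i ; right = j ; left<right = i<j ; at-left = eᵢ ; at-right = eⱼ ; only = only′ })
      where
      A≢B : A ≢ B
      A≢B refl with only zero refl
      ... | inj₁ ()
      ... | inj₂ ()
      only′ : ∀ k → List.lookup w k ≡ A → k ≡ i ⊎ k ≡ j
      only′ k e with only (suc k) e
      ... | inj₁ p = inj₁ (Finₚ.suc-injective p)
      ... | inj₂ p = inj₂ (Finₚ.suc-injective p)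

module ChargeRenaming {L L′ : Set} (_≟_ : DecidableEquality L) (_≟′_ : DecidableEquality L′)
                      (charge : L → ℤ) (charge′ : L′ → ℤ) (h : L′ → L) (h-injective : ∀ {A B} → h A ≡ h B → A ≡ B)
                      where

  private
    module C  = Charging _≟_ charge
    module C′ = Charging _≟′_ charge′
  open ChargedRenaming _≟_ _≟′_ using (rename)
  import Data.List.Membership.DecPropositional as DecMembership
  open import Data.Integer.Base using (-_)

  charges-rename : ∀ r w → (∀ {A} → A ∈ w → charge (h A) ≡ charge′ A) →
    C.charges (List.map h r) (List.map h w) ≡ List.map (rename h) (C′.charges r w)
  charges-rename r []      ch = refl
  charges-rename r (A ∷ w) ch = cong₂ _∷_
    (cong (h A ,_) (trans (C.sign-if-cong (DecMembership._∈?_ _≟_ (h A) (List.map h w ++ List.map h r))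
                                 (DecMembership._∈?_ _≟′_ A (w ++ r)) to from (h A))
                   (cong (λ q → if does (DecMembership._∈?_ _≟′_ A (w ++ r)) then q else - q) (ch (here refl)))))
    (charges-rename r w (ch ∘ there))
    where
    to : h A ∈ List.map h w ++ List.map h r → A ∈ w ++ r
    to hA∈ with ∈ₚ.∈-map⁻ h (subst (h A ∈_) (sym (Listₚ.map-++ h w r)) hA∈)
    ... | B , B∈ , e = subst (_∈ w ++ r) (sym (h-injective e)) B∈
    from : A ∈ w ++ r → h A ∈ List.map h w ++ List.map h r
    from A∈ = subst (h A ∈_) (Listₚ.map-++ h w r) (∈ₚ.∈-map⁺ h A∈)

-- Step functions and the linking of two intervals.

module Steps where

  open Conditionals
  open FiniteSums
  open import Data.Integer.Base using (_+_; _*_; -_; _-_)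

  private
    variable
      n : ℕ

  -- A jump from 0 to 2 with the mean value at the jump.
  step : Fin n → Fin n → ℤ
  step zero    zero    = 1ℤ
  step zero    (suc k) = 2ℤ
  step (suc l) zero    = 0ℤ
  step (suc l) (suc k) = step l k

  step-< : {l k : Fin n} → l Fin.< k → step l k ≡ 2ℤ
  step-< {l = zero}  {suc k} _         = refl
  step-< {l = suc l} {suc k} (ℕ.s≤s p) = step-< p

  step-≡ : (k : Fin n) → step k k ≡ 1ℤ
  step-≡ zero    = refl
  step-≡ (suc k) = step-≡ k

  step-> : {l k : Fin n} → k Fin.< l → step l k ≡ 0ℤ
  step-> {l = suc l} {zero}  _         = refl
  step-> {l = suc l} {suc k} (ℕ.s≤s p) = step-> p

  -- [a , a′] and [b , b′] stand for the left and right occurrences of two letters.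
  module _ (a a′ : Fin n) where

    -- The function on positions that one letter produces, for charge times `z` equal to 1: 2
    -- strictly between its occurrences, 1 at each of them, 0 elsewhere.
    hat : Fin n → ℤ
    hat k = step a k - step a′ k

    inside? : (k : Fin n) → Dec (a Fin.< k × k Fin.< a′)
    inside? k = (a Finₚ.<? k) ×-dec (k Finₚ.<? a′)

    inside : Fin n → ℤ
    inside k = if does (inside? k) then 1ℤ else 0ℤ

    inside-left : inside a ≡ 0ℤ
    inside-left = if-no (inside? a) λ p → Finₚ.<-irrefl refl (proj₁ p)

    inside-right : inside a′ ≡ 0ℤ
    inside-right = if-no (inside? a′) λ p → Finₚ.<-irrefl refl (proj₂ p)

    module _ (a<a′ : a Fin.< a′) where

      hat-left : hat a ≡ 1ℤ
      hat-left = cong₂ _-_ (step-≡ a) (step-> a<a′)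

      hat-right : hat a′ ≡ 1ℤ
      hat-right = cong₂ _-_ (step-< a<a′) (step-≡ a′)

      hat-inside : ∀ {k} → k ≢ a → k ≢ a′ → hat k ≡ 2ℤ * inside k
      hat-inside {k} k≢a k≢a′ with Finₚ.<-cmp a k | Finₚ.<-cmp k a′
      ... | tri≈ _ a≡k _  | _             = contradiction (sym a≡k) k≢a
      ... | _             | tri≈ _ k≡a′ _ = contradiction k≡a′ k≢a′
      ... | tri> ¬p _ k<a | tri> ¬q _ a′<k = contradiction (Finₚ.<-trans a′<k (Finₚ.<-trans k<a a<a′)) (Finₚ.<-irrefl refl)
      ... | tri< a<k _ _  | tri< k<a′ _ _ = trans (cong₂ _-_ (step-< a<k) (step-> k<a′))
              (cong (2ℤ *_) (sym (if-yes (inside? k) (a<k , k<a′))))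
      ... | tri< a<k _ _  | tri> ¬q _ a′<k = trans (cong₂ _-_ (step-< a<k) (step-< a′<k))
              (cong (2ℤ *_) (sym (if-no (inside? k) λ p → ¬q (proj₂ p))))
      ... | tri> ¬p _ k<a | tri< k<a′ _ _ = trans (cong₂ _-_ (step-> k<a) (step-> k<a′))
              (cong (2ℤ *_) (sym (if-no (inside? k) λ p → ¬p (proj₁ p))))

  module _ (a a′ b b′ : Fin n) where

    linked? : Dec (a Fin.< b × b Fin.< a′ × a′ Fin.< b′)
    linked? = (a Finₚ.<? b) ×-dec (b Finₚ.<? a′) ×-dec (a′ Finₚ.<? b′)

  linking : (a a′ b b′ : Fin n) → ℤ
  linking a a′ b b′ =
    if does (linked? a a′ b b′) then 1ℤ else if does (linked? b b′ a a′) then -1ℤ else 0ℤ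

  module _ {a a′ b b′ : Fin n} where

    linking-self : linking a a′ a a′ ≡ 0ℤ
    linking-self = trans (if-no (linked? a a′ a a′) λ p → Finₚ.<-irrefl refl (proj₁ p))
                         (if-no (linked? a a′ a a′) λ p → Finₚ.<-irrefl refl (proj₁ p))

    inside-∧ : ∀ {c c′ d d′ e e′ : Fin n} →
      (if does (inside? c c′ e ×-dec inside? d d′ e′) then 1ℤ else 0ℤ) ≡ inside c c′ e * inside d d′ e′
    inside-∧ {c} {c′} {d} {d′} {e} {e′} with does (inside? c c′ e) | does (inside? d d′ e′)
    ... | true  | true  = refl
    ... | true  | false = refl
    ... | false | true  = refl
    ... | false | false = refl

    -- Two intervals link exactly when one end of either lies inside the other interval and the
    -- other end outside, and the order decides the sign. The proof runs through the six orders of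
    -- the four endpoints.
    linking-inside : a Fin.< a′ → b Fin.< b′ → a ≢ b → a ≢ b′ → a′ ≢ b → a′ ≢ b′ →
      (inside a a′ b - inside a a′ b′ ≡ linking a a′ b b′) × (inside b b′ a′ - inside b b′ a ≡ linking a a′ b b′)
    linking-inside a<a′ b<b′ a≢b a≢b′ a′≢b a′≢b′ with Finₚ.<-cmp a b
    ... | tri≈ _ a≡b _ = contradiction a≡b a≢b
    ... | tri< a<b _ ¬b<a with Finₚ.<-cmp b a′
    ...   | tri≈ _ b≡a′ _ = contradiction (sym b≡a′) a′≢b
    ...   | tri> ¬b<a′ _ a′<b =
            trans (cong₂ _-_ (if-no (inside? a a′ b) (¬b<a′ ∘ proj₂))
                             (if-no (inside? a a′ b′) λ p → Finₚ.<-asym a′<b (Finₚ.<-trans b<b′ (proj₂ p)))) (sym n≡0)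
          , trans (cong₂ _-_ (if-no (inside? b b′ a′) (¬b<a′ ∘ proj₁)) (if-no (inside? b b′ a) (¬b<a ∘ proj₁))) (sym n≡0)
      where
      n≡0 : linking a a′ b b′ ≡ 0ℤ
      n≡0 = trans (if-no (linked? a a′ b b′) λ p → ¬b<a′ (proj₁ (proj₂ p)))
                  (if-no (linked? b b′ a a′) (¬b<a ∘ proj₁))
    ...   | tri< b<a′ _ _ with Finₚ.<-cmp a′ b′
    ...     | tri≈ _ a′≡b′ _ = contradiction a′≡b′ a′≢b′
    ...     | tri< a′<b′ _ ¬b′<a′ =
              trans (cong₂ _-_ (if-yes (inside? a a′ b) (a<b , b<a′)) (if-no (inside? a a′ b′) (¬b′<a′ ∘ proj₂))) (sym n≡1)
            , trans (cong₂ _-_ (if-yes (inside? b b′ a′) (b<a′ , a′<b′)) (if-no (inside? b b′ a) (¬b<a ∘ proj₁))) (sym n≡1)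
      where
      n≡1 : linking a a′ b b′ ≡ 1ℤ
      n≡1 = if-yes (linked? a a′ b b′) (a<b , b<a′ , a′<b′)
    ...     | tri> ¬a′<b′ _ b′<a′ =
              trans (cong₂ _-_ (if-yes (inside? a a′ b) (a<b , b<a′))
                               (if-yes (inside? a a′ b′) (Finₚ.<-trans a<b b<b′ , b′<a′))) (sym n≡0)
            , trans (cong₂ _-_ (if-no (inside? b b′ a′) (¬a′<b′ ∘ proj₂)) (if-no (inside? b b′ a) (¬b<a ∘ proj₁))) (sym n≡0)
      where
      n≡0 : linking a a′ b b′ ≡ 0ℤ
      n≡0 = trans (if-no (linked? a a′ b b′) λ p → ¬a′<b′ (proj₂ (proj₂ p)))
                  (if-no (linked? b b′ a a′) (¬b<a ∘ proj₁))
    linking-inside a<a′ b<b′ a≢b a≢b′ a′≢b a′≢b′ | tri> ¬a<b _ b<a with Finₚ.<-cmp a b′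
    ...   | tri≈ _ a≡b′ _ = contradiction a≡b′ a≢b′
    ...   | tri> ¬a<b′ _ b′<a =
            trans (cong₂ _-_ (if-no (inside? a a′ b) (¬a<b ∘ proj₁)) (if-no (inside? a a′ b′) (¬a<b′ ∘ proj₁))) (sym n≡0)
          , trans (cong₂ _-_ (if-no (inside? b b′ a′) λ p → ¬a<b′ (Finₚ.<-trans a<a′ (proj₂ p)))
                             (if-no (inside? b b′ a) (¬a<b′ ∘ proj₂))) (sym n≡0)
      where
      n≡0 : linking a a′ b b′ ≡ 0ℤ
      n≡0 = trans (if-no (linked? a a′ b b′) (¬a<b ∘ proj₁))
                  (if-no (linked? b b′ a a′) λ p → ¬a<b′ (proj₁ (proj₂ p)))
    ...   | tri< a<b′ _ _ with Finₚ.<-cmp a′ b′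
    ...     | tri≈ _ a′≡b′ _ = contradiction a′≡b′ a′≢b′
    ...     | tri< a′<b′ _ ¬b′<a′ =
              trans (cong₂ _-_ (if-no (inside? a a′ b) (¬a<b ∘ proj₁)) (if-no (inside? a a′ b′) (¬b′<a′ ∘ proj₂))) (sym n≡0)
            , trans (cong₂ _-_ (if-yes (inside? b b′ a′) (Finₚ.<-trans b<a a<a′ , a′<b′))
                               (if-yes (inside? b b′ a) (b<a , a<b′))) (sym n≡0)
      where
      n≡0 : linking a a′ b b′ ≡ 0ℤ
      n≡0 = trans (if-no (linked? a a′ b b′) (¬a<b ∘ proj₁))
                  (if-no (linked? b b′ a a′) λ p → ¬b′<a′ (proj₂ (proj₂ p)))
    ...     | tri> ¬a′<b′ _ b′<a′ =
              trans (cong₂ _-_ (if-no (inside? a a′ b) (¬a<b ∘ proj₁)) (if-yes (inside? a a′ b′) (a<b′ , b′<a′))) (sym n≡-1)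
            , trans (cong₂ _-_ (if-no (inside? b b′ a′) (¬a′<b′ ∘ proj₂)) (if-yes (inside? b b′ a) (b<a , a<b′))) (sym n≡-1)
      where
      n≡-1 : linking a a′ b b′ ≡ -1ℤ
      n≡-1 = trans (if-no (linked? a a′ b b′) (¬a<b ∘ proj₁)) (if-yes (linked? b b′ a a′) (b<a , a<b′ , b′<a′))

-- Sums over finite types.

module FiniteTypeSums where

  open FiniteSums
  open Conditionals
  open import Data.Integer.Base using (_+_; _*_; -_; _-_)

  private
    variable
      ℓ : Level
      A B : Set ℓ

  opaque

    ∑ℤ : Finite A → (A → ℤ) → ℤ
    ∑ℤ (_ , e) f = sum (f ∘ Inverse.to e)

    ∑-def : (fin : Finite A) (f : A → ℤ) → ∑ℤ fin f ≡ sum (f ∘ Inverse.to (proj₂ fin))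
    ∑-def fin f = refl

    ∑-cong : (fin : Finite A) {f g : A → ℤ} → f ≗ g → ∑ℤ fin f ≡ ∑ℤ fin g
    ∑-cong fin e = sum-cong (e ∘ Inverse.to (proj₂ fin))

    ∑-+ : (fin : Finite A) (f g : A → ℤ) → ∑ℤ fin (λ x → f x + g x) ≡ ∑ℤ fin f + ∑ℤ fin g
    ∑-+ fin f g = sum-+ (f ∘ Inverse.to (proj₂ fin)) _

    ∑-*ˡ : (fin : Finite A) (k : ℤ) (f : A → ℤ) → ∑ℤ fin (λ x → k * f x) ≡ k * ∑ℤ fin f
    ∑-*ˡ fin k f = sum-*ˡ k (f ∘ Inverse.to (proj₂ fin))

    ∑-*ʳ : (fin : Finite A) (k : ℤ) (f : A → ℤ) → ∑ℤ fin (λ x → f x * k) ≡ ∑ℤ fin f * k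
    ∑-*ʳ fin k f = sum-*ʳ k (f ∘ Inverse.to (proj₂ fin))

    ∑-zero : (fin : Finite A) {f : A → ℤ} → (∀ x → f x ≡ 0ℤ) → ∑ℤ fin f ≡ 0ℤ
    ∑-zero fin f≡0 = sum-zero (f≡0 ∘ Inverse.to (proj₂ fin))

    ∑-sum : (fin : Finite A) → ∀ {n} (f : A → Fin n → ℤ) → ∑ℤ fin (λ x → sum (f x)) ≡ sum (λ k → ∑ℤ fin λ x → f x k)
    ∑-sum fin f = sum-comm (f ∘ Inverse.to (proj₂ fin))

    ∑-comm : (fin : Finite A) (fin′ : Finite B) (f : A → B → ℤ) →
             ∑ℤ fin (λ x → ∑ℤ fin′ (f x)) ≡ ∑ℤ fin′ (λ y → ∑ℤ fin λ x → f x y)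
    ∑-comm fin fin′ f = sum-comm λ i j → f (Inverse.to (proj₂ fin) i) (Inverse.to (proj₂ fin′) j)

    ∑-Maybe : (fin : Finite A) (f : Maybe A → ℤ) → ∑ℤ (Finite-Maybe fin) f ≡ f nothing + ∑ℤ fin (f ∘ just)
    ∑-Maybe fin f = sum-cons _

  ∑-single : (fin : Finite A) (f : A → ℤ) (x : A) → (∀ y → y ≢ x → f y ≡ 0ℤ) → ∑ℤ fin f ≡ f x
  ∑-single fin f x f≡0 = trans (∑-def fin f) (trans
    (sum-single (f ∘ to) (from x) λ j j≢ → f≡0 (to j) λ to≡ → j≢ (trans (sym (strictlyInverseʳ j)) (cong from to≡)))
    (cong f (strictlyInverseˡ x)))
    where open Inverse (proj₂ fin)

  sum-splitAt : ∀ m {n} (f : Fin m ⊎ Fin n → ℤ) →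
                sum (f ∘ Fin.splitAt m) ≡ sum (f ∘ inj₁) + sum (f ∘ inj₂)
  sum-splitAt zero    f = sym (trans (cong (_+ sum (f ∘ inj₂)) (sum-nil _)) (ℤₚ.+-identityˡ _))
  sum-splitAt (suc m) f = begin
    sum (f ∘ Fin.splitAt (suc m))
      ≡⟨ sum-cons _ ⟩
    f (inj₁ zero) + sum (λ i → f (Fin.splitAt (suc m) (suc i)))
      ≡⟨ cong (f (inj₁ zero) +_) (sum-splitAt m (f ∘ Sum.map suc id)) ⟩
    f (inj₁ zero) + (sum (f ∘ inj₁ ∘ suc) + sum (f ∘ inj₂))
      ≡⟨ ℤₚ.+-assoc (f (inj₁ zero)) _ _ ⟨
    f (inj₁ zero) + sum (f ∘ inj₁ ∘ suc) + sum (f ∘ inj₂)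
      ≡⟨ cong (_+ sum (f ∘ inj₂)) (sum-cons (f ∘ inj₁)) ⟨
    sum (f ∘ inj₁) + sum (f ∘ inj₂) ∎
    where open ≡-Reasoning

  ∑-⊎ : {A B : Set ℓ} (fin : Finite A) (fin′ : Finite B) (f : A ⊎ B → ℤ) →
        ∑ℤ (Finite-⊎ fin fin′) f ≡ ∑ℤ fin (f ∘ inj₁) + ∑ℤ fin′ (f ∘ inj₂)
  ∑-⊎ (m , e) (n , e′) f = trans (∑-def (Finite-⊎ (m , e) (n , e′)) f) (trans
    (sum-splitAt m (f ∘ Sum.map (Inverse.to e) (Inverse.to e′)))
    (sym (cong₂ _+_ (∑-def (m , e) (f ∘ inj₁)) (∑-def (n , e′) (f ∘ inj₂)))))

-- The pairing of a nanoword as an alternating form.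

module NanowordForms {a} (α : Set a) (τ : α → α) (τ-involutive : Involutive _≡_ τ)
                     (φ : Nanowords.Π α τ τ-involutive → ℤ) (φ-additive : Nanowords.IsAdditive α τ τ-involutive φ)
                     (φ-unit : ∀ x → φ (Nanowords.gen x) ≡ 1ℤ ⊎ φ (Nanowords.gen x) ≡ -1ℤ) where

  open Nanowords α τ τ-involutive
  open Alphabet
  open NanowordOver using (word)
  open FiniteSums
  open FiniteTypeSums
  open Conditionals
  open Steps
  open Twice
  open import Data.Integer.Base using (_+_; _*_; -_; _-_)
  open GroupMorphisms (AbelianGroup.rawGroup π) (AbelianGroup.rawGroup ℤₚ.+-0-abelianGroup) using (module IsGroupHomomorphism)
  open IsGroupHomomorphism φ-additive renaming (homo to φ-+; ε-homo to φ-0; ⁻¹-homo to φ-neg; ⟦⟧-cong to φ-cong)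

  ψ : α → ℤ
  ψ x = φ (gen x)

  ψ-τ : ∀ x → ψ (τ x) ≡ - ψ x
  ψ-τ x = begin
    ψ (τ x)                     ≡⟨ ring (ψ x) (ψ (τ x)) ⟩
    ψ x + ψ (τ x) + - ψ x       ≡⟨ cong (_+ - ψ x) (trans (sym (φ-+ (gen x) (gen (τ x)))) (trans (φ-cong (relation x)) φ-0)) ⟩
    0ℤ + - ψ x                  ≡⟨ ℤₚ.+-identityˡ _ ⟩
    - ψ x                       ∎
    where
    open ≡-Reasoning
    ring : ∀ x y → y ≡ x + y + - x
    ring = solve-∀

  ψ-square : ∀ x → ψ x * ψ x ≡ 1ℤ
  ψ-square x with φ-unit x
  ... | inj₁ e = cong₂ _*_ e e
  ... | inj₂ e = cong₂ _*_ e e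

  φ-∑ : ∀ {ℓ} {A : Set ℓ} (fin : Finite A) (f : A → Π) → φ (∑ fin f) ≡ ∑ℤ fin (φ ∘ f)
  φ-∑ fin f = trans (go (f ∘ Inverse.to (proj₂ fin))) (sym (∑-def fin (φ ∘ f)))
    where
    go : ∀ {n} (g : Fin n → Π) → φ (CommutativeMonoidSum.sum (AbelianGroup.commutativeMonoid π) g) ≡ sum (φ ∘ g)
    go {zero}  g = trans φ-0 (sym (sum-nil _))
    go {suc n} g = trans (φ-+ (g zero) _) (trans (cong (φ (g zero) +_) (go (g ∘ suc))) (sym (sum-cons (φ ∘ g))))

  φ-· : ∀ k x → φ (k · x) ≡ k * φ x
  φ-· (ℤ.+ n) x = natural n
    where
    natural : ∀ n → φ ((ℤ.+ n) · x) ≡ ℤ.+ n * φ x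
    natural zero    = trans φ-0 (sym (ℤₚ.*-zeroˡ (φ x)))
    natural (suc n) = trans (φ-+ x _) (trans (cong (φ x +_) (natural n)) (sym (ℤₚ.suc-* (ℤ.+ n) (φ x))))
  φ-· ℤ.-[1+ n ] x = trans (φ-neg _) (trans (cong -_ (φ-· (ℤ.+ suc n) x)) (ℤₚ.neg-distribˡ-* (ℤ.+ suc n) (φ x)))

  module _ {𝒜 : Alphabet} (w : NanowordOver 𝒜) where

    opaque

      letters≟ : DecidableEquality (Letter 𝒜)
      letters≟ = Finite⇒≟ (NanowordOver.finite w)

    chargeOf : Letter 𝒜 → ℤ
    chargeOf A = ψ (label 𝒜 A)

    charged : List (Letter 𝒜 × ℤ)
    charged = Charging.charges letters≟ chargeOf [] (word w)

    formʷ : (Letter 𝒜 → ℤ) → ℤ → (Letter 𝒜 → ℤ) → ℤ → ℤ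
    formʷ = ChargedWords.form letters≟ charged

    open ChargedWords letters≟
    open Charging letters≟ chargeOf

    private
      fin : Finite (Letter 𝒜)
      fin = NanowordOver.finite w
      n : ℕ
      n = length (word w)
      l r : Letter 𝒜 → Fin n
      l A = left (NanowordOver.twice w A)
      r A = right (NanowordOver.twice w A)
      l<r : ∀ A → l A Fin.< r A
      l<r A = left<right (NanowordOver.twice w A)
      at-l : ∀ A → List.lookup (word w) (l A) ≡ A
      at-l A = at-left (NanowordOver.twice w A)
      at-r : ∀ A → List.lookup (word w) (r A) ≡ A
      at-r A = at-right (NanowordOver.twice w A)

    ∑-δ : ∀ A (f : Letter 𝒜 → ℤ) → ∑ℤ fin (λ B → δ A B * f B) ≡ f A
    ∑-δ A f = trans (∑-single fin _ A λ B B≢A → cong (_* f B) (δ-≢ (B≢A ∘ sym)))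
      (trans (cong (_* f A) (δ-refl A)) (ℤₚ.*-identityˡ (f A)))

    -- Every position is the left or the right occurrence of exactly one letter.
    sum-occurrences : (f : Fin n → ℤ) → sum f ≡ ∑ℤ fin (λ A → f (l A) + f (r A))
    sum-occurrences f = begin
      sum f
        ≡⟨ sum-cong (λ k → sym (∑-δ (List.lookup (word w) k) (λ _ → f k))) ⟩
      sum (λ k → ∑ℤ fin (λ A → δ (List.lookup (word w) k) A * f k))
        ≡⟨ sym (∑-sum fin (λ A k → δ (List.lookup (word w) k) A * f k)) ⟩
      ∑ℤ fin (λ A → sum (λ k → δ (List.lookup (word w) k) A * f k))
        ≡⟨ ∑-cong fin two ⟩
      ∑ℤ fin (λ A → f (l A) + f (r A)) ∎
      where
      open ≡-Reasoning
      at : Fin n → Fin n → ℤ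
      at p k = if does (k Finₚ.≟ p) then f k else 0ℤ
      sum-at : ∀ p → sum (at p) ≡ f p
      sum-at p = trans (sum-single (at p) p λ k k≢p → if-no (k Finₚ.≟ p) k≢p) (if-yes (p Finₚ.≟ p) refl)
      two : ∀ A → sum (λ k → δ (List.lookup (word w) k) A * f k) ≡ f (l A) + f (r A)
      two A = trans (sum-cong pointwise) (trans (sum-+ (at (l A)) _) (cong₂ _+_ (sum-at (l A)) (sum-at (r A))))
        where
        pointwise : ∀ k → δ (List.lookup (word w) k) A * f k ≡ at (l A) k + at (r A) k
        pointwise k = either (letters≟ (List.lookup (word w) k) A)
          where
          at-either : k ≡ l A ⊎ k ≡ r A → f k ≡ at (l A) k + at (r A) k
          at-either (inj₁ refl) = sym (trans
            (cong₂ _+_ (if-yes (k Finₚ.≟ k) refl) (if-no (k Finₚ.≟ r A) (Finₚ.<⇒≢ (l<r A)))) (ℤₚ.+-identityʳ (f k)))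
          at-either (inj₂ refl) = sym (trans
            (cong₂ _+_ (if-no (k Finₚ.≟ l A) (Finₚ.<⇒≢ (l<r A) ∘ sym)) (if-yes (k Finₚ.≟ k) refl)) (ℤₚ.+-identityˡ (f k)))
          either : Dec (List.lookup (word w) k ≡ A) → δ (List.lookup (word w) k) A * f k ≡ at (l A) k + at (r A) k
          either (no ≢A)  = trans (cong (_* f k) (δ-≢ ≢A)) (sym (cong₂ _+_
            (if-no (k Finₚ.≟ l A) λ { refl → ≢A (at-l A) }) (if-no (k Finₚ.≟ r A) λ { refl → ≢A (at-r A) })))
          either (yes ≡A) = trans (cong (_* f k) (trans (cong (λ B → δ B A) ≡A) (δ-refl A))) (trans (ℤₚ.*-identityˡ (f k))
            (at-either (only (NanowordOver.twice w A) k ≡A)))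

    private
      occ : Fin n → Occ
      occ k = List.lookup (word w) k , sign-if (isLeft? (NanowordOver.twice w) k) (List.lookup (word w) k)

      charged-occ : charged ≡ tabulate occ
      charged-occ = charges-twice (NanowordOver.twice w)

      occ-l : ∀ A → occ (l A) ≡ (A , chargeOf A)
      occ-l A = cong₂ _,_ (at-l A) (trans
        (if-yes (isLeft? (NanowordOver.twice w) (l A)) (sym (cong l (at-l A)))) (cong chargeOf (at-l A)))

      occ-r : ∀ A → occ (r A) ≡ (A , - chargeOf A)
      occ-r A = cong₂ _,_ (at-r A) (trans
        (if-no (isLeft? (NanowordOver.twice w) (r A)) λ e → Finₚ.<⇒≢ (l<r A) (sym (trans e (cong l (at-r A)))))
        (cong (-_ ∘ chargeOf) (at-r A)))

    -- The two charges of a letter cancel. This makes the function periodic along the word, as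
    -- `form-rotate` requires.
    total-charged : ∀ z → total z charged ≡ 0ℤ
    total-charged z = begin
      total z charged          ≡⟨ cong (total z) charged-occ ⟩
      total z (tabulate occ)   ≡⟨ total-tabulate occ ⟩
      sum (jump ∘ occ)         ≡⟨ sum-occurrences (jump ∘ occ) ⟩
      ∑ℤ fin (λ A → jump (occ (l A)) + jump (occ (r A)))
        ≡⟨ ∑-zero fin (λ A → trans (cong₂ (λ o o′ → jump o + jump o′) (occ-l A) (occ-r A)) (cancel (chargeOf A) (z A))) ⟩
      0ℤ ∎
      where
      open ≡-Reasoning
      jump : Occ → ℤ
      jump (A , q) = q * z A
      total-tabulate : ∀ {n} (o : Fin n → Occ) → total z (tabulate o) ≡ sum (jump ∘ o)
      total-tabulate {zero}  o = sym (sum-nil _)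
      total-tabulate {suc n} o = trans (cong (jump (o zero) +_) (total-tabulate (o ∘ suc))) (sym (sum-cons (jump ∘ o)))
      cancel : ∀ q x → q * x + - q * x ≡ 0ℤ
      cancel = solve-∀

    private
      hatʷ : Letter 𝒜 → Fin n → ℤ
      hatʷ A = hat (l A) (r A)

      -- The same function as in `val`, written at once as a superposition of hats instead of by
      -- running along the word.
      height : (Letter 𝒜 → ℤ) → ℤ → Fin n → ℤ
      height z c k = c + ∑ℤ fin (λ A → chargeOf A * z A * hatʷ A k)

      det : (Fin n → ℤ) → (Fin n → ℤ) → Letter 𝒜 → ℤ
      det p p′ D = chargeOf D * (p (l D) * p′ (r D) - p (r D) * p′ (l D))

      val-tabulate : ∀ {n} z c (o : Fin n → Occ) f → val z c (tabulate o) f ≡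
        sum (λ k → (c + sum (λ j → proj₂ (o j) * z (proj₁ (o j)) * step j k)) * f (o k))
      val-tabulate {zero}  z c o f = sym (sum-nil _)
      val-tabulate {suc n} z c o f = begin
        (c + i₀) * f (o zero) + val z (c + 2ℤ * i₀) (tabulate (o ∘ suc)) f
          ≡⟨ cong₂ (λ x y → x * f (o zero) + y) head-value (trans (val-tabulate z (c + 2ℤ * i₀) (o ∘ suc) f) (sum-cong tail-value)) ⟩
        (c + sum (λ j → i j * step j zero)) * f (o zero) + sum (λ k → (c + sum (λ j → i j * step j (suc k))) * f (o (suc k)))
          ≡⟨ sum-cons (λ k → (c + sum (λ j → i j * step j k)) * f (o k)) ⟨
        sum (λ k → (c + sum (λ j → i j * step j k)) * f (o k)) ∎
        where
        open ≡-Reasoning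
        i : Fin (suc n) → ℤ
        i j = proj₂ (o j) * z (proj₁ (o j))
        i₀ : ℤ
        i₀ = i zero
        head-value : c + i₀ ≡ c + sum (λ j → i j * step j zero)
        head-value = cong (c +_) (sym (trans (sum-cons (λ j → i j * step j zero))
          (trans (cong₂ _+_ (ℤₚ.*-identityʳ i₀) (sum-zero λ j → ℤₚ.*-zeroʳ (i (suc j)))) (ℤₚ.+-identityʳ i₀))))
        tail-value : ∀ k → (c + 2ℤ * i₀ + sum (λ j → i (suc j) * step j k)) * f (o (suc k))
                     ≡ (c + sum (λ j → i j * step j (suc k))) * f (o (suc k))
        tail-value k = cong (_* f (o (suc k))) (trans (assoc c i₀ _) (cong (c +_) (sym (sum-cons (λ j → i j * step j (suc k))))))
          where
          assoc : ∀ c x s → c + 2ℤ * x + s ≡ c + (x * 2ℤ + s)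
          assoc = solve-∀

      val-charged : ∀ z c f → val z c charged f ≡
        ∑ℤ fin (λ D → height z c (l D) * f (D , chargeOf D) + height z c (r D) * f (D , - chargeOf D))
      val-charged z c f = begin
        val z c charged f
          ≡⟨ cong (λ s → val z c s f) charged-occ ⟩
        val z c (tabulate occ) f
          ≡⟨ val-tabulate z c occ f ⟩
        sum (λ k → (c + sum (λ j → proj₂ (occ j) * z (proj₁ (occ j)) * step j k)) * f (occ k))
          ≡⟨ sum-cong (λ k → cong (λ x → (c + x) * f (occ k)) (total-value k)) ⟩
        sum (λ k → height z c k * f (occ k))
          ≡⟨ sum-occurrences _ ⟩
        ∑ℤ fin (λ D → height z c (l D) * f (occ (l D)) + height z c (r D) * f (occ (r D)))
          ≡⟨ ∑-cong fin (λ D → cong₂ (λ o o′ → height z c (l D) * f o + height z c (r D) * f o′) (occ-l D) (occ-r D)) ⟩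
        ∑ℤ fin (λ D → height z c (l D) * f (D , chargeOf D) + height z c (r D) * f (D , - chargeOf D)) ∎
        where
        open ≡-Reasoning
        total-value : ∀ k → sum (λ j → proj₂ (occ j) * z (proj₁ (occ j)) * step j k) ≡ ∑ℤ fin (λ A → chargeOf A * z A * hatʷ A k)
        total-value k = trans (sum-occurrences _) (∑-cong fin λ A → trans
          (cong₂ (λ o o′ → proj₂ o * z (proj₁ o) * step (l A) k + proj₂ o′ * z (proj₁ o′) * step (r A) k) (occ-l A) (occ-r A))
          (factor (chargeOf A) (z A) (step (l A) k) (step (r A) k)))
          where
          factor : ∀ q x s t → q * x * s + - q * x * t ≡ q * x * (s - t)
          factor = solve-∀

    form-det : ∀ z c z′ c′ → formʷ z c z′ c′ ≡ 2ℤ * ∑ℤ fin (det (height z c) (height z′ c′))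
    form-det z c z′ c′ = begin
      formʷ z c z′ c′
        ≡⟨ ⟪⟫-def (V z c charged) (V z′ c′ charged) ⟩
      val z c charged (λ o → val z′ c′ charged (ω o))
        ≡⟨ val-cong (λ _ → refl) c charged inner ⟩
      val z c charged inner-value
        ≡⟨ val-charged z c inner-value ⟩
      ∑ℤ fin (λ D → height z c (l D) * inner-value (D , chargeOf D) + height z c (r D) * inner-value (D , - chargeOf D))
        ≡⟨ ∑-cong fin (λ D → collect (chargeOf D) (height z c (l D)) (height z c (r D)) (height z′ c′ (l D)) (height z′ c′ (r D))) ⟩
      ∑ℤ fin (λ D → 2ℤ * det (height z c) (height z′ c′) D)
        ≡⟨ ∑-*ˡ fin 2ℤ _ ⟩
      2ℤ * ∑ℤ fin (det (height z c) (height z′ c′)) ∎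
      where
      open ≡-Reasoning
      inner-value : Occ → ℤ
      inner-value (D , q) = height z′ c′ (l D) * (q - chargeOf D) + height z′ c′ (r D) * (q - - chargeOf D)
      inner : ∀ o → val z′ c′ charged (ω o) ≡ inner-value o
      inner (D , q) = begin
        val z′ c′ charged (ω (D , q))
          ≡⟨ val-charged z′ c′ (ω (D , q)) ⟩
        ∑ℤ fin (λ E → height z′ c′ (l E) * (δ D E * (q - chargeOf E)) + height z′ c′ (r E) * (δ D E * (q - - chargeOf E)))
          ≡⟨ ∑-cong fin (λ E → pull (δ D E) (height z′ c′ (l E)) (height z′ c′ (r E)) (q - chargeOf E) (q - - chargeOf E)) ⟩
        ∑ℤ fin (λ E → δ D E * (height z′ c′ (l E) * (q - chargeOf E) + height z′ c′ (r E) * (q - - chargeOf E)))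
          ≡⟨ ∑-δ D _ ⟩
        inner-value (D , q) ∎
        where
        pull : ∀ d x y s t → x * (d * s) + y * (d * t) ≡ d * (x * s + y * t)
        pull = solve-∀
      collect : ∀ q x y x′ y′ →
        x * (x′ * (q - q) + y′ * (q - - q)) + y * (x′ * (- q - q) + y′ * (- q - - q)) ≡ 2ℤ * (q * (x * y′ - y * x′))
      collect = solve-∀

    private
      -- Half of the form, bilinear in functions on positions. It suffices to know it on the
      -- constant `𝟙` and on the hats, which will correspond to `s` and to the letters.
      K : (Fin n → ℤ) → (Fin n → ℤ) → ℤ
      K p p′ = ∑ℤ fin (det p p′)

      K-skew : ∀ p p′ → K p p′ ≡ - K p′ p
      K-skew p p′ = trans (∑-cong fin λ D → skew (chargeOf D) (p (l D)) (p (r D)) (p′ (l D)) (p′ (r D)))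
        (trans (∑-*ˡ fin -1ℤ (det p′ p)) (ℤₚ.-1*i≡-i (K p′ p)))
        where
        skew : ∀ q x y x′ y′ → q * (x * y′ - y * x′) ≡ -1ℤ * (q * (x′ * y - y′ * x))
        skew = solve-∀

      𝟙 : Fin n → ℤ
      𝟙 _ = 1ℤ

      K-linear : ∀ c (x : Letter 𝒜 → ℤ) p′ →
        K (λ k → c + ∑ℤ fin (λ A → x A * hatʷ A k)) p′ ≡ c * K 𝟙 p′ + ∑ℤ fin (λ A → x A * K (hatʷ A) p′)
      K-linear c x p′ = begin
        ∑ℤ fin (λ D → det (λ k → c + ∑ℤ fin (λ A → x A * hatʷ A k)) p′ D)
          ≡⟨ ∑-cong fin (λ D → trans
               (split (chargeOf D) c (∑ℤ fin (λ A → x A * hatʷ A (l D))) (∑ℤ fin (λ A → x A * hatʷ A (r D))) (p′ (l D)) (p′ (r D)))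
               (cong (c * det 𝟙 p′ D +_) (inner D))) ⟩
        ∑ℤ fin (λ D → c * det 𝟙 p′ D + ∑ℤ fin (λ A → x A * det (hatʷ A) p′ D))
          ≡⟨ ∑-+ fin (λ D → c * det 𝟙 p′ D) _ ⟩
        ∑ℤ fin (λ D → c * det 𝟙 p′ D) + ∑ℤ fin (λ D → ∑ℤ fin (λ A → x A * det (hatʷ A) p′ D))
          ≡⟨ cong₂ _+_ (∑-*ˡ fin c (det 𝟙 p′)) (trans (∑-comm fin fin (λ D A → x A * det (hatʷ A) p′ D))
               (∑-cong fin λ A → ∑-*ˡ fin (x A) (det (hatʷ A) p′))) ⟩
        c * K 𝟙 p′ + ∑ℤ fin (λ A → x A * K (hatʷ A) p′) ∎
        where
        open ≡-Reasoning
        split : ∀ q c s t u v → q * ((c + s) * v - (c + t) * u) ≡ c * (q * (1ℤ * v - 1ℤ * u)) + (s * (q * v) + t * (- q * u))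
        split = solve-∀
        inner : ∀ D → ∑ℤ fin (λ A → x A * hatʷ A (l D)) * (chargeOf D * p′ (r D))
                      + ∑ℤ fin (λ A → x A * hatʷ A (r D)) * (- chargeOf D * p′ (l D))
                    ≡ ∑ℤ fin (λ A → x A * det (hatʷ A) p′ D)
        inner D = begin
          ∑ℤ fin (λ A → x A * hatʷ A (l D)) * u + ∑ℤ fin (λ A → x A * hatʷ A (r D)) * v
            ≡⟨ cong₂ _+_ (∑-*ʳ fin u _) (∑-*ʳ fin v _) ⟨
          ∑ℤ fin (λ A → x A * hatʷ A (l D) * u) + ∑ℤ fin (λ A → x A * hatʷ A (r D) * v)
            ≡⟨ ∑-+ fin (λ A → x A * hatʷ A (l D) * u) _ ⟨
          ∑ℤ fin (λ A → x A * hatʷ A (l D) * u + x A * hatʷ A (r D) * v)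
            ≡⟨ ∑-cong fin (λ A → join (x A) (hatʷ A (l D)) (hatʷ A (r D)) (chargeOf D) (p′ (r D)) (p′ (l D))) ⟩
          ∑ℤ fin (λ A → x A * det (hatʷ A) p′ D) ∎
          where
          u v : ℤ
          u = chargeOf D * p′ (r D)
          v = - chargeOf D * p′ (l D)
          join : ∀ x s t q y z → x * s * (q * y) + x * t * (- q * z) ≡ x * (q * (s * y - t * z))
          join = solve-∀

      positions-≢ : ∀ {A B} → A ≢ B → l A ≢ l B × l A ≢ r B × r A ≢ l B × r A ≢ r B
      positions-≢ {A} {B} A≢B =
          (λ e → A≢B (trans (sym (at-l A)) (trans (cong (List.lookup (word w)) e) (at-l B))))
        , (λ e → A≢B (trans (sym (at-l A)) (trans (cong (List.lookup (word w)) e) (at-r B))))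
        , (λ e → A≢B (trans (sym (at-r A)) (trans (cong (List.lookup (word w)) e) (at-l B))))
        , (λ e → A≢B (trans (sym (at-r A)) (trans (cong (List.lookup (word w)) e) (at-r B))))

      insideʷ : Letter 𝒜 → Fin n → ℤ
      insideʷ A = inside (l A) (r A)

      hat-other : ∀ {A D} → A ≢ D → hatʷ A (l D) ≡ 2ℤ * insideʷ A (l D) × hatʷ A (r D) ≡ 2ℤ * insideʷ A (r D)
      hat-other {A} {D} A≢D = let ll , lr , rl , rr = positions-≢ A≢D in
          hat-inside (l A) (r A) (l<r A) (ll ∘ sym) (rl ∘ sym)
        , hat-inside (l A) (r A) (l<r A) (lr ∘ sym) (rr ∘ sym)

      linking-other : ∀ {A B} → A ≢ B →
        (insideʷ A (l B) - insideʷ A (r B) ≡ n⟨_,_⟩ w A B) × (insideʷ B (r A) - insideʷ B (l A) ≡ n⟨_,_⟩ w A B)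
      linking-other {A} {B} A≢B = let ll , lr , rl , rr = positions-≢ A≢B in
        linking-inside (l<r A) (l<r B) ll lr rl rr

      linking-self′ : ∀ A → n⟨_,_⟩ w A A ≡ 0ℤ
      linking-self′ A = linking-self {a = l A} {r A} {l A} {r A}

      -- Against a constant, the determinant at `D` is the difference of the hat of `A` between the
      -- two ends of `D`, that is, twice the linking number.
      K-hat-𝟙 : ∀ A → K (hatʷ A) 𝟙 ≡ 2ℤ * φ (pairing-e w (just A) nothing)
      K-hat-𝟙 A = begin
        ∑ℤ fin (λ D → chargeOf D * (hatʷ A (l D) * 1ℤ - hatʷ A (r D) * 1ℤ))
          ≡⟨ ∑-cong fin (λ D → trans (cong (chargeOf D *_) (pointwise D)) (swap (chargeOf D) (n⟨_,_⟩ w A D))) ⟩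
        ∑ℤ fin (λ D → 2ℤ * (n⟨_,_⟩ w A D * chargeOf D))
          ≡⟨ ∑-*ˡ fin 2ℤ _ ⟩
        2ℤ * ∑ℤ fin (λ D → n⟨_,_⟩ w A D * chargeOf D)
          ≡⟨ cong (2ℤ *_) (trans (φ-∑ fin _) (∑-cong fin λ D → φ-· (n⟨_,_⟩ w A D) (gen (label 𝒜 D)))) ⟨
        2ℤ * φ (pairing-e w (just A) nothing) ∎
        where
        open ≡-Reasoning
        swap : ∀ q m → q * (2ℤ * m) ≡ 2ℤ * (m * q)
        swap = solve-∀
        ring : ∀ x y → 2ℤ * x * 1ℤ - 2ℤ * y * 1ℤ ≡ 2ℤ * (x - y)
        ring = solve-∀
        pointwise : ∀ D → hatʷ A (l D) * 1ℤ - hatʷ A (r D) * 1ℤ ≡ 2ℤ * n⟨_,_⟩ w A D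
        pointwise D = go (letters≟ A D)
          where
          go : Dec (A ≡ D) → hatʷ A (l D) * 1ℤ - hatʷ A (r D) * 1ℤ ≡ 2ℤ * n⟨_,_⟩ w A D
          go (yes refl) = trans (cong₂ (λ x y → x * 1ℤ - y * 1ℤ) (hat-left (l A) (r A) (l<r A)) (hat-right (l A) (r A) (l<r A)))
            (cong (2ℤ *_) (sym (linking-self′ A)))
          go (no A≢D) = trans (cong₂ (λ x y → x * 1ℤ - y * 1ℤ) (proj₁ (hat-other A≢D)) (proj₂ (hat-other A≢D)))
            (trans (ring (insideʷ A (l D)) (insideʷ A (r D))) (cong (2ℤ *_) (proj₁ (linking-other A≢D))))

      4ℤ : ℤ
      4ℤ = ℤ.+ 4

      inner∘ : Letter 𝒜 → Letter 𝒜 → Letter 𝒜 → ℤ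
      inner∘ A B D = insideʷ A (l D) * insideʷ B (r D)

      φ-∘ : ∀ A B → φ (_∘ʷ_ w A B) ≡ ∑ℤ fin (λ D → chargeOf D * inner∘ A B D)
      φ-∘ A B = trans (φ-∑ fin _) (∑-cong fin λ D → trans
        (φ-if (does (inside? (l A) (r A) (l D) ×-dec inside? (l B) (r B) (r D))) (gen (label 𝒜 D)))
        (cong (chargeOf D *_) (inside-∧ {a = l A} {l A} {l A} {l A} {l A} {r A} {l B} {r B} {l D} {r D})))
        where
        φ-if : ∀ b x → φ (if b then x else 0π) ≡ φ x * (if b then 1ℤ else 0ℤ)
        φ-if true  x = sym (ℤₚ.*-identityʳ (φ x))
        φ-if false x = trans φ-0 (sym (ℤₚ.*-zeroʳ (φ x)))

      -- The formula for e_w(A,B), letter by letter. For D other than A and B both hats are twice an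
      -- indicator, and the products give A ∘ B and B ∘ A. For D = A or D = B one hat is 1 at both
      -- ends, and what remains is a difference of indicators, the linking number; this is the
      -- origin of the term n_w(A,B)(|A| + |B|).
      pointwise-hat : ∀ A B D → hatʷ A (l D) * hatʷ B (r D) - hatʷ A (r D) * hatʷ B (l D) ≡
        4ℤ * (inner∘ A B D - inner∘ B A D) + 2ℤ * (n⟨_,_⟩ w A B * (δ A D + δ B D))
      pointwise-hat A B D = go (letters≟ A B) (letters≟ A D) (letters≟ B D)
        where
        open ≡-Reasoning
        goal : Set
        goal = hatʷ A (l D) * hatʷ B (r D) - hatʷ A (r D) * hatʷ B (l D) ≡
          4ℤ * (inner∘ A B D - inner∘ B A D) + 2ℤ * (n⟨_,_⟩ w A B * (δ A D + δ B D))
        nn : ℤ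
        nn = n⟨_,_⟩ w A B
        go : Dec (A ≡ B) → Dec (A ≡ D) → Dec (B ≡ D) → goal
        go (yes refl) _ _ = trans (same (hatʷ A (l D)) (hatʷ A (r D)) (inner∘ A A D) (δ A D + δ A D))
          (cong (λ m → 4ℤ * (inner∘ A A D - inner∘ A A D) + 2ℤ * (m * (δ A D + δ A D))) (sym (linking-self′ A)))
          where
          same : ∀ x y i d → x * y - y * x ≡ 4ℤ * (i - i) + 2ℤ * (0ℤ * d)
          same = solve-∀
        go (no A≢B) (yes refl) (yes refl) = contradiction refl A≢B
        go (no A≢B) (yes refl) (no B≢D) = begin
          hatʷ A (l A) * hatʷ B (r A) - hatʷ A (r A) * hatʷ B (l A)
            ≡⟨ cong₂ (λ x y → x * hatʷ B (r A) - y * hatʷ B (l A)) (hat-left (l A) (r A) (l<r A)) (hat-right (l A) (r A) (l<r A)) ⟩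
          1ℤ * hatʷ B (r A) - 1ℤ * hatʷ B (l A)
            ≡⟨ cong₂ (λ x y → 1ℤ * x - 1ℤ * y) (proj₂ (hat-other B≢D)) (proj₁ (hat-other B≢D)) ⟩
          1ℤ * (2ℤ * insideʷ B (r A)) - 1ℤ * (2ℤ * insideʷ B (l A))
            ≡⟨ ring (insideʷ B (r A)) (insideʷ B (l A)) ⟩
          4ℤ * (0ℤ * insideʷ B (r A) - insideʷ B (l A) * 0ℤ) + 2ℤ * ((insideʷ B (r A) - insideʷ B (l A)) * (1ℤ + 0ℤ))
            ≡⟨ cong₂ (λ x y → 4ℤ * (x * insideʷ B (r A) - insideʷ B (l A) * y) + 2ℤ * ((insideʷ B (r A) - insideʷ B (l A)) * (1ℤ + 0ℤ)))
                 (inside-left (l A) (r A)) (inside-right (l A) (r A)) ⟨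
          4ℤ * (inner∘ A B A - inner∘ B A A) + 2ℤ * ((insideʷ B (r A) - insideʷ B (l A)) * (1ℤ + 0ℤ))
            ≡⟨ cong₂ (λ m d → 4ℤ * (inner∘ A B A - inner∘ B A A) + 2ℤ * (m * d)) (proj₂ (linking-other A≢B))
                 (sym (cong₂ _+_ (δ-refl A) (δ-≢ B≢D))) ⟩
          4ℤ * (inner∘ A B A - inner∘ B A A) + 2ℤ * (nn * (δ A A + δ B A)) ∎
          where
          ring : ∀ x y → 1ℤ * (2ℤ * x) - 1ℤ * (2ℤ * y) ≡ 4ℤ * (0ℤ * x - y * 0ℤ) + 2ℤ * ((x - y) * (1ℤ + 0ℤ))
          ring = solve-∀
        go (no A≢B) (no A≢D) (yes refl) = begin
          hatʷ A (l B) * hatʷ B (r B) - hatʷ A (r B) * hatʷ B (l B)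
            ≡⟨ cong₂ (λ x y → hatʷ A (l B) * x - hatʷ A (r B) * y) (hat-right (l B) (r B) (l<r B)) (hat-left (l B) (r B) (l<r B)) ⟩
          hatʷ A (l B) * 1ℤ - hatʷ A (r B) * 1ℤ
            ≡⟨ cong₂ (λ x y → x * 1ℤ - y * 1ℤ) (proj₁ (hat-other A≢D)) (proj₂ (hat-other A≢D)) ⟩
          2ℤ * insideʷ A (l B) * 1ℤ - 2ℤ * insideʷ A (r B) * 1ℤ
            ≡⟨ ring (insideʷ A (l B)) (insideʷ A (r B)) ⟩
          4ℤ * (insideʷ A (l B) * 0ℤ - 0ℤ * insideʷ A (r B)) + 2ℤ * ((insideʷ A (l B) - insideʷ A (r B)) * (0ℤ + 1ℤ))
            ≡⟨ cong₂ (λ x y → 4ℤ * (insideʷ A (l B) * x - y * insideʷ A (r B)) + 2ℤ * ((insideʷ A (l B) - insideʷ A (r B)) * (0ℤ + 1ℤ)))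
                 (inside-right (l B) (r B)) (inside-left (l B) (r B)) ⟨
          4ℤ * (inner∘ A B B - inner∘ B A B) + 2ℤ * ((insideʷ A (l B) - insideʷ A (r B)) * (0ℤ + 1ℤ))
            ≡⟨ cong₂ (λ m d → 4ℤ * (inner∘ A B B - inner∘ B A B) + 2ℤ * (m * d)) (proj₁ (linking-other A≢B))
                 (sym (cong₂ _+_ (δ-≢ A≢D) (δ-refl B))) ⟩
          4ℤ * (inner∘ A B B - inner∘ B A B) + 2ℤ * (nn * (δ A B + δ B B)) ∎
          where
          ring : ∀ x y → 2ℤ * x * 1ℤ - 2ℤ * y * 1ℤ ≡ 4ℤ * (x * 0ℤ - 0ℤ * y) + 2ℤ * ((x - y) * (0ℤ + 1ℤ))
          ring = solve-∀
        go (no A≢B) (no A≢D) (no B≢D) = begin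
          hatʷ A (l D) * hatʷ B (r D) - hatʷ A (r D) * hatʷ B (l D)
            ≡⟨ cong₂ _-_ (cong₂ _*_ (proj₁ (hat-other A≢D)) (proj₂ (hat-other B≢D)))
                         (cong₂ _*_ (proj₂ (hat-other A≢D)) (proj₁ (hat-other B≢D))) ⟩
          2ℤ * insideʷ A (l D) * (2ℤ * insideʷ B (r D)) - 2ℤ * insideʷ A (r D) * (2ℤ * insideʷ B (l D))
            ≡⟨ ring (insideʷ A (l D)) (insideʷ B (r D)) (insideʷ A (r D)) (insideʷ B (l D)) nn ⟩
          4ℤ * (inner∘ A B D - inner∘ B A D) + 2ℤ * (nn * (0ℤ + 0ℤ))
            ≡⟨ cong (λ d → 4ℤ * (inner∘ A B D - inner∘ B A D) + 2ℤ * (nn * d)) (cong₂ _+_ (δ-≢ A≢D) (δ-≢ B≢D)) ⟨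
          4ℤ * (inner∘ A B D - inner∘ B A D) + 2ℤ * (nn * (δ A D + δ B D)) ∎
          where
          ring : ∀ x y s t m → 2ℤ * x * (2ℤ * y) - 2ℤ * s * (2ℤ * t) ≡ 4ℤ * (x * y - t * s) + 2ℤ * (m * (0ℤ + 0ℤ))
          ring = solve-∀

      K-hat-hat : ∀ A B → K (hatʷ A) (hatʷ B) ≡ 2ℤ * φ (pairing-e w (just A) (just B))
      K-hat-hat A B = begin
        ∑ℤ fin (λ D → chargeOf D * (hatʷ A (l D) * hatʷ B (r D) - hatʷ A (r D) * hatʷ B (l D)))
          ≡⟨ ∑-cong fin (λ D → trans (cong (chargeOf D *_) (pointwise-hat A B D))
               (spread (chargeOf D) (inner∘ A B D) (inner∘ B A D) nn (δ A D) (δ B D))) ⟩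
        ∑ℤ fin (λ D → 4ℤ * P D + (- 4ℤ * Q D + (2ℤ * nn * (δ A D * chargeOf D) + 2ℤ * nn * (δ B D * chargeOf D))))
          ≡⟨ trans (∑-+ fin (λ D → 4ℤ * P D) _) (cong₂ _+_ (∑-*ˡ fin 4ℤ P)
               (trans (∑-+ fin (λ D → - 4ℤ * Q D) _) (cong₂ _+_ (∑-*ˡ fin (- 4ℤ) Q)
                 (trans (∑-+ fin (λ D → 2ℤ * nn * (δ A D * chargeOf D)) _) (cong₂ _+_ (pick A) (pick B)))))) ⟩
        4ℤ * ∑ℤ fin P + (- 4ℤ * ∑ℤ fin Q + (2ℤ * nn * chargeOf A + 2ℤ * nn * chargeOf B))
          ≡⟨ cong₂ (λ x y → 4ℤ * x + (- 4ℤ * y + (2ℤ * nn * chargeOf A + 2ℤ * nn * chargeOf B))) (sym (φ-∘ A B)) (sym (φ-∘ B A)) ⟩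
        4ℤ * φ (_∘ʷ_ w A B) + (- 4ℤ * φ (_∘ʷ_ w B A) + (2ℤ * nn * chargeOf A + 2ℤ * nn * chargeOf B))
          ≡⟨ gather (φ (_∘ʷ_ w A B)) (φ (_∘ʷ_ w B A)) nn (chargeOf A) (chargeOf B) ⟩
        2ℤ * (2ℤ * (φ (_∘ʷ_ w A B) + - φ (_∘ʷ_ w B A)) + nn * (chargeOf A + chargeOf B))
          ≡⟨ cong (2ℤ *_) (sym φe) ⟩
        2ℤ * φ (pairing-e w (just A) (just B)) ∎
        where
        open ≡-Reasoning
        nn : ℤ
        nn = n⟨_,_⟩ w A B
        P Q : Letter 𝒜 → ℤ
        P D = chargeOf D * inner∘ A B D
        Q D = chargeOf D * inner∘ B A D
        spread : ∀ q i j m d e → q * (4ℤ * (i - j) + 2ℤ * (m * (d + e))) ≡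
          4ℤ * (q * i) + (- 4ℤ * (q * j) + (2ℤ * m * (d * q) + 2ℤ * m * (e * q)))
        spread = solve-∀
        pick : ∀ C → ∑ℤ fin (λ D → 2ℤ * nn * (δ C D * chargeOf D)) ≡ 2ℤ * nn * chargeOf C
        pick C = trans (∑-*ˡ fin (2ℤ * nn) _) (cong (2ℤ * nn *_) (∑-δ C chargeOf))
        gather : ∀ f g m a b → 4ℤ * f + (- 4ℤ * g + (2ℤ * m * a + 2ℤ * m * b)) ≡ 2ℤ * (2ℤ * (f + - g) + m * (a + b))
        gather = solve-∀
        φe : φ (pairing-e w (just A) (just B)) ≡ 2ℤ * (φ (_∘ʷ_ w A B) + - φ (_∘ʷ_ w B A)) + nn * (chargeOf A + chargeOf B)
        φe = trans (φ-+ _ _) (cong₂ _+_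
          (trans (φ-· 2ℤ _) (cong (2ℤ *_) (trans (φ-+ _ _) (cong (φ (_∘ʷ_ w A B) +_) (φ-neg _)))))
          (trans (φ-· nn _) (cong (nn *_) (φ-+ _ _))))

    -- In the factor 4, one 2 is the difference of the charges `q` and `- q` in `ω`, the other the
    -- height 2 of the hats. The value `c` plays the part of the coefficient of `s`.
    form-expand : ∀ z c z′ c′ → let x A = chargeOf A * z A ; y B = chargeOf B * z′ B in
      formʷ z c z′ c′ ≡ 4ℤ * (c * - ∑ℤ fin (λ B → y B * φ (pairing-e w (just B) nothing))
        + ∑ℤ fin (λ A → x A * (c′ * φ (pairing-e w (just A) nothing)
            + ∑ℤ fin (λ B → y B * φ (pairing-e w (just A) (just B))))))
    form-expand z c z′ c′ = begin
      formʷ z c z′ c′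
        ≡⟨ form-det z c z′ c′ ⟩
      2ℤ * K (height z c) v′
        ≡⟨ cong (2ℤ *_) (K-linear c x v′) ⟩
      2ℤ * (c * K 𝟙 v′ + ∑ℤ fin (λ A → x A * K (hatʷ A) v′))
        ≡⟨ cong₂ (λ s t → 2ℤ * (c * s + t)) K-𝟙 (trans (∑-cong fin λ A → trans (cong (x A *_) (K-A A))
             (out (x A) _)) (∑-*ˡ fin 2ℤ _)) ⟩
      2ℤ * (c * - (2ℤ * N) + 2ℤ * M)
        ≡⟨ four c N M ⟩
      4ℤ * (c * - N + M) ∎
      where
      open ≡-Reasoning
      x y : Letter 𝒜 → ℤ
      x A = chargeOf A * z A
      y B = chargeOf B * z′ B
      v′ : Fin n → ℤ
      v′ = height z′ c′
      N M : ℤ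
      N = ∑ℤ fin (λ B → y B * φ (pairing-e w (just B) nothing))
      M = ∑ℤ fin (λ A → x A * (c′ * φ (pairing-e w (just A) nothing) + ∑ℤ fin (λ B → y B * φ (pairing-e w (just A) (just B)))))
      out : ∀ a s → a * (2ℤ * s) ≡ 2ℤ * (a * s)
      out = solve-∀
      four : ∀ c n m → 2ℤ * (c * - (2ℤ * n) + 2ℤ * m) ≡ 4ℤ * (c * - n + m)
      four = solve-∀
      K-self : ∀ p → K p p ≡ 0ℤ
      K-self p = ∑-zero fin λ D → zero-det (chargeOf D) (p (l D)) (p (r D))
        where
        zero-det : ∀ q a b → q * (a * b - b * a) ≡ 0ℤ
        zero-det = solve-∀
      K-𝟙 : K 𝟙 v′ ≡ - (2ℤ * N)
      K-𝟙 = trans (K-skew 𝟙 v′) (cong -_ (begin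
        K v′ 𝟙
          ≡⟨ K-linear c′ y 𝟙 ⟩
        c′ * K 𝟙 𝟙 + ∑ℤ fin (λ B → y B * K (hatʷ B) 𝟙)
          ≡⟨ cong₂ (λ s t → c′ * s + t) (K-self 𝟙) (trans (∑-cong fin λ B → trans (cong (y B *_) (K-hat-𝟙 B)) (out (y B) _)) (∑-*ˡ fin 2ℤ _)) ⟩
        c′ * 0ℤ + 2ℤ * N
          ≡⟨ trans (cong (_+ 2ℤ * N) (ℤₚ.*-zeroʳ c′)) (ℤₚ.+-identityˡ _) ⟩
        2ℤ * N ∎))
      K-A : ∀ A → K (hatʷ A) v′ ≡ 2ℤ * (c′ * φ (pairing-e w (just A) nothing) + ∑ℤ fin (λ B → y B * φ (pairing-e w (just A) (just B))))
      K-A A = begin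
        K (hatʷ A) v′
          ≡⟨ K-skew (hatʷ A) v′ ⟩
        - K v′ (hatʷ A)
          ≡⟨ cong -_ (K-linear c′ y (hatʷ A)) ⟩
        - (c′ * K 𝟙 (hatʷ A) + ∑ℤ fin (λ B → y B * K (hatʷ B) (hatʷ A)))
          ≡⟨ cong₂ (λ s t → - (c′ * s + t)) (trans (K-skew 𝟙 (hatʷ A)) (cong -_ (K-hat-𝟙 A)))
               (trans (∑-cong fin λ B → trans (cong (y B *_) (trans (K-skew (hatʷ B) (hatʷ A)) (cong -_ (K-hat-hat A B))))
                 (outneg (y B) _)) (∑-*ˡ fin (- 2ℤ) _)) ⟩
        - (c′ * - (2ℤ * φ (pairing-e w (just A) nothing)) + - 2ℤ * ∑ℤ fin (λ B → y B * φ (pairing-e w (just A) (just B))))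
          ≡⟨ ring c′ (φ (pairing-e w (just A) nothing)) _ ⟩
        2ℤ * (c′ * φ (pairing-e w (just A) nothing) + ∑ℤ fin (λ B → y B * φ (pairing-e w (just A) (just B)))) ∎
        where
        outneg : ∀ a s → a * - (2ℤ * s) ≡ - 2ℤ * (a * s)
        outneg = solve-∀
        ring : ∀ c u s → - (c * - (2ℤ * u) + - 2ℤ * s) ≡ 2ℤ * (c * u + s)
        ring = solve-∀

-- The pairing of a direct sum with an opposite.

module PairingGram {a} (α : Set a) (τ : α → α) (τ-involutive : Involutive _≡_ τ)
                   (φ : Nanowords.Π α τ τ-involutive → ℤ) (φ-additive : Nanowords.IsAdditive α τ τ-involutive φ)
                   (φ-unit : ∀ x → φ (Nanowords.gen x) ≡ 1ℤ ⊎ φ (Nanowords.gen x) ≡ -1ℤ) where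

  open Nanowords α τ τ-involutive
  open NanowordForms α τ τ-involutive φ φ-additive φ-unit
  open FiniteTypeSums
  open import Data.Integer.Base using (_+_; _*_; -_; _-_)
  open GroupMorphisms (AbelianGroup.rawGroup π) (AbelianGroup.rawGroup ℤₚ.+-0-abelianGroup) using (module IsGroupHomomorphism)
  open IsGroupHomomorphism φ-additive renaming (homo to φ-+; ε-homo to φ-0; ⁻¹-homo to φ-neg)

  φ-ẽ : ∀ p (x y : Pairing.ℤS p) → let open Pairing p in φ (ẽ x y) ≡
    x s * y s * φ (e s s) + ∑ℤ finite° (λ B → x s * y (just B) * φ (e s (just B)))
    + ∑ℤ finite° (λ A → x (just A) * y s * φ (e (just A) s)
        + ∑ℤ finite° (λ B → x (just A) * y (just B) * φ (e (just A) (just B))))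
  φ-ẽ p x y = begin
    φ (ẽ x y)
      ≡⟨ trans (φ-∑ finite _) (∑-cong finite λ A → trans (φ-∑ finite _) (∑-cong finite λ B → φ-· (x A * y B) (e A B))) ⟩
    ∑ℤ finite (λ A → ∑ℤ finite λ B → x A * y B * φ (e A B))
      ≡⟨ ∑-cong finite (λ A → ∑-Maybe finite° _) ⟩
    ∑ℤ finite (λ A → x A * y s * φ (e A s) + ∑ℤ finite° (λ B → x A * y (just B) * φ (e A (just B))))
      ≡⟨ ∑-Maybe finite° _ ⟩
    _ ∎
    where
    open ≡-Reasoning
    open Pairing p

  module _ (w v : Nanoword) where

    private
      𝒜 ℬ : Alphabet
      𝒜 = proj₁ w
      ℬ = proj₁ v
      ww : NanowordOver 𝒜
      ww = proj₂ w
      vv : NanowordOver ℬ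
      vv = proj₂ v
      L₁ L₂ : Set
      L₁ = Alphabet.Letter 𝒜
      L₂ = Alphabet.Letter ℬ
      p : Pairing
      p = pairing w ⊕ opposite-pairing (pairing v)
      f₁ : Finite L₁
      f₁ = NanowordOver.finite ww
      f₂ : Finite L₂
      f₂ = NanowordOver.finite vv

    open Pairing p using (ẽ; S; e)

    -- The two blocks do not interact except through the common `s`. Its coefficient is therefore
    -- the start value of the functions on both words, and the opposite pairing turns the sum of the
    -- two forms into a difference.
    gram-form : ∀ (x y : S → ℤ) (x₁ y₁ : L₁ → ℤ) (x₂ y₂ : L₂ → ℤ) →
      (∀ A → x (just (inj₁ A)) ≡ chargeOf ww A * x₁ A) → (∀ A → y (just (inj₁ A)) ≡ chargeOf ww A * y₁ A) →
      (∀ A → x (just (inj₂ A)) ≡ chargeOf vv A * x₂ A) → (∀ A → y (just (inj₂ A)) ≡ chargeOf vv A * y₂ A) →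
      ℤ.+ 4 * φ (ẽ x y) ≡ formʷ ww x₁ (x nothing) y₁ (y nothing) - formʷ vv x₂ (x nothing) y₂ (y nothing)
    gram-form x y x₁ y₁ x₂ y₂ hx₁ hy₁ hx₂ hy₂ = begin
      ℤ.+ 4 * φ (ẽ x y)
        ≡⟨ cong (ℤ.+ 4 *_) (trans (φ-ẽ p x y) (cong₂ _+_ (cong₂ _+_ corner (row)) column)) ⟩
      ℤ.+ 4 * (0ℤ + (c * - N₁ + c * N₂) + (M₁ + - M₂))
        ≡⟨ ring (c * - N₁) c N₂ M₁ M₂ ⟩
      ℤ.+ 4 * (c * - N₁ + M₁) - ℤ.+ 4 * (c * - N₂ + M₂)
        ≡⟨ cong₂ _-_ (form-expand ww x₁ c y₁ c′) (form-expand vv x₂ c y₂ c′) ⟨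
      formʷ ww x₁ c y₁ c′ - formʷ vv x₂ c y₂ c′ ∎
      where
      open ≡-Reasoning
      c c′ : ℤ
      c  = x nothing
      c′ = y nothing
      s₁ : L₁ → ℤ
      s₁ A = φ (pairing-e ww (just A) nothing)
      s₂ : L₂ → ℤ
      s₂ A = φ (pairing-e vv (just A) nothing)
      e₁ : L₁ → L₁ → ℤ
      e₁ A B = φ (pairing-e ww (just A) (just B))
      e₂ : L₂ → L₂ → ℤ
      e₂ A B = φ (pairing-e vv (just A) (just B))
      X₁ Y₁ : L₁ → ℤ
      X₁ A = chargeOf ww A * x₁ A
      Y₁ A = chargeOf ww A * y₁ A
      X₂ Y₂ : L₂ → ℤ
      X₂ A = chargeOf vv A * x₂ A
      Y₂ A = chargeOf vv A * y₂ A
      N₁ N₂ M₁ M₂ : ℤ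
      N₁ = ∑ℤ f₁ (λ B → Y₁ B * s₁ B)
      N₂ = ∑ℤ f₂ (λ B → Y₂ B * s₂ B)
      M₁ = ∑ℤ f₁ (λ A → X₁ A * (c′ * s₁ A + ∑ℤ f₁ (λ B → Y₁ B * e₁ A B)))
      M₂ = ∑ℤ f₂ (λ A → X₂ A * (c′ * s₂ A + ∑ℤ f₂ (λ B → Y₂ B * e₂ A B)))
      ring : ∀ a c n m m′ → ℤ.+ 4 * (0ℤ + (a + c * n) + (m + - m′)) ≡ ℤ.+ 4 * (a + m) - ℤ.+ 4 * (c * - n + m′)
      ring = solve-∀
      corner : c * c′ * φ (0π +π -π 0π) ≡ 0ℤ
      corner = trans (cong (c * c′ *_) (trans (φ-+ 0π (-π 0π)) (cong₂ _+_ φ-0 (trans (φ-neg 0π) (cong -_ φ-0)))))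
        (ℤₚ.*-zeroʳ (c * c′))
      row : ∑ℤ (Finite-⊎ f₁ f₂) (λ B → c * y (just B) * φ (e nothing (just B))) ≡ c * - N₁ + c * N₂
      row = trans (∑-⊎ f₁ f₂ _) (cong₂ _+_
        (trans (∑-cong f₁ λ B → trans (cong₂ (λ u t → c * u * t) (hy₁ B) (φ-neg (pairing-e ww (just B) nothing))) (neg c (Y₁ B) (s₁ B)))
          (trans (∑-*ˡ f₁ (- c) _) (outside c N₁)))
        (trans (∑-cong f₂ λ B → trans (cong₂ (λ u t → c * u * t) (hy₂ B)
            (trans (φ-neg (-π (pairing-e vv (just B) nothing))) (trans (cong -_ (φ-neg (pairing-e vv (just B) nothing))) (ℤₚ.neg-involutive _))))
            (ℤₚ.*-assoc c (Y₂ B) (s₂ B)))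
          (∑-*ˡ f₂ c _)))
        where
        neg : ∀ c y s → c * y * - s ≡ - c * (y * s)
        neg = solve-∀
        outside : ∀ c n → - c * n ≡ c * - n
        outside = solve-∀
      block : {L : Set} (f : Finite L) (u : ℤ) (Y E : L → ℤ) →
              ∑ℤ f (λ B → u * Y B * E B) ≡ u * ∑ℤ f (λ B → Y B * E B)
      block f u Y E = trans (∑-cong f λ B → ℤₚ.*-assoc u (Y B) (E B)) (∑-*ˡ f u _)
      zero-block : {L : Set} (f : Finite L) (u : ℤ) (Y : L → ℤ) → ∑ℤ f (λ B → u * Y B * φ 0π) ≡ 0ℤ
      zero-block f u Y = ∑-zero f λ B → trans (cong (u * Y B *_) φ-0) (ℤₚ.*-zeroʳ (u * Y B))
      column : ∑ℤ (Finite-⊎ f₁ f₂) (λ A → x (just A) * c′ * φ (e (just A) nothing)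
                 + ∑ℤ (Finite-⊎ f₁ f₂) (λ B → x (just A) * y (just B) * φ (e (just A) (just B)))) ≡ M₁ + - M₂
      column = trans (∑-⊎ f₁ f₂ _) (cong₂ _+_ (∑-cong f₁ left-column)
        (trans (∑-cong f₂ right-column) (trans (∑-*ˡ f₂ -1ℤ _) (ℤₚ.-1*i≡-i M₂))))
        where
        left-column : ∀ A → x (just (inj₁ A)) * c′ * s₁ A
          + ∑ℤ (Finite-⊎ f₁ f₂) (λ B → x (just (inj₁ A)) * y (just B) * φ (e (just (inj₁ A)) (just B)))
          ≡ X₁ A * (c′ * s₁ A + ∑ℤ f₁ (λ B → Y₁ B * e₁ A B))
        left-column A = trans (cong (λ u → u * c′ * s₁ A + ∑ℤ (Finite-⊎ f₁ f₂) (λ B → u * y (just B) * φ (e (just (inj₁ A)) (just B)))) (hx₁ A))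
          (trans (cong (X₁ A * c′ * s₁ A +_) (trans (∑-⊎ f₁ f₂ _) (cong₂ _+_
            (trans (∑-cong f₁ λ B → cong (λ u → X₁ A * u * e₁ A B) (hy₁ B)) (block f₁ (X₁ A) Y₁ (e₁ A)))
            (zero-block f₂ (X₁ A) (λ B → y (just (inj₂ B)))))))
          (collect (X₁ A) c′ (s₁ A) _))
          where
          collect : ∀ x c s t → x * c * s + (x * t + 0ℤ) ≡ x * (c * s + t)
          collect = solve-∀
        right-column : ∀ A → x (just (inj₂ A)) * c′ * φ (e (just (inj₂ A)) nothing)
          + ∑ℤ (Finite-⊎ f₁ f₂) (λ B → x (just (inj₂ A)) * y (just B) * φ (e (just (inj₂ A)) (just B)))
          ≡ -1ℤ * (X₂ A * (c′ * s₂ A + ∑ℤ f₂ (λ B → Y₂ B * e₂ A B)))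
        right-column A = trans (cong₂ (λ u t → u * c′ * t + ∑ℤ (Finite-⊎ f₁ f₂) (λ B → u * y (just B) * φ (e (just (inj₂ A)) (just B))))
            (hx₂ A) (φ-neg (pairing-e vv (just A) nothing)))
          (trans (cong (X₂ A * c′ * - s₂ A +_) (trans (∑-⊎ f₁ f₂ _) (cong₂ _+_
            (zero-block f₁ (X₂ A) (λ B → y (just (inj₁ B))))
            (trans (∑-cong f₂ λ B → trans (cong₂ (λ u t → X₂ A * u * t) (hy₂ B) (φ-neg (pairing-e vv (just A) (just B)))) (neg (X₂ A) (Y₂ B) (e₂ A B)))
              (∑-*ˡ f₂ (- X₂ A) _)))))
          (collect (X₂ A) c′ (s₂ A) _))
          where
          neg : ∀ x y e → x * y * - e ≡ - x * (y * e)
          neg = solve-∀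
          collect : ∀ x c s t → x * c * - s + (0ℤ + - x * t) ≡ -1ℤ * (x * (c * s + t))
          collect = solve-∀

-- Uniting classes along an involution.

module Merging {ℓ} {E I : Set} (_≟ᴱ_ : DecidableEquality E) (_≟ᴵ_ : DecidableEquality I) (cls : E → I)
               (_≈_ : E → E → Set ℓ) (≈-sym : ∀ {e e′} → e ≈ e′ → e′ ≈ e)
               (≈-trans : ∀ {e e′ e″} → e ≈ e′ → e′ ≈ e″ → e ≈ e″)
               (j : E → E) (j-involutive : Involutive _≡_ j) (j-≈ : ∀ e → j e ≈ e)
               {Removed : E → Set} (removed? : ∀ e → Removed e ⊎ j e ≡ e) where

  open import Data.List.Membership.DecPropositional _≟ᴱ_ using (_∈?_)

  Alive : List E → E → Set
  Alive ds e = ∀ b → b ∈ ds → Removed b → e ≢ b × e ≢ j b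

  NoThree : (E → I) → (E → Set) → Set
  NoThree f P = ∀ {e₁ e₂ e₃} → P e₁ → P e₂ → P e₃ → e₁ ≢ e₂ → e₁ ≢ e₃ → e₂ ≢ e₃ →
                f e₁ ≡ f e₂ → f e₁ ≡ f e₃ → ⊥

  -- `ds` lists the elements treated so far. A united class may hold more than two elements, but at
  -- most two of them survive the removal; hence `no-three` is demanded of alive elements only,
  -- while `compat` must hold for all.
  record Merged (ds : List E) : Set ℓ where
    field
      r        : I → I
      closed   : ∀ {b} → b ∈ ds → r (cls (j b)) ≡ r (cls b)
      compat   : ∀ {e e′} → r (cls e) ≡ r (cls e′) → e ≈ e′
      no-three : NoThree (r ∘ cls) (Alive ds)

  weaken : ∀ {ds b e} → Alive (b ∷ ds) e → Alive ds e
  weaken al b b∈ = al b (there b∈)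

  -- The alive members of a class number at most two.  When b and j b leave, their classes, which then have
  -- at most one member each, are united.
  merge-step : ∀ {ds} b → Merged ds → Merged (b ∷ ds)
  merge-step {ds} b m with removed? b
  ... | inj₂ jb≡b = record
    { r = r ; closed = λ { (here refl) → cong (r ∘ cls) jb≡b ; (there b∈) → closed b∈ } ; compat = compat
    ; no-three = λ a₁ a₂ a₃ → no-three (weaken a₁) (weaken a₂) (weaken a₃) }
    where open Merged m
  ... | inj₁ rb with b ∈? ds | j b ∈? ds
  -- If `b` or `j b` was treated before, their classes have been united then, and uniting again
  -- would spoil the count of survivors.
  ...   | yes b∈ | _ = record
    { r = r ; closed = λ { (here refl) → closed b∈ ; (there b′∈) → closed b′∈ } ; compat = compat
    ; no-three = λ a₁ a₂ a₃ → no-three (weaken a₁) (weaken a₂) (weaken a₃) }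
    where open Merged m
  ...   | no _ | yes jb∈ = record
    { r = r
    ; closed = λ { (here refl) → trans (sym (closed jb∈)) (cong (r ∘ cls) (j-involutive b)) ; (there b′∈) → closed b′∈ }
    ; compat = compat
    ; no-three = λ a₁ a₂ a₃ → no-three (weaken a₁) (weaken a₂) (weaken a₃) }
    where open Merged m
  ...   | no b∉ | no jb∉ with Merged.r m (cls (j b)) ≟ᴵ Merged.r m (cls b)
  ...     | yes same = record
    { r = r ; closed = λ { (here refl) → same ; (there b∈) → closed b∈ } ; compat = compat
    ; no-three = λ a₁ a₂ a₃ → no-three (weaken a₁) (weaken a₂) (weaken a₃) }
    where open Merged m
  ...     | no β≢γ = record { r = redirect ∘ r ; closed = closed′ ; compat = compat′ ; no-three = no-three′ }
    where
    open Merged m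
    β γ : I
    β = r (cls b)
    γ = r (cls (j b))
    redirect : I → I
    redirect i with i ≟ᴵ γ
    ... | yes _ = β
    ... | no _  = i
    redirect-γ : ∀ {i} → i ≡ γ → redirect i ≡ β
    redirect-γ {i} i≡γ with i ≟ᴵ γ
    ... | yes _  = refl
    ... | no i≢γ = contradiction i≡γ i≢γ
    redirect-≢ : ∀ {i} → i ≢ γ → redirect i ≡ i
    redirect-≢ {i} i≢γ with i ≟ᴵ γ
    ... | yes i≡γ = contradiction i≡γ i≢γ
    ... | no _    = refl
    inverse : ∀ i k → redirect i ≡ redirect k → i ≡ k ⊎ (i ≡ β × k ≡ γ) ⊎ (i ≡ γ × k ≡ β)
    inverse i k e with i ≟ᴵ γ | k ≟ᴵ γ
    ... | yes i≡γ | yes k≡γ = inj₁ (trans i≡γ (sym k≡γ))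
    ... | yes i≡γ | no _    = inj₂ (inj₂ (i≡γ , sym e))
    ... | no _    | yes k≡γ = inj₂ (inj₁ (e , k≡γ))
    ... | no _    | no _    = inj₁ e
    closed′ : ∀ {b′} → b′ ∈ b ∷ ds → redirect (r (cls (j b′))) ≡ redirect (r (cls b′))
    closed′ (here refl) = trans (redirect-γ refl) (sym (redirect-≢ (β≢γ ∘ sym)))
    closed′ (there b′∈) = cong redirect (closed b′∈)
    compat′ : ∀ {e e′} → redirect (r (cls e)) ≡ redirect (r (cls e′)) → e ≈ e′
    compat′ {e} {e′} eq with inverse (r (cls e)) (r (cls e′)) eq
    ... | inj₁ same             = compat same
    ... | inj₂ (inj₁ (eβ , eγ)) = ≈-trans (compat eβ) (≈-trans (≈-sym (j-≈ b)) (≈-sym (compat eγ)))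
    ... | inj₂ (inj₂ (eγ , eβ)) = ≈-trans (compat eγ) (≈-trans (j-≈ b) (≈-sym (compat eβ)))
    -- As neither `b` nor `j b` was treated, both still count as alive members of their classes
    -- before this step.
    alive-b : Alive ds b
    alive-b b′ b′∈ _ = (λ { refl → b∉ b′∈ }) , λ b≡jb′ → jb∉ (subst (_∈ ds) (trans (sym (j-involutive b′)) (cong j (sym b≡jb′))) b′∈)
    alive-jb : Alive ds (j b)
    alive-jb b′ b′∈ _ = (λ { refl → jb∉ b′∈ }) , λ jb≡jb′ →
      b∉ (subst (_∈ ds) (trans (sym (j-involutive b′)) (trans (cong j (sym jb≡jb′)) (j-involutive b))) b′∈)
    -- Two survivors in the class of `b`, or in that of `j b`, would form a triple with `b` or `j b`
    -- itself. So each of the united classes brings at most one survivor.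
    pair : ∀ {e₁ e₂} → Alive (b ∷ ds) e₁ → Alive (b ∷ ds) e₂ → e₁ ≢ e₂ → ∀ {i} → i ≡ β ⊎ i ≡ γ →
           r (cls e₁) ≡ i → r (cls e₂) ≡ i → ⊥
    pair a₁ a₂ e₁≢e₂ (inj₁ refl) p₁ p₂ = no-three (weaken a₁) (weaken a₂) alive-b e₁≢e₂
      (proj₁ (a₁ b (here refl) rb)) (proj₁ (a₂ b (here refl) rb)) (trans p₁ (sym p₂)) p₁
    pair a₁ a₂ e₁≢e₂ (inj₂ refl) p₁ p₂ = no-three (weaken a₁) (weaken a₂) alive-jb e₁≢e₂
      (proj₂ (a₁ b (here refl) rb)) (proj₂ (a₂ b (here refl) rb)) (trans p₁ (sym p₂)) p₁
    no-three′ : NoThree (redirect ∘ r ∘ cls) (Alive (b ∷ ds))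
    no-three′ {e₁} {e₂} {e₃} a₁ a₂ a₃ n₁₂ n₁₃ n₂₃ q₁₂ q₁₃
      with inverse (r (cls e₁)) (r (cls e₂)) q₁₂ | inverse (r (cls e₁)) (r (cls e₃)) q₁₃
    ... | inj₁ p₁₂ | inj₁ p₁₃ = no-three (weaken a₁) (weaken a₂) (weaken a₃) n₁₂ n₁₃ n₂₃ p₁₂ p₁₃
    ... | inj₁ p₁₂ | inj₂ (inj₁ (p , _)) = pair a₁ a₂ n₁₂ (inj₁ refl) p (trans (sym p₁₂) p)
    ... | inj₁ p₁₂ | inj₂ (inj₂ (p , _)) = pair a₁ a₂ n₁₂ (inj₂ refl) p (trans (sym p₁₂) p)
    ... | inj₂ (inj₁ (p , _)) | inj₁ p₁₃ = pair a₁ a₃ n₁₃ (inj₁ refl) p (trans (sym p₁₃) p)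
    ... | inj₂ (inj₂ (p , _)) | inj₁ p₁₃ = pair a₁ a₃ n₁₃ (inj₂ refl) p (trans (sym p₁₃) p)
    ... | inj₂ (inj₁ (_ , p₂)) | inj₂ (inj₁ (_ , p₃)) = pair a₂ a₃ n₂₃ (inj₂ refl) p₂ p₃
    ... | inj₂ (inj₂ (_ , p₂)) | inj₂ (inj₂ (_ , p₃)) = pair a₂ a₃ n₂₃ (inj₁ refl) p₂ p₃
    ... | inj₂ (inj₁ (p , _)) | inj₂ (inj₂ (q , _)) = β≢γ (trans (sym q) p)
    ... | inj₂ (inj₂ (p , _)) | inj₂ (inj₁ (q , _)) = β≢γ (trans (sym p) q)

  merge : (∀ {e e′} → cls e ≡ cls e′ → e ≈ e′) → NoThree cls (λ e → e ≡ e) → ∀ ds → Merged ds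
  merge compat no-three []       = record
    { r = id ; closed = λ () ; compat = compat ; no-three = λ _ _ _ → no-three refl refl refl }
  merge compat no-three (b ∷ ds) = merge-step b (merge compat no-three ds)

-- Reductions, links and their composition.

module Cobordisms {a} (α : Set a) (τ : α → α) (τ-involutive : Involutive _≡_ τ)
                  (φ : Nanowords.Π α τ τ-involutive → ℤ) (φ-additive : Nanowords.IsAdditive α τ τ-involutive φ)
                  (φ-unit : ∀ x → φ (Nanowords.gen x) ≡ 1ℤ ⊎ φ (Nanowords.gen x) ≡ -1ℤ) where

  open Nanowords α τ τ-involutive
  open NanowordForms α τ τ-involutive φ φ-additive φ-unit
  open Alphabet
  open NanowordOver using (word; twice; finite)
  open FiniteSums using (2ℤ)
  open LowRank
  open Twice
  open import Data.Integer.Base using (_+_; _*_; -_; _-_)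

  infix 4 _∼_

  -- The relation between two labels that allows a short vector A + B (equal labels) or A - B
  -- (labels exchanged by τ).
  _∼_ : α → α → Set a
  x ∼ y = x ≡ y ⊎ x ≡ τ y

  ∼-refl : ∀ {x} → x ∼ x
  ∼-refl = inj₁ refl

  ∼-sym : ∀ {x y} → x ∼ y → y ∼ x
  ∼-sym (inj₁ e) = inj₁ (sym e)
  ∼-sym {x} {y} (inj₂ e) = inj₂ (trans (sym (τ-involutive y)) (cong τ (sym e)))

  ∼-trans : ∀ {x y z} → x ∼ y → y ∼ z → x ∼ z
  ∼-trans (inj₁ refl) q           = q
  ∼-trans (inj₂ p)    (inj₁ refl) = inj₂ p
  ∼-trans (inj₂ p)    (inj₂ refl) = inj₁ (trans p (τ-involutive _))

  Invariant : {L : Set} → (L → L) → Set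
  Invariant {L} ι = (Σ (L → ℤ) λ z → ∀ A → z (ι A) ≡ z A) × ℤ

  -- What the moves w ↦ u have in common: functions z invariant under ι, restricted to the letters of u, give
  -- nearly the same form on w and u.
  record Reduction (N : ℕ) {𝒜 ℬ : Alphabet} (w : NanowordOver 𝒜) (u : NanowordOver ℬ) : Set a where
    field
      kept           : Letter ℬ → Letter 𝒜
      kept-injective : ∀ {A B} → kept A ≡ kept B → A ≡ B
      kept-label     : ∀ B → label 𝒜 (kept B) ∼ label ℬ B
      ι              : Letter 𝒜 → Letter 𝒜
      ι-involutive   : Involutive _≡_ ι
      ι-label        : ∀ A → label 𝒜 (ι A) ∼ label 𝒜 A
      ι-kept         : ∀ B → ι (kept B) ≡ kept B
      split          : ∀ A → (∃ λ B → kept B ≡ A) ⊎ (∀ B → kept B ≢ A)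
      twist          : (Letter 𝒜 → ℤ) → ℤ
      low            : Low {A = Invariant ι} N λ ((z , _) , c) ((z′ , _) , c′) →
        2ℤ * (formʷ w z c z′ c′ - formʷ u (z ∘ kept) (c + twist z) (z′ ∘ kept) (c′ + twist z′))

  -- A filling of the pairing p(w) ⊕ p(v)⁻, given by its classes of letters, whose vectors have a Gram
  -- matrix of small rank after suitable multiples (the twist) of s are added to their components in ℤS of v.
  record Link (N : ℕ) {𝒜 ℬ : Alphabet} (w : NanowordOver 𝒜) (v : NanowordOver ℬ) : Set (Level.suc 0ℓ ⊔ a) where
    labels : Letter 𝒜 ⊎ Letter ℬ → α
    labels = Sum.[ label 𝒜 , label ℬ ]′
    field
      I        : Set
      _≟ᴵ_     : DecidableEquality I
      cls      : Letter 𝒜 ⊎ Letter ℬ → I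
      compat   : ∀ {e e′} → cls e ≡ cls e′ → labels e ∼ labels e′
      no-three : ∀ {e₁ e₂ e₃} → e₁ ≢ e₂ → e₁ ≢ e₃ → e₂ ≢ e₃ → cls e₁ ≡ cls e₂ → cls e₁ ≡ cls e₃ → ⊥
      twist    : (I → ℤ) → ℤ
      low      : Low {A = (I → ℤ) × ℤ} N λ (z , c) (z′ , c′) →
        2ℤ * (formʷ w (z ∘ cls ∘ inj₁) c (z′ ∘ cls ∘ inj₁) c′
             - formʷ v (z ∘ cls ∘ inj₂) (c + twist z) (z′ ∘ cls ∘ inj₂) (c′ + twist z′))

  formʷ-cong : ∀ {𝒜} (w : NanowordOver 𝒜) {z₁ z₂ z₁′ z₂′ : Letter 𝒜 → ℤ} {c d c′ d′} →
               z₁ ≗ z₂ → c ≡ d → z₁′ ≗ z₂′ → c′ ≡ d′ → formʷ w z₁ c z₁′ c′ ≡ formʷ w z₂ d z₂′ d′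
  formʷ-cong w {c = c} {c′ = c′} e refl e′ refl = ChargedWords.form-cong (letters≟ w) (charged w) c c′ e e′

  link-refl : ∀ {𝒜} (w : NanowordOver 𝒜) → Link 0 w w
  link-refl {𝒜} w = record
    { I = Letter 𝒜 ; _≟ᴵ_ = letters≟ w ; cls = fold ; compat = λ {e} {e′} → compat e e′
    ; no-three = λ {e₁} {e₂} {e₃} → no-three e₁ e₂ e₃
    ; twist = λ _ → 0ℤ
    ; low = low-zero λ (z , c) (z′ , c′) → trans
        (cong (λ x → 2ℤ * (formʷ w z c z′ c′ - x)) (formʷ-cong w (λ _ → refl) (ℤₚ.+-identityʳ c) (λ _ → refl) (ℤₚ.+-identityʳ c′)))
        (cancel (formʷ w z c z′ c′))
    }
    where
    fold : Letter 𝒜 ⊎ Letter 𝒜 → Letter 𝒜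
    fold = Sum.[ id , id ]′
    labels : Letter 𝒜 ⊎ Letter 𝒜 → α
    labels = Sum.[ label 𝒜 , label 𝒜 ]′
    labels-fold : ∀ e → labels e ≡ label 𝒜 (fold e)
    labels-fold (inj₁ A) = refl
    labels-fold (inj₂ A) = refl
    compat : ∀ e e′ → fold e ≡ fold e′ → labels e ∼ labels e′
    compat e e′ p = inj₁ (trans (labels-fold e) (trans (cong (label 𝒜) p) (sym (labels-fold e′))))
    no-three : ∀ e₁ e₂ e₃ → e₁ ≢ e₂ → e₁ ≢ e₃ → e₂ ≢ e₃ → fold e₁ ≡ fold e₂ → fold e₁ ≡ fold e₃ → ⊥
    no-three (inj₁ _) (inj₁ _) _        n₁₂ _   _   p _ = n₁₂ (cong inj₁ p)
    no-three (inj₂ _) (inj₂ _) _        n₁₂ _   _   p _ = n₁₂ (cong inj₂ p)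
    no-three (inj₁ _) (inj₂ _) (inj₁ _) _   n₁₃ _   _ q = n₁₃ (cong inj₁ q)
    no-three (inj₁ _) (inj₂ _) (inj₂ _) _   _   n₂₃ p q = n₂₃ (cong inj₂ (trans (sym p) q))
    no-three (inj₂ _) (inj₁ _) (inj₂ _) _   n₁₃ _   _ q = n₁₃ (cong inj₂ q)
    no-three (inj₂ _) (inj₁ _) (inj₁ _) _   _   n₂₃ p q = n₂₃ (cong inj₁ (trans (sym p) q))
    cancel : ∀ x → 2ℤ * (x - x) ≡ 0ℤ
    cancel = solve-∀

  private
    telescope : ∀ x y z → 2ℤ * (x - z) ≡ 2ℤ * (x - y) + 2ℤ * (y - z)
    telescope = solve-∀

  module _ {M N : ℕ} {𝒜 ℬ 𝒞 : Alphabet} {u : NanowordOver 𝒜} {w : NanowordOver ℬ} {v : NanowordOver 𝒞} where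

    -- The letters of `u` that `w` lacks disappear from the link, but the reduction applies only to
    -- functions invariant under its `ι`; uniting the classes of B and ι(B) provides this
    -- invariance. As the reduction adds its twist on the way from `u` to `w`, the start value on
    -- `u` has to be lowered by it.
    link-backward : Reduction N u w → Link M u v → Link (N ℕ.+ M) w v
    link-backward red lk = record
      { I = Lk.I ; _≟ᴵ_ = Lk._≟ᴵ_ ; cls = cls′ ; compat = λ {e} {e′} p → compat′ e e′ p
      ; no-three = λ {e₁} {e₂} {e₃} n₁₂ n₁₃ n₂₃ → Mg.no-three (alive e₁) (alive e₂) (alive e₃)
          (n₁₂ ∘ emb-injective e₁ e₂) (n₁₃ ∘ emb-injective e₁ e₃) (n₂₃ ∘ emb-injective e₂ e₃)
      ; twist = λ z → - R.twist (zᵘ z) + Lk.twist (z ∘ Mg.r)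
      ; low = low-cong expand (low-+
          (low-pull {B = (Lk.I → ℤ) × ℤ} (λ (z , c) → (zᵘ z , zᵘ-ι z) , c - R.twist (zᵘ z)) (low-* -1ℤ R.low))
          (low-pull (λ (z , c) → z ∘ Mg.r , c - R.twist (zᵘ z)) Lk.low))
      }
      where
      module R  = Reduction red
      module Lk = Link lk
      E : Set
      E = Letter 𝒜 ⊎ Letter 𝒞
      _≟ᴱ_ : DecidableEquality E
      _≟ᴱ_ = Sumₚ.≡-dec (letters≟ u) (letters≟ v)
      j : E → E
      j = Sum.map₁ R.ι
      j-involutive : Involutive _≡_ j
      j-involutive (inj₁ A) = cong inj₁ (R.ι-involutive A)
      j-involutive (inj₂ _) = refl
      j-∼ : ∀ e → Lk.labels (j e) ∼ Lk.labels e
      j-∼ (inj₁ A) = R.ι-label A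
      j-∼ (inj₂ _) = ∼-refl
      Removed : E → Set
      Removed (inj₁ A) = ∀ B → R.kept B ≢ A
      Removed (inj₂ _) = ⊥
      removed? : ∀ e → Removed e ⊎ j e ≡ e
      removed? (inj₁ A) with R.split A
      ... | inj₁ (B , refl) = inj₂ (cong inj₁ (R.ι-kept B))
      ... | inj₂ out        = inj₁ out
      removed? (inj₂ _) = inj₂ refl
      ds : List E
      ds = List.map inj₁ (word u)
      module Mg = Merging.Merged (Merging.merge _≟ᴱ_ Lk._≟ᴵ_ Lk.cls (λ e e′ → Lk.labels e ∼ Lk.labels e′) ∼-sym ∼-trans
        j j-involutive j-∼ {Removed} removed? Lk.compat (λ _ _ _ → Lk.no-three) ds)
      emb : Letter ℬ ⊎ Letter 𝒞 → E
      emb = Sum.map₁ R.kept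
      emb-injective : ∀ e e′ → emb e ≡ emb e′ → e ≡ e′
      emb-injective (inj₁ A) (inj₁ B) p    = cong inj₁ (R.kept-injective (Sumₚ.inj₁-injective p))
      emb-injective (inj₂ A) (inj₂ .A) refl = refl
      labels′ : Letter ℬ ⊎ Letter 𝒞 → α
      labels′ = Sum.[ label ℬ , label 𝒞 ]′
      emb-label : ∀ e → Lk.labels (emb e) ∼ labels′ e
      emb-label (inj₁ B) = R.kept-label B
      emb-label (inj₂ C) = ∼-refl
      cls′ : Letter ℬ ⊎ Letter 𝒞 → Lk.I
      cls′ = Mg.r ∘ Lk.cls ∘ emb
      compat′ : ∀ e e′ → cls′ e ≡ cls′ e′ → labels′ e ∼ labels′ e′
      compat′ e e′ p = ∼-trans (∼-sym (emb-label e)) (∼-trans (Mg.compat p) (emb-label e′))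
      alive : ∀ e → ∀ b → b ∈ ds → Removed b → emb e ≢ b × emb e ≢ j b
      alive (inj₁ B) (inj₁ A) _ out = (λ p → out B (Sumₚ.inj₁-injective p)) , λ p → out B
        (trans (sym (R.ι-kept B)) (trans (cong R.ι (Sumₚ.inj₁-injective p)) (R.ι-involutive A)))
      alive (inj₂ C) (inj₁ A) _ out = (λ ()) , λ ()
      zᵘ : (Lk.I → ℤ) → Letter 𝒜 → ℤ
      zᵘ z A = z (Mg.r (Lk.cls (inj₁ A)))
      -- `ds` runs through all letters of `u`, so every ι-orbit has been closed.
      zᵘ-ι : ∀ z A → zᵘ z (R.ι A) ≡ zᵘ z A
      zᵘ-ι z A = cong z (Mg.closed (∈ₚ.∈-map⁺ inj₁ (subst (_∈ word u) (at-left (twice u A)) (∈ₚ.∈-lookup (left (twice u A))))))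
      expand : ∀ ((z , c) (z′ , c′) : (Lk.I → ℤ) × ℤ) →
        let t = R.twist (zᵘ z) ; t′ = R.twist (zᵘ z′) in
        2ℤ * (formʷ w (z ∘ cls′ ∘ inj₁) c (z′ ∘ cls′ ∘ inj₁) c′
             - formʷ v (z ∘ cls′ ∘ inj₂) (c + (- t + Lk.twist (z ∘ Mg.r))) (z′ ∘ cls′ ∘ inj₂) (c′ + (- t′ + Lk.twist (z′ ∘ Mg.r))))
        ≡ -1ℤ * (2ℤ * (formʷ u (zᵘ z) (c - t) (zᵘ z′) (c′ - t′)
                      - formʷ w (zᵘ z ∘ R.kept) (c - t + t) (zᵘ z′ ∘ R.kept) (c′ - t′ + t′)))
          + 2ℤ * (formʷ u (zᵘ z) (c - t) (zᵘ z′) (c′ - t′)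
                 - formʷ v (z ∘ Mg.r ∘ Lk.cls ∘ inj₂) (c - t + Lk.twist (z ∘ Mg.r))
                           (z′ ∘ Mg.r ∘ Lk.cls ∘ inj₂) (c′ - t′ + Lk.twist (z′ ∘ Mg.r)))
      expand (z , c) (z′ , c′) = trans
        (cong₂ (λ x y → 2ℤ * (x - y))
          (formʷ-cong w (λ _ → refl) (undo c (R.twist (zᵘ z))) (λ _ → refl) (undo c′ (R.twist (zᵘ z′))))
          (formʷ-cong v (λ _ → refl) (sym (ℤₚ.+-assoc c _ _)) (λ _ → refl) (sym (ℤₚ.+-assoc c′ _ _))))
        (via (formʷ u (zᵘ z) (c - R.twist (zᵘ z)) (zᵘ z′) (c′ - R.twist (zᵘ z′))) _ _)
        where
        undo : ∀ c t → c ≡ c - t + t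
        undo = solve-∀
        via : ∀ y x z → 2ℤ * (x - z) ≡ -1ℤ * (2ℤ * (y - x)) + 2ℤ * (y - z)
        via = solve-∀

  module _ {M N : ℕ} {𝒜 ℬ 𝒞 : Alphabet} {w : NanowordOver 𝒜} {u : NanowordOver ℬ} {v : NanowordOver 𝒞} where

    -- The letters of `w` that `u` lacks were never matched with anything. Their ι-orbits become new
    -- classes, which have at most two members with labels related by `ι-label`, and on which
    -- functions are invariant by construction.
    link-forward : Reduction N w u → Link M u v → Link (N ℕ.+ M) w v
    link-forward red lk = record
      { I = Lk.I ⊎ Letter 𝒜 ; _≟ᴵ_ = Sumₚ.≡-dec Lk._≟ᴵ_ (letters≟ w) ; cls = cls′
      ; compat = λ {e} {e′} → compat′ e e′
      ; no-three = λ {e₁} {e₂} {e₃} → no-three′ e₁ e₂ e₃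
      ; twist = λ z → R.twist (zʷ z) + Lk.twist (z ∘ inj₁)
      ; low = low-cong expand (low-+
          (low-pull {B = (Lk.I ⊎ Letter 𝒜 → ℤ) × ℤ} (λ (z , c) → (zʷ z , zʷ-ι z) , c) R.low)
          (low-pull (λ (z , c) → z ∘ inj₁ , c + R.twist (zʷ z)) Lk.low))
      }
      where
      module R  = Reduction red
      module Lk = Link lk
      E : Set
      E = Letter 𝒜 ⊎ Letter 𝒞
      labels′ : E → α
      labels′ = Sum.[ label 𝒜 , label 𝒞 ]′
      idx : Letter 𝒜 → Fin (proj₁ (finite w))
      idx = Inverse.from (proj₂ (finite w))
      idx-injective : ∀ {A B} → idx A ≡ idx B → A ≡ B
      idx-injective {A} {B} p = trans (sym (Inverse.strictlyInverseˡ (proj₂ (finite w)) A))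
        (trans (cong (Inverse.to (proj₂ (finite w))) p) (Inverse.strictlyInverseˡ (proj₂ (finite w)) B))
      -- The name of an ι-orbit is its earlier member in the enumeration of the letters.
      canon : Letter 𝒜 → Letter 𝒜
      canon A with idx A Finₚ.≤? idx (R.ι A)
      ... | yes _ = A
      ... | no _  = R.ι A
      canon-either : ∀ A → canon A ≡ A ⊎ canon A ≡ R.ι A
      canon-either A with idx A Finₚ.≤? idx (R.ι A)
      ... | yes _ = inj₁ refl
      ... | no _  = inj₂ refl
      canon-≡ : ∀ A B → canon A ≡ canon B → B ≡ A ⊎ B ≡ R.ι A
      canon-≡ A B p with canon-either A | canon-either B
      ... | inj₁ a | inj₁ b = inj₁ (trans (sym b) (trans (sym p) a))
      ... | inj₁ a | inj₂ b = inj₂ (trans (sym (R.ι-involutive B)) (cong R.ι (trans (sym b) (trans (sym p) a))))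
      ... | inj₂ a | inj₁ b = inj₂ (trans (sym b) (trans (sym p) a))
      ... | inj₂ a | inj₂ b = inj₁ (trans (sym (R.ι-involutive B)) (trans (cong R.ι (trans (sym b) (trans (sym p) a))) (R.ι-involutive A)))
      canon-ι : ∀ A → canon (R.ι A) ≡ canon A
      canon-ι A with idx A Finₚ.≤? idx (R.ι A) | idx (R.ι A) Finₚ.≤? idx (R.ι (R.ι A))
      ... | yes p | yes q = idx-injective (Finₚ.≤-antisym (subst (λ B → idx (R.ι A) Fin.≤ idx B) (R.ι-involutive A) q) p)
      ... | yes _ | no _  = R.ι-involutive A
      ... | no _  | yes _ = refl
      ... | no p  | no q  = contradiction (subst (λ B → idx (R.ι A) Fin.≤ idx B) (sym (R.ι-involutive A))
                              (Sum.[ (λ x → contradiction x p) , id ]′ (Finₚ.≤-total (idx A) (idx (R.ι A))))) q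
      cls-kept : (A : Letter 𝒜) → (∃ λ B → R.kept B ≡ A) ⊎ (∀ B → R.kept B ≢ A) → Lk.I ⊎ Letter 𝒜
      cls-kept A (inj₁ (B , _)) = inj₁ (Lk.cls (inj₁ B))
      cls-kept A (inj₂ _)       = inj₂ (canon A)
      cls′ : E → Lk.I ⊎ Letter 𝒜
      cls′ (inj₁ A) = cls-kept A (R.split A)
      cls′ (inj₂ C) = inj₁ (Lk.cls (inj₂ C))
      emb : Letter ℬ ⊎ Letter 𝒞 → E
      emb = Sum.map₁ R.kept
      emb-label : ∀ e → labels′ (emb e) ∼ Lk.labels e
      emb-label (inj₁ B) = R.kept-label B
      emb-label (inj₂ C) = ∼-refl
      data View : E → Set where
        kept    : ∀ o → cls′ (emb o) ≡ inj₁ (Lk.cls o) → View (emb o)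
        removed : ∀ A → cls′ (inj₁ A) ≡ inj₂ (canon A) → View (inj₁ A)
      view-letter : ∀ A s → cls-kept A (R.split A) ≡ cls-kept A s → View (inj₁ A)
      view-letter _ (inj₁ (B , refl)) e = kept (inj₁ B) e
      view-letter A (inj₂ _)          e = removed A e
      view : ∀ e → View e
      view (inj₁ A) = view-letter A (R.split A) refl
      view (inj₂ C) = kept (inj₂ C) refl
      compat′ : ∀ e e′ → cls′ e ≡ cls′ e′ → labels′ e ∼ labels′ e′
      compat′ e e′ p with view e | view e′
      ... | kept o q | kept o′ q′ = ∼-trans (emb-label o)
              (∼-trans (Lk.compat (Sumₚ.inj₁-injective (trans (sym q) (trans p q′)))) (∼-sym (emb-label o′)))
      ... | kept o q | removed A q′ = case-absurd (trans (sym q) (trans p q′))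
        where
        case-absurd : ∀ {x y} → inj₁ x ≡ inj₂ y → labels′ (emb o) ∼ label 𝒜 A
        case-absurd ()
      ... | removed A q | kept o q′ = case-absurd (trans (sym q) (trans p q′))
        where
        case-absurd : ∀ {x y} → inj₂ x ≡ inj₁ y → label 𝒜 A ∼ labels′ (emb o)
        case-absurd ()
      ... | removed A q | removed B q′ with canon-≡ A B (Sumₚ.inj₂-injective (trans (sym q) (trans p q′)))
      ...   | inj₁ refl = ∼-refl
      ...   | inj₂ refl = ∼-sym (R.ι-label A)
      no-three′ : ∀ e₁ e₂ e₃ → e₁ ≢ e₂ → e₁ ≢ e₃ → e₂ ≢ e₃ → cls′ e₁ ≡ cls′ e₂ → cls′ e₁ ≡ cls′ e₃ → ⊥
      no-three′ e₁ e₂ e₃ n₁₂ n₁₃ n₂₃ p₁₂ p₁₃ with view e₁ | view e₂ | view e₃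
      ... | kept o₁ q₁ | kept o₂ q₂ | kept o₃ q₃ = Lk.no-three (n₁₂ ∘ cong emb) (n₁₃ ∘ cong emb) (n₂₃ ∘ cong emb)
              (Sumₚ.inj₁-injective (trans (sym q₁) (trans p₁₂ q₂))) (Sumₚ.inj₁-injective (trans (sym q₁) (trans p₁₃ q₃)))
      ... | kept o₁ q₁ | removed A q₂ | _ with () ← trans (sym q₁) (trans p₁₂ q₂)
      ... | kept o₁ q₁ | kept _ _ | removed A q₃ with () ← trans (sym q₁) (trans p₁₃ q₃)
      ... | removed A q₁ | kept o₂ q₂ | _ with () ← trans (sym q₁) (trans p₁₂ q₂)
      ... | removed A q₁ | removed _ _ | kept o₃ q₃ with () ← trans (sym q₁) (trans p₁₃ q₃)
      ... | removed A q₁ | removed B q₂ | removed C q₃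
              with canon-≡ A B (Sumₚ.inj₂-injective (trans (sym q₁) (trans p₁₂ q₂)))
                 | canon-≡ A C (Sumₚ.inj₂-injective (trans (sym q₁) (trans p₁₃ q₃)))
      ...     | inj₁ refl | _         = n₁₂ refl
      ...     | inj₂ _    | inj₁ refl = n₁₃ refl
      ...     | inj₂ refl | inj₂ refl = n₂₃ refl
      zʷ : (Lk.I ⊎ Letter 𝒜 → ℤ) → Letter 𝒜 → ℤ
      zʷ z A = z (cls′ (inj₁ A))
      zʷ-ι : ∀ z A → zʷ z (R.ι A) ≡ zʷ z A
      zʷ-ι z A = cong z (go (R.split A) refl (R.split (R.ι A)) refl)
        where
        go : ∀ s → R.split A ≡ s → ∀ s′ → R.split (R.ι A) ≡ s′ → cls-kept (R.ι A) (R.split (R.ι A)) ≡ cls-kept A (R.split A)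
        go (inj₁ (B , refl)) _ _ _ = cong (cls′ ∘ inj₁) (R.ι-kept B)
        go (inj₂ out) e (inj₁ (B , p)) e′ = contradiction
          (trans (sym (R.ι-kept B)) (trans (cong R.ι p) (R.ι-involutive A))) (out B)
        go (inj₂ out) e (inj₂ out′) e′ = trans (cong (cls-kept (R.ι A)) e′) (trans (cong inj₂ (canon-ι A)) (sym (cong (cls-kept A) e)))
      zʷ-kept : ∀ z B → zʷ z (R.kept B) ≡ z (inj₁ (Lk.cls (inj₁ B)))
      zʷ-kept z B = cong z (go (R.split (R.kept B)) refl)
        where
        go : ∀ s → R.split (R.kept B) ≡ s → cls-kept (R.kept B) (R.split (R.kept B)) ≡ inj₁ (Lk.cls (inj₁ B))
        go (inj₁ (B′ , p)) e = trans (cong (cls-kept (R.kept B)) e) (cong (inj₁ ∘ Lk.cls ∘ inj₁) (R.kept-injective p))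
        go (inj₂ out)      e = contradiction refl (out B)
      expand : ∀ ((z , c) (z′ , c′) : (Lk.I ⊎ Letter 𝒜 → ℤ) × ℤ) →
        let t = R.twist (zʷ z) ; t′ = R.twist (zʷ z′) in
        2ℤ * (formʷ w (z ∘ cls′ ∘ inj₁) c (z′ ∘ cls′ ∘ inj₁) c′
             - formʷ v (z ∘ cls′ ∘ inj₂) (c + (t + Lk.twist (z ∘ inj₁))) (z′ ∘ cls′ ∘ inj₂) (c′ + (t′ + Lk.twist (z′ ∘ inj₁))))
        ≡ 2ℤ * (formʷ w (zʷ z) c (zʷ z′) c′ - formʷ u (zʷ z ∘ R.kept) (c + t) (zʷ z′ ∘ R.kept) (c′ + t′))
          + 2ℤ * (formʷ u (z ∘ inj₁ ∘ Lk.cls ∘ inj₁) (c + t) (z′ ∘ inj₁ ∘ Lk.cls ∘ inj₁) (c′ + t′)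
                 - formʷ v (z ∘ inj₁ ∘ Lk.cls ∘ inj₂) (c + t + Lk.twist (z ∘ inj₁))
                           (z′ ∘ inj₁ ∘ Lk.cls ∘ inj₂) (c′ + t′ + Lk.twist (z′ ∘ inj₁)))
      expand (z , c) (z′ , c′) = begin
        2ℤ * (W - _)
          ≡⟨ cong (λ y → 2ℤ * (W - y)) (formʷ-cong v (λ _ → refl) (sym (ℤₚ.+-assoc c _ _)) (λ _ → refl) (sym (ℤₚ.+-assoc c′ _ _))) ⟩
        2ℤ * (W - V)
          ≡⟨ telescope W U V ⟩
        2ℤ * (W - U) + 2ℤ * (U - V)
          ≡⟨ cong (λ y → 2ℤ * (W - U) + 2ℤ * (y - V)) (formʷ-cong u (zʷ-kept z) refl (zʷ-kept z′) refl) ⟩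
        _ ∎
        where
        open ≡-Reasoning
        t t′ W U V : ℤ
        t = R.twist (zʷ z)
        t′ = R.twist (zʷ z′)
        W = formʷ w (zʷ z) c (zʷ z′) c′
        U = formʷ u (zʷ z ∘ R.kept) (c + t) (zʷ z′ ∘ R.kept) (c′ + t′)
        V = formʷ v (z ∘ inj₁ ∘ Lk.cls ∘ inj₂) (c + t + Lk.twist (z ∘ inj₁))
                    (z′ ∘ inj₁ ∘ Lk.cls ∘ inj₂) (c′ + t′ + Lk.twist (z′ ∘ inj₁))

-- Reductions of isomorphisms, homotopy moves and shifts.

module ElementaryReductions {a} (α : Set a) (τ : α → α) (τ-involutive : Involutive _≡_ τ)
                  (φ : Nanowords.Π α τ τ-involutive → ℤ) (φ-additive : Nanowords.IsAdditive α τ τ-involutive φ)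
                  (φ-unit : ∀ x → φ (Nanowords.gen x) ≡ 1ℤ ⊎ φ (Nanowords.gen x) ≡ -1ℤ) where

  open Nanowords α τ τ-involutive
  open NanowordForms α τ τ-involutive φ φ-additive φ-unit
  open Cobordisms α τ τ-involutive φ φ-additive φ-unit
  open Alphabet
  open NanowordOver using (word; twice)
  open FiniteSums using (2ℤ)
  open LowRank
  open Conditionals
  open import Data.Integer.Base using (_+_; _*_; -_; _-_)

  -- Values ±1 of φ are never their own negatives. This separates the letters A and B of the second
  -- homotopy move.
  ψ-≢-τ : ∀ x → x ≢ τ x
  ψ-≢-τ x x≡τx with φ-unit x
  ... | inj₁ e = contradiction (trans (sym e) (trans (cong ψ x≡τx) (trans (ψ-τ x) (cong -_ e)))) λ ()
  ... | inj₂ e = contradiction (trans (sym e) (trans (cong ψ x≡τx) (trans (ψ-τ x) (cong -_ e)))) λ ()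

  Occurrences : {𝒜 : Alphabet} → Set
  Occurrences {𝒜} = List (Letter 𝒜 × ℤ)

  module _ {𝒜 ℬ : Alphabet} (w : NanowordOver 𝒜) (u : NanowordOver ℬ)
           (kept : Letter ℬ → Letter 𝒜) (kept-injective : ∀ {A B} → kept A ≡ kept B → A ≡ B) where

    private
      module W = ChargedWords (letters≟ w)
      renamed : Occurrences {𝒜}
      renamed = List.map (ChargedRenaming.rename (letters≟ w) (letters≟ u) kept) (charged u)

    form-kept : ∀ z c z′ c′ → W.form renamed z c z′ c′ ≡ formʷ u (z ∘ kept) c (z′ ∘ kept) c′
    form-kept = ChargedRenaming.form-rename (letters≟ w) (letters≟ u) kept kept-injective (charged u)

    charged-kept : (∀ B → label 𝒜 (kept B) ≡ label ℬ B) →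
      Charging.charges (letters≟ w) (chargeOf w) [] (List.map kept (word u)) ≡ renamed
    charged-kept kept-label = ChargeRenaming.charges-rename (letters≟ w) (letters≟ u) (chargeOf w) (chargeOf u)
      kept kept-injective [] (word u) λ {B} _ → cong ψ (kept-label B)

    -- The common frame for moves that preserve the form exactly and need no multiple of `s`.
    -- Preservation is asked for on ι-invariant functions only, as the second move requires.
    exact-reduction :
      (∀ B → label 𝒜 (kept B) ≡ label ℬ B) →
      (ι : Letter 𝒜 → Letter 𝒜) → Involutive _≡_ ι → (∀ A → label 𝒜 (ι A) ∼ label 𝒜 A) → (∀ B → ι (kept B) ≡ kept B) →
      (∀ A → (∃ λ B → kept B ≡ A) ⊎ (∀ B → kept B ≢ A)) →
      (∀ z c z′ c′ → (∀ A → z (ι A) ≡ z A) → (∀ A → z′ (ι A) ≡ z′ A) → formʷ w z c z′ c′ ≡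
        W.form (Charging.charges (letters≟ w) (chargeOf w) [] (List.map kept (word u))) z c z′ c′) →
      Reduction 0 w u
    exact-reduction kept-label ι ι-inv ι-label ι-kept split same = record
      { kept = kept ; kept-injective = kept-injective ; kept-label = inj₁ ∘ kept-label ; ι = ι ; ι-involutive = ι-inv
      ; ι-label = ι-label ; ι-kept = ι-kept ; split = split ; twist = λ _ → 0ℤ
      ; low = low-zero λ ((z , z-ι) , c) ((z′ , z′-ι) , c′) → trans
          (cong₂ (λ x y → 2ℤ * (x - y))
            (trans (same z c z′ c′ z-ι z′-ι) (trans (cong (λ s → W.form s z c z′ c′) (charged-kept kept-label)) (form-kept z c z′ c′)))
            (formʷ-cong u (λ _ → refl) (ℤₚ.+-identityʳ c) (λ _ → refl) (ℤₚ.+-identityʳ c′)))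
          (cancel (formʷ u (z ∘ kept) c (z′ ∘ kept) c′)) }
      where
      cancel : ∀ x → 2ℤ * (x - x) ≡ 0ℤ
      cancel = solve-∀

  reduction-isomorphism : ∀ {𝒜 𝒜′} {w : NanowordOver 𝒜} {w′ : NanowordOver 𝒜′} (f : Letter 𝒜 ↔ Letter 𝒜′) →
    (∀ A → label 𝒜′ (Inverse.to f A) ≡ label 𝒜 A) → word w′ ≡ List.map (Inverse.to f) (word w) → Reduction 0 w w′
  reduction-isomorphism {𝒜} {𝒜′} {w} {w′} f f-label eq = exact-reduction w w′ from
    (λ {A} {B} e → trans (sym (strictlyInverseˡ A)) (trans (cong to e) (strictlyInverseˡ B)))
    (λ B → trans (sym (f-label (from B))) (cong (label 𝒜′) (strictlyInverseˡ B)))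
    id (λ _ → refl) (λ _ → ∼-refl) (λ _ → refl) (λ A → inj₁ (to A , strictlyInverseʳ A))
    (λ z c z′ c′ _ _ → cong (λ v → ChargedWords.form (letters≟ w) (Charging.charges (letters≟ w) (chargeOf w) [] v) z c z′ c′)
      (sym (trans (cong (List.map from) eq) (trans (sym (Listₚ.map-∘ (word w)))
        (trans (Listₚ.map-cong strictlyInverseʳ (word w)) (Listₚ.map-id (word w)))))))
    where open Inverse f

  module _ {L : Set} {P : L → Set} where

    irrelevant-absurd : ∀ {A} → Irrelevant (P A) → Irrelevant (¬ P A) → ⊥
    irrelevant-absurd {A} [ p ] [ ¬p ] = ⊥-elim-irr (¬p p)

    removed-∉ : (x : List (Refinement L (λ A → ¬ P A))) → ∀ {A} → P A → A ∉ ⟪ x ⟫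
    removed-∉ x {A} PA A∈ with ∈ₚ.∈-map⁻ value A∈
    ... | B , _ , refl = irrelevant-absurd [ PA ] (proof B)

    split-removed : (∀ A → Irrelevant (P A) ⊎ Irrelevant (¬ P A)) → ∀ A →
      (∃ λ (B : Refinement L (λ A → ¬ P A)) → value B ≡ A) ⊎ (∀ (B : Refinement L (λ A → ¬ P A)) → value B ≢ A)
    split-removed P? A with P? A
    ... | inj₁ PA = inj₂ λ { B refl → irrelevant-absurd PA (proof B) }
    ... | inj₂ ¬PA = inj₁ (record { value = A ; proof = ¬PA } , refl)

    irrelevant-dec : (∀ A → Dec (P A)) → ∀ A → Irrelevant (P A) ⊎ Irrelevant (¬ P A)
    irrelevant-dec P? A with P? A
    ... | yes p = inj₁ [ p ]
    ... | no ¬p = inj₂ [ ¬p ]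

  all-∉ : {L : Set} {ls x : List L} → (∀ {A} → A ∈ ls → A ∉ x) → All (_∉ ls) x
  all-∉ new = All.tabulate λ A∈x A∈ls → new A∈ls A∈x

  reduction-homotopy₁ : ∀ {𝒜 A} {w : NanowordOver 𝒜} {w′ : NanowordOver (𝒜 ∖ ｛ A ｝)} x y →
    word w ≡ ⟪ x ⟫ ++ A ∷ A ∷ ⟪ y ⟫ → word w′ ≡ x ++ y → Reduction 0 w w′
  reduction-homotopy₁ {𝒜} {A} {w} {w′} x y eq eq′ = exact-reduction w w′ value value-injective
    (λ _ → refl) id (λ _ → refl) (λ _ → ∼-refl) (λ _ → refl)
    (split-removed (irrelevant-dec (letters≟ w A)))
    λ z c z′ c′ _ _ → begin
      formʷ w z c z′ c′
        ≡⟨ cong (λ s → W.form s z c z′ c′) (trans (cong (charges []) eq) (charges-homotopy₁ A∉x A∉y)) ⟩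
      W.form (charges ⟪ y ⟫ ⟪ x ⟫ ++ (A , chargeOf w A) ∷ (A , - chargeOf w A) ∷ charges [] ⟪ y ⟫) z c z′ c′
        ≡⟨ form-homotopy₁ A (chargeOf w A) (charges-letters (all-∉ λ { (here refl) → A∉x }))
             (charges-letters (all-∉ λ { (here refl) → A∉y })) z c z′ c′ ⟩
      W.form (charges ⟪ y ⟫ ⟪ x ⟫ ++ charges [] ⟪ y ⟫) z c z′ c′
        ≡⟨ cong (λ s → W.form s z c z′ c′) (sym (trans
             (cong (charges []) (trans (cong (List.map value) eq′) (Listₚ.map-++ value x y)))
             (trans (charges-++ [] ⟪ x ⟫ ⟪ y ⟫) (cong (λ r → charges r ⟪ x ⟫ ++ charges [] ⟪ y ⟫) (Listₚ.++-identityʳ ⟪ y ⟫))))) ⟩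
      W.form (charges [] (List.map value (word w′))) z c z′ c′ ∎
    where
    open ≡-Reasoning
    module W = ChargedWords (letters≟ w)
    open Charging (letters≟ w) (chargeOf w)
    open ChargedHomotopy (letters≟ w)
    A∉x : A ∉ ⟪ x ⟫
    A∉x = removed-∉ {P = ｛ A ｝} x refl
    A∉y : A ∉ ⟪ y ⟫
    A∉y = removed-∉ {P = ｛ A ｝} y refl

  module _ {L : Set} (_≟_ : DecidableEquality L) (A B : L) where

    swap : L → L
    swap C with C ≟ A | C ≟ B
    ... | yes _ | _     = B
    ... | no _  | yes _ = A
    ... | no _  | no _  = C

    swap-A : swap A ≡ B
    swap-A with A ≟ A | A ≟ B
    ... | yes _ | _ = refl
    ... | no ≢  | _ = contradiction refl ≢

    swap-B : swap B ≡ A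
    swap-B with B ≟ A | B ≟ B
    ... | yes p | _     = p
    ... | no _  | yes _ = refl
    ... | no _  | no ≢  = contradiction refl ≢

    swap-other : ∀ {C} → C ≢ A → C ≢ B → swap C ≡ C
    swap-other {C} C≢A C≢B with C ≟ A | C ≟ B
    ... | yes p | _     = contradiction p C≢A
    ... | no _  | yes p = contradiction p C≢B
    ... | no _  | no _  = refl

    swap-cases : ∀ {ℓ} (Q : L → L → Set ℓ) → Q A B → Q B A → (∀ {C} → C ≢ A → C ≢ B → Q C C) → ∀ C → Q C (swap C)
    swap-cases Q qA qB q C with C ≟ A | C ≟ B
    ... | yes refl | _        = qA
    ... | no _     | yes refl = qB
    ... | no C≢A   | no C≢B   = q C≢A C≢B

    swap-involutive : Involutive _≡_ swap
    swap-involutive = swap-cases (λ C D → swap D ≡ C) swap-B swap-A swap-other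

  -- Here `ι` exchanges the two removed letters, so invariance supplies z(A) = z(B), and |B| =
  -- τ(|A|) makes their charges opposite.
  reduction-homotopy₂ : ∀ {𝒜 A B} {w : NanowordOver 𝒜} {w′ : NanowordOver (𝒜 ∖ (｛ A ｝ ∪ ｛ B ｝))} x y z →
    label 𝒜 B ≡ τ (label 𝒜 A) → word w ≡ ⟪ x ⟫ ++ A ∷ B ∷ ⟪ y ⟫ ++ B ∷ A ∷ ⟪ z ⟫ → word w′ ≡ x ++ y ++ z →
    Reduction 0 w w′
  reduction-homotopy₂ {𝒜} {A} {B} {w} {w′} x y z B~A eq eq′ = exact-reduction w w′ value value-injective
    (λ _ → refl) ι (swap-involutive _≟_ A B)
    (swap-cases _≟_ A B (λ C D → label 𝒜 D ∼ label 𝒜 C) (inj₂ B~A) (∼-sym (inj₂ B~A)) (λ _ _ → ∼-refl))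
    (λ C → swap-other _≟_ A B (λ { refl → irrelevant-absurd {P = ｛ A ｝ ∪ ｛ B ｝} [ inj₁ refl ] (proof C) })
                              (λ { refl → irrelevant-absurd {P = ｛ A ｝ ∪ ｛ B ｝} [ inj₂ refl ] (proof C) }))
    (split-removed (irrelevant-dec λ C → (A ≟ C) ⊎-dec (B ≟ C)))
    λ f c f′ c′ f-ι f′-ι → begin
      formʷ w f c f′ c′
        ≡⟨ cong (λ s → W.form s f c f′ c′) charges-w ⟩
      W.form (charges (⟪ y ⟫ ++ ⟪ z ⟫) ⟪ x ⟫ ++ (A , q) ∷ (B , - q) ∷ charges ⟪ z ⟫ ⟪ y ⟫ ++ (B , - - q) ∷ (A , - q) ∷ charges [] ⟪ z ⟫) f c f′ c′
        ≡⟨ form-homotopy₂ A≢B q (charges-letters (all-∉ (new x))) (charges-letters (all-∉ (new y))) (charges-letters (all-∉ (new z)))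
             f c f′ c′ (A=B f f-ι) (A=B f′ f′-ι) ⟩
      W.form (charges (⟪ y ⟫ ++ ⟪ z ⟫) ⟪ x ⟫ ++ charges ⟪ z ⟫ ⟪ y ⟫ ++ charges [] ⟪ z ⟫) f c f′ c′
        ≡⟨ cong (λ s → W.form s f c f′ c′) (sym charges-w′) ⟩
      W.form (charges [] (List.map value (word w′))) f c f′ c′ ∎
    where
    open ≡-Reasoning
    _≟_ : DecidableEquality (Letter 𝒜)
    _≟_ = letters≟ w
    module W = ChargedWords _≟_
    open Charging _≟_ (chargeOf w)
    open ChargedHomotopy _≟_
    ι : Letter 𝒜 → Letter 𝒜
    ι = swap _≟_ A B
    q : ℤ
    q = chargeOf w A
    A≢B : A ≢ B
    A≢B refl = ψ-≢-τ (label 𝒜 A) B~A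
    new : (x : List (Letter (𝒜 ∖ (｛ A ｝ ∪ ｛ B ｝)))) → ∀ {C} → C ∈ A ∷ B ∷ [] → C ∉ ⟪ x ⟫
    new x (here refl)         = removed-∉ {P = ｛ A ｝ ∪ ｛ B ｝} x (inj₁ refl)
    new x (there (here refl)) = removed-∉ {P = ｛ A ｝ ∪ ｛ B ｝} x (inj₂ refl)
    A=B : ∀ f → (∀ C → f (ι C) ≡ f C) → f A ≡ f B
    A=B f f-ι = trans (sym (f-ι A)) (cong f (swap-A _≟_ A B))
    charge-B : chargeOf w B ≡ - q
    charge-B = trans (cong ψ B~A) (ψ-τ (label 𝒜 A))
    iA : A ∈ A ∷ B ∷ []
    iA = here refl
    iB : B ∈ A ∷ B ∷ []
    iB = there (here refl)
    charges-w : charged w ≡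
      charges (⟪ y ⟫ ++ ⟪ z ⟫) ⟪ x ⟫ ++ (A , q) ∷ (B , - q) ∷ charges ⟪ z ⟫ ⟪ y ⟫ ++ (B , - - q) ∷ (A , - q) ∷ charges [] ⟪ z ⟫
    charges-w = trans (cong (charges []) eq) (trans
      (charges-homotopy₂ A≢B (new x iA) (new y iA) (new z iA) (new x iB) (new y iB) (new z iB))
      (cong (λ p → charges (⟪ y ⟫ ++ ⟪ z ⟫) ⟪ x ⟫ ++ (A , q) ∷ (B , p) ∷ charges ⟪ z ⟫ ⟪ y ⟫ ++ (B , - p) ∷ (A , - q) ∷ charges [] ⟪ z ⟫) charge-B))
    charges-w′ : charges [] (List.map value (word w′)) ≡ charges (⟪ y ⟫ ++ ⟪ z ⟫) ⟪ x ⟫ ++ charges ⟪ z ⟫ ⟪ y ⟫ ++ charges [] ⟪ z ⟫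
    charges-w′ = trans
      (cong (charges []) (trans (cong (List.map value) eq′) (trans (Listₚ.map-++ value x (y ++ z)) (cong (⟪ x ⟫ ++_) (Listₚ.map-++ value y z)))))
      (trans (charges-++ [] ⟪ x ⟫ (⟪ y ⟫ ++ ⟪ z ⟫)) (cong₂ _++_ (cong (λ r → charges r ⟪ x ⟫) (Listₚ.++-identityʳ _))
        (trans (charges-++ [] ⟪ y ⟫ ⟪ z ⟫) (cong (λ r → charges r ⟪ y ⟫ ++ charges [] ⟪ z ⟫) (Listₚ.++-identityʳ ⟪ z ⟫)))))

  reduction-homotopy₃ : ∀ {𝒜 A B C} {w w′ : NanowordOver 𝒜} x y z t →
    A ≢ B → A ≢ C → B ≢ C → label 𝒜 A ≡ label 𝒜 B → label 𝒜 B ≡ label 𝒜 C →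
    word w  ≡ x ++ A ∷ B ∷ y ++ A ∷ C ∷ z ++ B ∷ C ∷ t → word w′ ≡ x ++ B ∷ A ∷ y ++ C ∷ A ∷ z ++ C ∷ B ∷ t →
    Reduction 0 w w′
  reduction-homotopy₃ {𝒜} {A} {B} {C} {w} {w′} x y z t A≢B A≢C B≢C A~B B~C eq eq′ =
    exact-reduction w w′ id id (λ _ → refl) id (λ _ → refl) (λ _ → ∼-refl) (λ _ → refl) (λ A → inj₁ (A , refl))
    λ f c f′ c′ _ _ → begin
      formʷ w f c f′ c′
        ≡⟨ cong (λ s → W.form s f c f′ c′) charges-w ⟩
      W.form _ f c f′ c′
        ≡⟨ form-homotopy₃ A≢B A≢C B≢C q (charges-letters (all-∉ (proj₁ ∘ new))) (charges-letters (all-∉ (proj₁ ∘ proj₂ ∘ new)))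
             (charges-letters (all-∉ (proj₁ ∘ proj₂ ∘ proj₂ ∘ new))) (charges-letters (all-∉ (proj₂ ∘ proj₂ ∘ proj₂ ∘ new))) f c f′ c′ ⟩
      W.form _ f c f′ c′
        ≡⟨ cong (λ s → W.form s f c f′ c′) (sym charges-w′) ⟩
      W.form (charges [] (List.map id (word w′))) f c f′ c′ ∎
    where
    open ≡-Reasoning
    _≟_ : DecidableEquality (Letter 𝒜)
    _≟_ = letters≟ w
    module W = ChargedWords _≟_
    open Charging _≟_ (chargeOf w)
    open ChargedHomotopy _≟_
    open Counting _≟_
    q : ℤ
    q = chargeOf w A
    charge-B : chargeOf w B ≡ q
    charge-B = cong ψ (sym A~B)
    charge-C : chargeOf w C ≡ q
    charge-C = cong ψ (sym (trans A~B B~C))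
    Absent : Letter 𝒜 → Set
    Absent D = (D ∉ x) × (D ∉ y) × (D ∉ z) × (D ∉ t)
    indicator : Letter 𝒜 → Letter 𝒜 → ℕ
    indicator D E = if does (D ≟ E) then 1 else 0
    -- Each of the three letters lies in two of the displayed pairs, which exhausts its two
    -- occurrences; the numbers of occurrences in the four remaining words therefore sum to zero.
    absent : ∀ {D} → indicator D A ℕ.+ indicator D B ℕ.+ indicator D C ≡ 1 → Absent D
    absent {D} one = count≡0⇒∉ x (ℕₚ.m+n≡0⇒m≡0 nx sum≡0) , count≡0⇒∉ y (ℕₚ.m+n≡0⇒m≡0 ny rest≡0)
                   , count≡0⇒∉ z (ℕₚ.m+n≡0⇒m≡0 nz rest′≡0) , count≡0⇒∉ t (ℕₚ.m+n≡0⇒n≡0 nz rest′≡0)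
      where
      i j k nx ny nz nt : ℕ
      i = indicator D A
      j = indicator D B
      k = indicator D C
      nx = count D x
      ny = count D y
      nz = count D z
      nt = count D t
      tally : count D (word w) ≡ nx ℕ.+ (i ℕ.+ (j ℕ.+ (ny ℕ.+ (i ℕ.+ (k ℕ.+ (nz ℕ.+ (j ℕ.+ (k ℕ.+ nt))))))))
      tally = trans (cong (count D) eq) (trans (count-++ D x _) (cong (λ m → nx ℕ.+ (i ℕ.+ (j ℕ.+ m)))
        (trans (count-++ D y _) (cong (λ m → ny ℕ.+ (i ℕ.+ (k ℕ.+ m))) (count-++ D z _)))))
      regroup : ∀ x y z t i j k → x ℕ.+ (i ℕ.+ (j ℕ.+ (y ℕ.+ (i ℕ.+ (k ℕ.+ (z ℕ.+ (j ℕ.+ (k ℕ.+ t)))))))) ≡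
                2 ℕ.* (i ℕ.+ j ℕ.+ k) ℕ.+ (x ℕ.+ (y ℕ.+ (z ℕ.+ t)))
      regroup = ℕ-RingSolver.solve-∀
      sum≡0 : nx ℕ.+ (ny ℕ.+ (nz ℕ.+ nt)) ≡ 0
      sum≡0 = ℕₚ.suc-injective (ℕₚ.suc-injective (trans
        (sym (trans (trans tally (regroup nx ny nz nt i j k)) (cong (λ m → 2 ℕ.* m ℕ.+ (nx ℕ.+ (ny ℕ.+ (nz ℕ.+ nt)))) one)))
        (count-twice (word w) (twice w D))))
      rest≡0 : ny ℕ.+ (nz ℕ.+ nt) ≡ 0
      rest≡0 = ℕₚ.m+n≡0⇒n≡0 nx sum≡0
      rest′≡0 : nz ℕ.+ nt ≡ 0
      rest′≡0 = ℕₚ.m+n≡0⇒n≡0 ny rest≡0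
    new : ∀ {D} → D ∈ A ∷ B ∷ C ∷ [] → Absent D
    new (here refl)                 = absent (cong₂ ℕ._+_ (cong₂ ℕ._+_ (if-yes (A ≟ A) refl) (if-no (A ≟ B) A≢B)) (if-no (A ≟ C) A≢C))
    new (there (here refl))         = absent (cong₂ ℕ._+_ (cong₂ ℕ._+_ (if-no (B ≟ A) (A≢B ∘ sym)) (if-yes (B ≟ B) refl)) (if-no (B ≟ C) B≢C))
    new (there (there (here refl))) = absent (cong₂ ℕ._+_ (cong₂ ℕ._+_ (if-no (C ≟ A) (A≢C ∘ sym)) (if-no (C ≟ B) (B≢C ∘ sym))) (if-yes (C ≟ C) refl))
    charges-w : charged w ≡ charges (y ++ z ++ t) x ++ (A , q) ∷ (B , q) ∷ charges (z ++ t) y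
      ++ (A , - q) ∷ (C , q) ∷ charges t z ++ (B , - q) ∷ (C , - q) ∷ charges [] t
    charges-w = trans (cong (charges []) eq) (trans (charges-homotopy₃ A≢B A≢C B≢C new)
      (cong₂ (λ p r → charges (y ++ z ++ t) x ++ (A , q) ∷ (B , p) ∷ charges (z ++ t) y
        ++ (A , - q) ∷ (C , r) ∷ charges t z ++ (B , - p) ∷ (C , - r) ∷ charges [] t) charge-B charge-C))
    charges-w′ : charges [] (List.map id (word w′)) ≡ charges (y ++ z ++ t) x ++ (B , q) ∷ (A , q) ∷ charges (z ++ t) y
      ++ (C , q) ∷ (A , - q) ∷ charges t z ++ (C , - q) ∷ (B , - q) ∷ charges [] t
    charges-w′ = trans (cong (charges []) (trans (Listₚ.map-id (word w′)) eq′)) (trans (charges-homotopy₃′ A≢B A≢C B≢C new)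
      (cong₂ (λ p r → charges (y ++ z ++ t) x ++ (B , p) ∷ (A , q) ∷ charges (z ++ t) y
        ++ (C , r) ∷ (A , - q) ∷ charges t z ++ (C , - r) ∷ (B , - p) ∷ charges [] t) charge-B charge-C))

  -- The new letter is identified with A. Its label τ(|A|) gives the charges `- q` and `q` to its
  -- left and right occurrences, so that each occurrence of A keeps its charge while the first one
  -- moves to the end. The twist is the jump at this occurrence, behind which the shifted word
  -- starts.
  reduction-shift : ∀ {𝒜 A} {w : NanowordOver 𝒜} {w′ : NanowordOver (shiftAlphabet 𝒜 A)} x y →
    word w ≡ A ∷ ⟪ x ⟫ ++ A ∷ ⟪ y ⟫ → word w′ ≡ List.map just x ++ nothing ∷ List.map just y ++ nothing ∷ [] →
    Reduction 0 w w′
  reduction-shift {𝒜} {A} {w} {w′} x y eq eq′ = record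
    { kept = kept ; kept-injective = λ {B} {C} → kept-injective B C ; kept-label = kept-label
    ; ι = id ; ι-involutive = λ _ → refl ; ι-label = λ _ → ∼-refl ; ι-kept = λ _ → refl ; split = split
    ; twist = λ z → 2ℤ * (q * z A)
    ; low = low-zero λ ((z , _) , c) ((z′ , _) , c′) → trans (cong (λ u → 2ℤ * (formʷ w z c z′ c′ - u)) (sym (same z c z′ c′)))
        (cancel (formʷ w z c z′ c′)) }
    where
    open ≡-Reasoning
    _≟_ : DecidableEquality (Letter 𝒜)
    _≟_ = letters≟ w
    module W = ChargedWords _≟_
    open Charging _≟_ (chargeOf w)
    open ChargedHomotopy _≟_
    module C′ = Charging (letters≟ w′) (chargeOf w′)
    q : ℤ
    q = chargeOf w A
    ℬ : Alphabet
    ℬ = shiftAlphabet 𝒜 A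
    cancel : ∀ x → 2ℤ * (x - x) ≡ 0ℤ
    cancel = solve-∀
    kept : Letter ℬ → Letter 𝒜
    kept nothing  = A
    kept (just B) = value B
    value≢A : (B : Letter (𝒜 ∖ ｛ A ｝)) → A ≢ value B
    value≢A B e = irrelevant-absurd {P = ｛ A ｝} [ e ] (proof B)
    kept-injective : ∀ B C → kept B ≡ kept C → B ≡ C
    kept-injective nothing  nothing  _ = refl
    kept-injective nothing  (just C) e = contradiction e (value≢A C)
    kept-injective (just B) nothing  e = contradiction (sym e) (value≢A B)
    kept-injective (just B) (just C) e = cong just (value-injective e)
    kept-label : ∀ B → label 𝒜 (kept B) ∼ label ℬ B
    kept-label nothing  = inj₂ (sym (τ-involutive (label 𝒜 A)))
    kept-label (just B) = inj₁ refl
    split : ∀ C → (∃ λ B → kept B ≡ C) ⊎ (∀ B → kept B ≢ C)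
    split C with A ≟ C
    ... | yes refl = inj₁ (nothing , refl)
    ... | no A≢C   = inj₁ (just record { value = C ; proof = [ A≢C ] } , refl)
    rename : List (Letter ℬ × ℤ) → List (Letter 𝒜 × ℤ)
    rename = List.map (ChargedRenaming.rename _≟_ (letters≟ w′) kept)
    A∉ : ∀ x → A ∉ ⟪ x ⟫
    A∉ x = removed-∉ {P = ｛ A ｝} x refl
    nothing∉ : (x : List (Letter (𝒜 ∖ ｛ A ｝))) → nothing ∉ List.map just x
    nothing∉ x n∈ with ∈ₚ.∈-map⁻ just n∈
    ... | _ , _ , ()
    rename-just : ∀ r x → rename (C′.charges (List.map just r) (List.map just x)) ≡ charges ⟪ r ⟫ ⟪ x ⟫
    rename-just r x = trans
      (sym (ChargeRenaming.charges-rename _≟_ (letters≟ w′) (chargeOf w) (chargeOf w′) kept (λ {B} {C} → kept-injective B C)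
        (List.map just r) (List.map just x) charge-just))
      (cong₂ charges (sym (Listₚ.map-∘ r)) (sym (Listₚ.map-∘ x)))
      where
      charge-just : ∀ {B} → B ∈ List.map just x → chargeOf w (kept B) ≡ chargeOf w′ B
      charge-just B∈ with ∈ₚ.∈-map⁻ just B∈
      ... | _ , _ , refl = refl
    charged-w : charged w ≡ (A , q) ∷ charges ⟪ y ⟫ ⟪ x ⟫ ++ (A , - q) ∷ charges [] ⟪ y ⟫
    charged-w = trans (cong (charges []) eq) (charges-shift (A∉ x) (A∉ y))
    charged-w′ : rename (charged w′) ≡ (charges ⟪ y ⟫ ⟪ x ⟫ ++ (A , - q) ∷ charges [] ⟪ y ⟫) ++ (A , q) ∷ []
    charged-w′ = begin
      rename (charged w′)
        ≡⟨ cong rename (trans (cong (C′.charges []) eq′) (C′.charges-shifted (nothing∉ x) (nothing∉ y))) ⟩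
      rename (C′.charges (List.map just y) (List.map just x) ++ (nothing , q′) ∷ C′.charges [] (List.map just y) ++ (nothing , - q′) ∷ [])
        ≡⟨ trans (Listₚ.map-++ _ (C′.charges (List.map just y) (List.map just x)) _)
             (cong₂ (λ s t → s ++ (A , q′) ∷ t) (rename-just y x)
               (trans (Listₚ.map-++ _ (C′.charges [] (List.map just y)) _) (cong (_++ (A , - q′) ∷ []) (rename-just [] y)))) ⟩
      charges ⟪ y ⟫ ⟪ x ⟫ ++ (A , q′) ∷ charges [] ⟪ y ⟫ ++ (A , - q′) ∷ []
        ≡⟨ cong₂ (λ p r → charges ⟪ y ⟫ ⟪ x ⟫ ++ (A , p) ∷ charges [] ⟪ y ⟫ ++ (A , r) ∷ []) (ψ-τ (label 𝒜 A))
             (trans (cong -_ (ψ-τ (label 𝒜 A))) (ℤₚ.neg-involutive q)) ⟩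
      charges ⟪ y ⟫ ⟪ x ⟫ ++ (A , - q) ∷ charges [] ⟪ y ⟫ ++ (A , q) ∷ []
        ≡⟨ Listₚ.++-assoc (charges ⟪ y ⟫ ⟪ x ⟫) ((A , - q) ∷ charges [] ⟪ y ⟫) ((A , q) ∷ []) ⟨
      (charges ⟪ y ⟫ ⟪ x ⟫ ++ (A , - q) ∷ charges [] ⟪ y ⟫) ++ (A , q) ∷ [] ∎
      where
      q′ : ℤ
      q′ = ψ (τ (label 𝒜 A))
    same : ∀ z c z′ c′ → formʷ w z c z′ c′ ≡
      formʷ w′ (z ∘ kept) (c + 2ℤ * (q * z A)) (z′ ∘ kept) (c′ + 2ℤ * (q * z′ A))
    same z c z′ c′ = begin
      formʷ w z c z′ c′
        ≡⟨ cong (λ s → W.form s z c z′ c′) charged-w ⟩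
      W.form ((A , q) ∷ U) z c z′ c′
        ≡⟨ form-rotate {A} {q} {U} z c z′ c′ (total-zero z) (total-zero z′) ⟩
      W.form (U ++ (A , q) ∷ []) z (c + 2ℤ * (q * z A)) z′ (c′ + 2ℤ * (q * z′ A))
        ≡⟨ cong (λ s → W.form s z (c + 2ℤ * (q * z A)) z′ (c′ + 2ℤ * (q * z′ A))) (sym charged-w′) ⟩
      W.form (rename (charged w′)) z (c + 2ℤ * (q * z A)) z′ (c′ + 2ℤ * (q * z′ A))
        ≡⟨ form-kept w w′ kept (λ {B} {C} → kept-injective B C) z _ z′ _ ⟩
      formʷ w′ (z ∘ kept) (c + 2ℤ * (q * z A)) (z′ ∘ kept) (c′ + 2ℤ * (q * z′ A)) ∎
      where
      U : List (Letter 𝒜 × ℤ)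
      U = charges ⟪ y ⟫ ⟪ x ⟫ ++ (A , - q) ∷ charges [] ⟪ y ⟫
      total-zero : ∀ z → W.total z ((A , q) ∷ U) ≡ 0ℤ
      total-zero z = trans (cong (W.total z) (sym charged-w)) (total-charged w z)

-- Words cut into segments and the order of their places.

module SegmentedWords where

  private
    variable
      A B : Set
      k : ℕ

  reverse-tabulate : ∀ {n} (f : Fin n → A) → reverse (tabulate f) ≡ tabulate (f ∘ opposite)
  reverse-tabulate f = sym (tabulate-opposite f)
    where
    open ≡-Reasoning
    tabulate-∷ʳ : ∀ {n} (g : Fin (suc n) → A) → tabulate g ≡ tabulate (g ∘ Fin.inject₁) ++ g (Fin.fromℕ n) ∷ []
    tabulate-∷ʳ {n = zero}  g = refl
    tabulate-∷ʳ {n = suc n} g = cong (g zero ∷_) (tabulate-∷ʳ (g ∘ suc))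
    tabulate-opposite : ∀ {n} (f : Fin n → A) → tabulate (f ∘ opposite) ≡ reverse (tabulate f)
    tabulate-opposite {n = zero}  f = refl
    tabulate-opposite {n = suc n} f = begin
      tabulate (f ∘ opposite)
        ≡⟨ tabulate-∷ʳ (f ∘ opposite) ⟩
      tabulate (f ∘ opposite ∘ Fin.inject₁) ++ f (opposite (Fin.fromℕ n)) ∷ []
        ≡⟨ cong₂ (λ xs i → xs ++ f i ∷ [])
             (trans (Listₚ.tabulate-cong λ i → cong f (opposite-inject₁ i)) (tabulate-opposite (f ∘ suc))) (opposite-fromℕ n) ⟩
      reverse (tabulate (f ∘ suc)) ++ f zero ∷ []
        ≡⟨ Listₚ.unfold-reverse (f zero) (tabulate (f ∘ suc)) ⟨
      reverse (tabulate f) ∎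
      where
      opposite-fromℕ : ∀ n → opposite (Fin.fromℕ n) ≡ zero
      opposite-fromℕ zero    = refl
      opposite-fromℕ (suc n) = cong Fin.inject₁ (opposite-fromℕ n)
      opposite-inject₁ : ∀ {n} (i : Fin n) → opposite (Fin.inject₁ i) ≡ suc (opposite i)
      opposite-inject₁ zero    = refl
      opposite-inject₁ (suc i) = cong Fin.inject₁ (opposite-inject₁ i)

  tabulate-reversed : ∀ {m n} .(eq : m ≡ n) (f : Fin m → A) (g : Fin n → A) →
    (∀ j → g (opposite (cast eq j)) ≡ f j) → tabulate g ≡ reverse (tabulate f)
  tabulate-reversed {m = m} {n} eq f g h with recompute (m ℕₚ.≟ n) eq
  ... | refl = trans (Listₚ.tabulate-cong λ j →
    trans (cong g (sym (Finₚ.opposite-involutive j)))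
      (trans (cong (g ∘ opposite) (sym (Finₚ.cast-is-id eq (opposite j)))) (h (opposite j)))) (sym (reverse-tabulate f))

  reversed-lookup : ∀ (f : A → B) xs (ys : List B) .(eq : length xs ≡ length ys) → List.map f xs ≡ reverse ys →
    ∀ j → List.lookup ys (opposite (cast eq j)) ≡ f (List.lookup xs j)
  reversed-lookup f xs ys eq e = go (length xs) (length ys) eq (f ∘ List.lookup xs) (List.lookup ys) (begin
    tabulate (f ∘ List.lookup xs)          ≡⟨ Listₚ.map-tabulate (List.lookup xs) f ⟨
    List.map f (tabulate (List.lookup xs)) ≡⟨ cong (List.map f) (Listₚ.tabulate-lookup xs) ⟩
    List.map f xs                          ≡⟨ e ⟩
    reverse ys                             ≡⟨ cong reverse (Listₚ.tabulate-lookup ys) ⟨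
    reverse (tabulate (List.lookup ys))    ≡⟨ reverse-tabulate (List.lookup ys) ⟩
    tabulate (List.lookup ys ∘ opposite)   ∎)
    where
    open ≡-Reasoning
    tabulate-injective : ∀ {n} (g h : Fin n → B) → tabulate g ≡ tabulate h → g ≗ h
    tabulate-injective g h e zero    = Listₚ.∷-injectiveˡ e
    tabulate-injective g h e (suc i) = tabulate-injective (g ∘ suc) (h ∘ suc) (Listₚ.∷-injectiveʳ e) i
    go : ∀ m n .(eq : m ≡ n) (g : Fin m → B) (h : Fin n → B) → tabulate g ≡ tabulate (h ∘ opposite) →
         ∀ j → h (opposite (cast eq j)) ≡ g j
    go m n eq g h e j with recompute (m ℕₚ.≟ n) eq
    ... | refl = trans (cong (h ∘ opposite) (Finₚ.cast-is-id eq j)) (sym (tabulate-injective g (h ∘ opposite) e j))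

  map-fixed : (f : A → A) → ∀ xs → List.map f xs ≡ xs → ∀ {x} → x ∈ xs → f x ≡ x
  map-fixed f (x ∷ xs) e (here refl) = Listₚ.∷-injectiveˡ e
  map-fixed f (x ∷ xs) e (there x∈)  = map-fixed f xs (Listₚ.∷-injectiveʳ e) x∈

  Place : Vec (List A) k → Set
  Place {k = k} v = Σ (Fin k) λ r → Fin (length (Vec.lookup v r))

  at : (v : Vec (List A) k) → Place v → A
  at v (r , j) = List.lookup (Vec.lookup v r) j

  _⊢_⊏_ : (v : Vec (List A) k) → Place v → Place v → Set
  v ⊢ (r , j) ⊏ (r′ , j′) = r Fin.< r′ ⊎ (r ≡ r′ × toℕ j ℕ.< toℕ j′)

  ⊏-cmp : (v : Vec (List A) k) (o o′ : Place v) → v ⊢ o ⊏ o′ ⊎ o ≡ o′ ⊎ v ⊢ o′ ⊏ o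
  ⊏-cmp v (r , j) (r′ , j′) with Finₚ.<-cmp r r′
  ... | tri< r<r′ _ _ = inj₁ (inj₁ r<r′)
  ... | tri> _ _ r′<r = inj₂ (inj₂ (inj₁ r′<r))
  ... | tri≈ _ refl _ with Finₚ.<-cmp j j′
  ...   | tri< j<j′ _ _ = inj₁ (inj₂ (refl , j<j′))
  ...   | tri≈ _ refl _ = inj₂ (inj₁ refl)
  ...   | tri> _ _ j′<j = inj₂ (inj₂ (inj₂ (refl , j′<j)))

  module _ {A : Set} where

    inˡ : (u w : List A) → Fin (length u) → Fin (length (u ++ w))
    inˡ (x ∷ u) w zero    = zero
    inˡ (x ∷ u) w (suc i) = suc (inˡ u w i)

    inʳ : (u w : List A) → Fin (length w) → Fin (length (u ++ w))
    inʳ []      w i = i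
    inʳ (x ∷ u) w i = suc (inʳ u w i)

    lookup-inˡ : ∀ u w i → List.lookup (u ++ w) (inˡ u w i) ≡ List.lookup u i
    lookup-inˡ (x ∷ u) w zero    = refl
    lookup-inˡ (x ∷ u) w (suc i) = lookup-inˡ u w i

    lookup-inʳ : ∀ u w i → List.lookup (u ++ w) (inʳ u w i) ≡ List.lookup w i
    lookup-inʳ []      w i = refl
    lookup-inʳ (x ∷ u) w i = lookup-inʳ u w i

    inˡ-< : ∀ u w {i j} → toℕ i ℕ.< toℕ j → inˡ u w i Fin.< inˡ u w j
    inˡ-< (x ∷ u) w {zero}  {suc j} _         = ℕ.z<s
    inˡ-< (x ∷ u) w {suc i} {suc j} (ℕ.s≤s p) = ℕ.s<s (inˡ-< u w p)

    inʳ-< : ∀ u w {i j} → i Fin.< j → inʳ u w i Fin.< inʳ u w j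
    inʳ-< []      w p = p
    inʳ-< (x ∷ u) w p = ℕ.s<s (inʳ-< u w p)

    inˡ<inʳ : ∀ u w i j → inˡ u w i Fin.< inʳ u w j
    inˡ<inʳ (x ∷ u) w zero    j = ℕ.z<s
    inˡ<inʳ (x ∷ u) w (suc i) j = ℕ.s<s (inˡ<inʳ u w i j)

    split-++ : ∀ u w (i : Fin (length (u ++ w))) → (∃ λ j → inˡ u w j ≡ i) ⊎ (∃ λ j → inʳ u w j ≡ i)
    split-++ []      w i    = inj₂ (i , refl)
    split-++ (x ∷ u) w zero = inj₁ (zero , refl)
    split-++ (x ∷ u) w (suc i) with split-++ u w i
    ... | inj₁ (j , refl) = inj₁ (suc j , refl)
    ... | inj₂ (j , refl) = inj₂ (j , refl)

    flat : Vec (List A) k → List A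
    flat v = concat (Vec.toList v)

    position : (v : Vec (List A) k) → Place v → Fin (length (flat v))
    position (u ∷ v) (zero , j)  = inˡ u (flat v) j
    position (u ∷ v) (suc r , j) = inʳ u (flat v) (position v (r , j))

    lookup-position : (v : Vec (List A) k) (o : Place v) → List.lookup (flat v) (position v o) ≡ at v o
    lookup-position (u ∷ v) (zero , j)  = lookup-inˡ u (flat v) j
    lookup-position (u ∷ v) (suc r , j) = trans (lookup-inʳ u (flat v) _) (lookup-position v (r , j))

    position-< : (v : Vec (List A) k) {o o′ : Place v} → v ⊢ o ⊏ o′ → position v o Fin.< position v o′
    position-< (u ∷ v) {zero , j}  {suc r′ , j′} (inj₁ _)           = inˡ<inʳ u (flat v) j _
    position-< (u ∷ v) {suc r , j} {suc r′ , j′} (inj₁ (ℕ.s≤s r<))  = inʳ-< u (flat v) (position-< v (inj₁ r<))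
    position-< (u ∷ v) {zero , j}  {zero , j′}   (inj₂ (refl , j<)) = inˡ-< u (flat v) j<
    position-< (u ∷ v) {suc r , j} {suc r , j′}  (inj₂ (refl , j<)) = inʳ-< u (flat v) (position-< v (inj₂ (refl , j<)))

    position-surjective : (v : Vec (List A) k) (i : Fin (length (flat v))) → ∃ λ o → position v o ≡ i
    position-surjective (u ∷ v) i with split-++ u (flat v) i
    ... | inj₁ (j , e)    = (zero , j) , e
    ... | inj₂ (i′ , e) with position-surjective v i′
    ...   | (r , j) , refl = (suc r , j) , e

    later : Vec (List A) k → Fin k → List A
    later (u ∷ v) zero    = flat v
    later (u ∷ v) (suc r) = later v r

    ∈-flat⁺ : (v : Vec (List A) k) {x : A} (r : Fin k) → x ∈ Vec.lookup v r → x ∈ flat v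
    ∈-flat⁺ (u ∷ v) zero    x∈ = ∈ₚ.∈-++⁺ˡ x∈
    ∈-flat⁺ (u ∷ v) (suc r) x∈ = ∈ₚ.∈-++⁺ʳ u (∈-flat⁺ v r x∈)

    ∈-flat⁻ : (v : Vec (List A) k) {x : A} → x ∈ flat v → ∃ λ r → x ∈ Vec.lookup v r
    ∈-flat⁻ (u ∷ v) x∈ with ∈ₚ.∈-++⁻ u x∈
    ... | inj₁ x∈u = zero , x∈u
    ... | inj₂ x∈v with ∈-flat⁻ v x∈v
    ...   | r , x∈r = suc r , x∈r

    ∈-later⁺ : (v : Vec (List A) k) {x : A} {r r′ : Fin k} → r Fin.< r′ → x ∈ Vec.lookup v r′ → x ∈ later v r
    ∈-later⁺ (u ∷ v) {r = zero}  {suc r′} _         x∈ = ∈-flat⁺ v r′ x∈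
    ∈-later⁺ (u ∷ v) {r = suc r} {suc r′} (ℕ.s≤s p) x∈ = ∈-later⁺ v p x∈

    ∈-later⁻ : (v : Vec (List A) k) {x : A} (r : Fin k) → x ∈ later v r → ∃ λ r′ → r Fin.< r′ × x ∈ Vec.lookup v r′
    ∈-later⁻ (u ∷ v) zero x∈ with ∈-flat⁻ v x∈
    ... | r′ , x∈r′ = suc r′ , ℕ.z<s , x∈r′
    ∈-later⁻ (u ∷ v) (suc r) x∈ with ∈-later⁻ v r x∈
    ... | r′ , r<r′ , x∈r′ = suc r′ , ℕ.s<s r<r′ , x∈r′

    record TwoPlaces (v : Vec (List A) k) (x : A) : Set where
      field
        first second : Place v
        at-first     : at v first ≡ x
        at-second    : at v second ≡ x
        first⊏second : v ⊢ first ⊏ second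
        only-two     : ∀ o → at v o ≡ x → o ≡ first ⊎ o ≡ second

    ⊏-irrefl : (v : Vec (List A) k) {o : Place v} → v ⊢ o ⊏ o → ⊥
    ⊏-irrefl v p = Finₚ.<-irrefl refl (position-< v p)

    ⊏-asym : (v : Vec (List A) k) {o o′ : Place v} → v ⊢ o ⊏ o′ → v ⊢ o′ ⊏ o → ⊥
    ⊏-asym v p q = Finₚ.<-asym (position-< v p) (position-< v q)

    -- Carries the two positions in the concatenation over to places in segments with their
    -- lexicographic order, in which `Leftmost` and the symmetry of a bridge are stated.
    twice⇒places : (v : Vec (List A) k) {x : A} → Twice (flat v) x → TwoPlaces v x
    twice⇒places v {x} t with position-surjective v (Twice.left t) | position-surjective v (Twice.right t)
    ... | o₁ , e₁ | o₂ , e₂ = record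
      { first = o₁ ; second = o₂
      ; at-first  = trans (sym (lookup-position v o₁)) (trans (cong (List.lookup (flat v)) e₁) (Twice.at-left t))
      ; at-second = trans (sym (lookup-position v o₂)) (trans (cong (List.lookup (flat v)) e₂) (Twice.at-right t))
      ; first⊏second = ordered (⊏-cmp v o₁ o₂)
      ; only-two = λ o e → Sum.map (λ p → same o o₁ (trans p (sym e₁))) (λ p → same o o₂ (trans p (sym e₂)))
          (Twice.only t (position v o) (trans (lookup-position v o) e)) }
      where
      lt : position v o₁ Fin.< position v o₂
      lt = subst₂ Fin._<_ (sym e₁) (sym e₂) (Twice.left<right t)
      ordered : v ⊢ o₁ ⊏ o₂ ⊎ o₁ ≡ o₂ ⊎ v ⊢ o₂ ⊏ o₁ → v ⊢ o₁ ⊏ o₂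
      ordered (inj₁ p)           = p
      ordered (inj₂ (inj₁ refl)) = contradiction lt (Finₚ.<-irrefl refl)
      ordered (inj₂ (inj₂ p))    = contradiction (position-< v p) (Finₚ.<-asym lt)
      same : ∀ o o′ → position v o ≡ position v o′ → o ≡ o′
      same o o′ e with ⊏-cmp v o o′
      ... | inj₁ p        = contradiction e (Finₚ.<⇒≢ (position-< v p))
      ... | inj₂ (inj₁ p) = p
      ... | inj₂ (inj₂ p) = contradiction (sym e) (Finₚ.<⇒≢ (position-< v p))

-- Charges segment by segment.

module SegmentCharges {L : Set} (_≟_ : DecidableEquality L) (charge : L → ℤ) where

  open SegmentedWords
  open ChargedWords _≟_ using (Occ)
  open Charging _≟_ charge
  open Conditionals
  open import Data.List.Membership.DecPropositional _≟_ using (_∈?_)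
  open import Data.Integer.Base using (-_)

  private
    variable
      k : ℕ

  pieces : Vec (List L) k → Vec (List Occ) k
  pieces []      = []
  pieces (x ∷ v) = charges (flat v) x ∷ pieces v

  flat-pieces : (v : Vec (List L) k) → flat (pieces v) ≡ charges [] (flat v)
  flat-pieces []      = refl
  flat-pieces (x ∷ v) = sym (trans (charges-++ [] x (flat v))
    (cong₂ _++_ (cong (λ r → charges r x) (Listₚ.++-identityʳ (flat v))) (sym (flat-pieces v))))

  lookup-pieces : (v : Vec (List L) k) (r : Fin k) → Vec.lookup (pieces v) r ≡ charges (later v r) (Vec.lookup v r)
  lookup-pieces (x ∷ v) zero    = refl
  lookup-pieces (x ∷ v) (suc r) = lookup-pieces v r

  context : (v : Vec (List L) k) → Place v → List L
  context v (r , j) = suffix (Vec.lookup v r) j ++ later v r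

  place-charge : (v : Vec (List L) k) → Place v → ℤ
  place-charge v o = sign-if (at v o ∈? context v o) (at v o)

  pieces-tabulate : (v : Vec (List L) k) (r : Fin k) →
    Vec.lookup (pieces v) r ≡ tabulate λ j → at v (r , j) , place-charge v (r , j)
  pieces-tabulate v r = trans (lookup-pieces v r) (charges-tabulate (later v r) (Vec.lookup v r))

  module _ {v : Vec (List L) k} {x : L} (t : TwoPlaces v x) where

    open TwoPlaces t

    place-charge-first : place-charge v first ≡ charge x
    place-charge-first = trans (if-yes (at v first ∈? context v first)
      (subst (_∈ context v first) (trans at-second (sym at-first)) (go first⊏second)))
                               (cong charge at-first)
      where
      go : ∀ {o o′} → v ⊢ o ⊏ o′ → at v o′ ∈ context v o
      go {r , j} {r′ , j′} (inj₁ r<r′)         = ∈ₚ.∈-++⁺ʳ (suffix (Vec.lookup v r) j) (∈-later⁺ v r<r′ (∈ₚ.∈-lookup j′))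
      go {r , j} {r′ , j′} (inj₂ (refl , j<j′)) = ∈ₚ.∈-++⁺ˡ (∈-suffix⁺ (Vec.lookup v r) j j′ j<j′)

    place-charge-second : place-charge v second ≡ - charge x
    place-charge-second = trans (if-no (at v second ∈? context v second) λ x∈ → absurd (go second x∈)) (cong (-_ ∘ charge) at-second)
      where
      go : ∀ o → at v o ∈ context v o →
           ∃ λ o′ → v ⊢ o ⊏ o′ × at v o′ ≡ at v o
      go (r , j) x∈ with ∈ₚ.∈-++⁻ (suffix (Vec.lookup v r) j) x∈
      ... | inj₁ x∈s with ∈-suffix⁻ (Vec.lookup v r) j x∈s
      ...   | j′ , j<j′ , e = (r , j′) , inj₂ (refl , j<j′) , e
      go (r , j) x∈ | inj₂ x∈l with ∈-later⁻ v r x∈l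
      ...   | r′ , r<r′ , x∈r′ = (r′ , index x∈r′) , inj₁ r<r′ , sym (Anyₚ.lookup-index x∈r′)
      absurd : (∃ λ o′ → v ⊢ second ⊏ o′ × at v o′ ≡ at v second) → ⊥
      absurd (o′ , second⊏o′ , e) with only-two o′ (trans e at-second)
      ... | inj₁ refl = ⊏-asym v second⊏o′ first⊏second
      ... | inj₂ refl = ⊏-irrefl v second⊏o′

-- The reduction of a bridge move, and the link of a metamorphosis.

module BridgeReduction {a} (α : Set a) (τ : α → α) (τ-involutive : Involutive _≡_ τ)
                  (φ : Nanowords.Π α τ τ-involutive → ℤ) (φ-additive : Nanowords.IsAdditive α τ τ-involutive φ)
                  (φ-unit : ∀ x → φ (Nanowords.gen x) ≡ 1ℤ ⊎ φ (Nanowords.gen x) ≡ -1ℤ) where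

  open Nanowords α τ τ-involutive
  open NanowordForms α τ τ-involutive φ φ-additive φ-unit
  open Cobordisms α τ τ-involutive φ φ-additive φ-unit
  open ElementaryReductions α τ τ-involutive φ φ-additive φ-unit
  open Alphabet
  open NanowordOver using (word; twice)
  open FiniteSums using (2ℤ)
  open LowRank
  open SegmentedWords
  open import Data.Integer.Base using (_+_; _*_; -_; _-_)

  ∈-interleave⁻ : ∀ {L : Set} {k} (X : Vec (List L) (suc k)) (V : Vec (List L) k) {A} →
    A ∈ interleave X V → A ∈ flat X ⊎ A ∈ flat V
  ∈-interleave⁻ (x ∷ [])     []       A∈ = inj₁ (∈ₚ.∈-++⁺ˡ A∈)
  ∈-interleave⁻ (x ∷ y ∷ ys) (v ∷ vs) A∈ with ∈ₚ.∈-++⁻ x A∈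
  ... | inj₁ A∈x = inj₁ (∈ₚ.∈-++⁺ˡ A∈x)
  ... | inj₂ A∈′ with ∈ₚ.∈-++⁻ v A∈′
  ...   | inj₁ A∈v = inj₂ (∈ₚ.∈-++⁺ˡ A∈v)
  ...   | inj₂ A∈r = Sum.map (∈ₚ.∈-++⁺ʳ x) (∈ₚ.∈-++⁺ʳ v) (∈-interleave⁻ (y ∷ ys) vs A∈r)

  module _ {L : Set} (_≟_ : DecidableEquality L) (charge : L → ℤ) where

    open Charging _≟_ charge
    open SegmentCharges _≟_ charge

    -- The two families share no letters, so whether a letter recurs later is decided within its own
    -- family; the charges can be computed as if the other family were absent.
    charges-interleave : ∀ {k} (X : Vec (List L) (suc k)) (V : Vec (List L) k) →
      (∀ {A} → A ∈ flat X → A ∈ flat V → ⊥) →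
      charges [] (interleave X V) ≡ interleave (pieces X) (pieces V)
    charges-interleave (x ∷ [])     []      _   = refl
    charges-interleave (x ∷ y ∷ ys) (v ∷ vs) dis = begin
      charges [] (x ++ v ++ rest)
        ≡⟨ charges-++ [] x (v ++ rest) ⟩
      charges ((v ++ rest) ++ []) x ++ charges [] (v ++ rest)
        ≡⟨ cong₂ _++_ (charges-cong x λ A∈x → to-x A∈x , from-x)
             (trans (charges-++ [] v rest) (cong₂ _++_ (charges-cong v λ A∈v → to-v A∈v , from-v)
               (charges-interleave (y ∷ ys) vs λ A∈ys A∈vs → dis (∈ₚ.∈-++⁺ʳ x A∈ys) (∈ₚ.∈-++⁺ʳ v A∈vs)))) ⟩
      charges (flat (y ∷ ys)) x ++ charges (flat vs) v ++ interleave (pieces (y ∷ ys)) (pieces vs) ∎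
      where
      open ≡-Reasoning
      rest : List L
      rest = interleave (y ∷ ys) vs
      ∈-interleave⁺ : ∀ {k} (X : Vec (List L) (suc k)) (V : Vec (List L) k) {A} →
        A ∈ flat X ⊎ A ∈ flat V → A ∈ interleave X V
      ∈-interleave⁺ (x ∷ [])     []       (inj₁ A∈) = subst (_ ∈_) (Listₚ.++-identityʳ x) A∈
      ∈-interleave⁺ (x ∷ y ∷ ys) (v ∷ vs) (inj₁ A∈) with ∈ₚ.∈-++⁻ x A∈
      ... | inj₁ A∈x = ∈ₚ.∈-++⁺ˡ A∈x
      ... | inj₂ A∈r = ∈ₚ.∈-++⁺ʳ x (∈ₚ.∈-++⁺ʳ v (∈-interleave⁺ (y ∷ ys) vs (inj₁ A∈r)))
      ∈-interleave⁺ (x ∷ y ∷ ys) (v ∷ vs) (inj₂ A∈) with ∈ₚ.∈-++⁻ v A∈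
      ... | inj₁ A∈v = ∈ₚ.∈-++⁺ʳ x (∈ₚ.∈-++⁺ˡ A∈v)
      ... | inj₂ A∈r = ∈ₚ.∈-++⁺ʳ x (∈ₚ.∈-++⁺ʳ v (∈-interleave⁺ (y ∷ ys) vs (inj₂ A∈r)))
      to-x : ∀ {A} → A ∈ x → A ∈ (v ++ rest) ++ [] → A ∈ flat (y ∷ ys)
      to-x A∈x A∈ with ∈ₚ.∈-++⁻ v (subst (_ ∈_) (Listₚ.++-identityʳ (v ++ rest)) A∈)
      ... | inj₁ A∈v = ⊥-elim (dis (∈ₚ.∈-++⁺ˡ A∈x) (∈ₚ.∈-++⁺ˡ A∈v))
      ... | inj₂ A∈r with ∈-interleave⁻ (y ∷ ys) vs A∈r
      ...   | inj₁ A∈ys = A∈ys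
      ...   | inj₂ A∈vs = ⊥-elim (dis (∈ₚ.∈-++⁺ˡ A∈x) (∈ₚ.∈-++⁺ʳ v A∈vs))
      from-x : ∀ {A} → A ∈ flat (y ∷ ys) → A ∈ (v ++ rest) ++ []
      from-x A∈ = ∈ₚ.∈-++⁺ˡ (∈ₚ.∈-++⁺ʳ v (∈-interleave⁺ (y ∷ ys) vs (inj₁ A∈)))
      to-v : ∀ {A} → A ∈ v → A ∈ rest ++ [] → A ∈ flat vs
      to-v A∈v A∈ with ∈-interleave⁻ (y ∷ ys) vs (subst (_ ∈_) (Listₚ.++-identityʳ rest) A∈)
      ... | inj₁ A∈ys = ⊥-elim (dis (∈ₚ.∈-++⁺ʳ x A∈ys) (∈ₚ.∈-++⁺ˡ A∈v))
      ... | inj₂ A∈vs = A∈vs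
      from-v : ∀ {A} → A ∈ flat vs → A ∈ rest ++ []
      from-v A∈ = ∈ₚ.∈-++⁺ˡ (∈-interleave⁺ (y ∷ ys) vs (inj₂ A∈))

  flat-map : ∀ {A B : Set} {k} (f : A → B) (v : Vec (List A) k) → flat (Vec.map (List.map f) v) ≡ List.map f (flat v)
  flat-map f []      = refl
  flat-map f (x ∷ v) = trans (cong (List.map f x ++_) (flat-map f v)) (sym (Listₚ.map-++ f x (flat v)))

  module _ {𝒜 : Alphabet} {w : NanowordOver 𝒜} (b : Bridge w) where

    open Bridge b hiding (_⊑_) renaming (symmetric to mirror)

    private
      R : Set
      R = Letter (𝒜 ↾ ℬ)
      _≟_ : DecidableEquality (Letter 𝒜)
      _≟_ = letters≟ w
      _≟ᴿ_ : DecidableEquality R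
      _≟ᴿ_ = Refinementₚ._≟_ _≟_
      chargeᴿ : R → ℤ
      chargeᴿ B = chargeOf w (value B)
      module P  = SegmentCharges _≟_ (chargeOf w)
      module Pᴿ = SegmentCharges _≟ᴿ_ chargeᴿ
      places : ∀ B → TwoPlaces v B
      places B = twice⇒places v (v-twice B)
      module T B = TwoPlaces (places B)

      letterAt-mirror : ∀ o → letterAt (mirror o) ≡ ι (letterAt o)
      letterAt-mirror (r , j) = reversed-lookup ι (Vec.lookup v r) (Vec.lookup v (κ r)) (length-κ r) (ι-reverses r) j

      opposite-injective : ∀ {n} {i j : Fin n} → opposite i ≡ opposite j → i ≡ j
      opposite-injective {i = i} {j} e = trans (sym (Finₚ.opposite-involutive i)) (trans (cong opposite e) (Finₚ.opposite-involutive j))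

      mirror-injective : ∀ o o′ → mirror o ≡ mirror o′ → o ≡ o′
      mirror-injective (r , j) (r′ , j′) e = go r r′ j j′
        (trans (sym (κ-involutive r)) (trans (cong (κ ∘ proj₁) e) (κ-involutive r′))) e
        where
        go : ∀ r r′ j j′ → r ≡ r′ → mirror (r , j) ≡ mirror (r′ , j′) → (r , j) ≡ (r′ , j′)
        go r .r j j′ refl e = cong (r ,_) (cast-injective (opposite-injective (same-fibre e)))
          where
          same-fibre : ∀ {s} {i i′ : Fin (length (Vec.lookup v s))} → (s , i) ≡ (s , i′) → i ≡ i′
          same-fibre refl = refl
          cast-injective : ∀ {j j′} → cast (length-κ r) j ≡ cast (length-κ r) j′ → j ≡ j′
          cast-injective {j} {j′} e = Finₚ.toℕ-injective
            (trans (sym (Finₚ.toℕ-cast (length-κ r) j)) (trans (cong toℕ e) (Finₚ.toℕ-cast (length-κ r) j′)))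

      -- Not part of the definition of a bridge. Condition (b) at r and at κ(r) shows that ι∘ι fixes
      -- the word v_r letter by letter, and every letter of ℬ lies in some v_r.
      ι-involutiveᴿ : ∀ B → ι (ι B) ≡ B
      ι-involutiveᴿ B = map-fixed (ι ∘ ι) (Vec.lookup v r) all-fixed (subst (_∈ Vec.lookup v r) (T.at-first B) (∈ₚ.∈-lookup (proj₂ (T.first B))))
        where
        open ≡-Reasoning
        r : Fin k
        r = proj₁ (T.first B)
        all-fixed : List.map (ι ∘ ι) (Vec.lookup v r) ≡ Vec.lookup v r
        all-fixed = begin
          List.map (ι ∘ ι) (Vec.lookup v r)          ≡⟨ Listₚ.map-∘ (Vec.lookup v r) ⟩
          List.map ι (List.map ι (Vec.lookup v r))   ≡⟨ cong (List.map ι) (ι-reverses r) ⟩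
          List.map ι (reverse (Vec.lookup v (κ r)))  ≡⟨ Listₚ.reverse-map ι (Vec.lookup v (κ r)) ⟩
          reverse (List.map ι (Vec.lookup v (κ r)))  ≡⟨ cong reverse (ι-reverses (κ r)) ⟩
          reverse (reverse (Vec.lookup v (κ (κ r)))) ≡⟨ Listₚ.reverse-involutive _ ⟩
          Vec.lookup v (κ (κ r))                     ≡⟨ cong (Vec.lookup v) (κ-involutive r) ⟩
          Vec.lookup v r                             ∎

      leftmost-first : ∀ B → Leftmost (T.first B)
      leftmost-first B o e with T.only-two B o (trans e (T.at-first B))
      ... | inj₁ refl = inj₂ (refl , ℕₚ.≤-refl)
      ... | inj₂ refl with T.first⊏second B
      ...   | inj₁ r<r′         = inj₁ r<r′
      ...   | inj₂ (r≡r′ , j<j′) = inj₂ (r≡r′ , ℕₚ.<⇒≤ j<j′)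

      ¬leftmost-second : ∀ B → ¬ Leftmost (T.second B)
      ¬leftmost-second B lm with lm (T.first B) (trans (T.at-first B) (sym (T.at-second B))) | T.first⊏second B
      ... | inj₁ s<f         | inj₁ f<s         = Finₚ.<-asym s<f f<s
      ... | inj₁ s<f         | inj₂ (f≡s , _)   = Finₚ.<-irrefl (sym f≡s) s<f
      ... | inj₂ (s≡f , _)   | inj₁ f<s         = Finₚ.<-irrefl (sym s≡f) f<s
      ... | inj₂ (_ , s≤f)   | inj₂ (_ , f<s)   = ℕₚ.<⇒≱ f<s s≤f

      -- parallel is ε(B) = 1, crossed is ε(B) = 0.
      data Orientation (B : R) : Set a where
        parallel : mirror (T.first B) ≡ T.first (ι B) → mirror (T.second B) ≡ T.second (ι B) →
                   label (𝒜 ↾ ℬ) (ι B) ≡ τ (label (𝒜 ↾ ℬ) B) → Orientation B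
        crossed  : mirror (T.first B) ≡ T.second (ι B) → mirror (T.second B) ≡ T.first (ι B) →
                   label (𝒜 ↾ ℬ) (ι B) ≡ label (𝒜 ↾ ℬ) B → Orientation B

      first≢second : ∀ B → T.first B ≢ T.second B
      first≢second B e = ⊏-irrefl v (subst (λ o → v ⊢ T.first B ⊏ o) (sym e) (T.first⊏second B))

      -- `mirror` is injective and sends places of B to places of ι(B), so it maps the pair of the
      -- one onto the pair of the other, either in order or crosswise; the two cases select
      -- `labels₁` and `labels₀`.
      orientation : ∀ B → Orientation B
      orientation B with T.only-two (ι B) (mirror (T.first B)) (trans (letterAt-mirror (T.first B)) (cong ι (T.at-first B)))
                       | T.only-two (ι B) (mirror (T.second B)) (trans (letterAt-mirror (T.second B)) (cong ι (T.at-second B)))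
      ... | inj₁ p | inj₁ q = contradiction (mirror-injective _ _ (trans p (sym q))) (first≢second B)
      ... | inj₂ p | inj₂ q = contradiction (mirror-injective _ _ (trans p (sym q))) (first≢second B)
      ... | inj₁ p | inj₂ q = parallel p q (subst (λ C → label (𝒜 ↾ ℬ) (ι C) ≡ τ (label (𝒜 ↾ ℬ) C)) (T.at-first B)
              (labels₁ (T.first B) (leftmost-first B) (subst Leftmost (sym p) (leftmost-first (ι B)))))
      ... | inj₂ p | inj₁ q = crossed p q (subst (λ C → label (𝒜 ↾ ℬ) (ι C) ≡ label (𝒜 ↾ ℬ) C) (T.at-first B)
              (labels₀ (T.first B) (leftmost-first B) (¬leftmost-second (ι B) ∘ subst Leftmost p)))

      -- The label condition of a bridge in terms of charges. If left goes to left, the labels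
      -- differ by τ; if left goes to right, they agree. In both cases the charge changes sign.
      charge-mirror : ∀ o → Pᴿ.place-charge v (mirror o) ≡ - Pᴿ.place-charge v o
      charge-mirror o = go (letterAt o) (T.only-two (letterAt o) o refl) (orientation (letterAt o))
        where
        open ≡-Reasoning
        first-charge : ∀ B → Pᴿ.place-charge v (T.first B) ≡ chargeᴿ B
        first-charge B = Pᴿ.place-charge-first (places B)
        second-charge : ∀ B → Pᴿ.place-charge v (T.second B) ≡ - chargeᴿ B
        second-charge B = Pᴿ.place-charge-second (places B)
        opposite-charge : ∀ {B} → label (𝒜 ↾ ℬ) (ι B) ≡ τ (label (𝒜 ↾ ℬ) B) → chargeᴿ (ι B) ≡ - chargeᴿ B
        opposite-charge e = trans (cong ψ e) (ψ-τ _)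
        go : ∀ B → o ≡ T.first B ⊎ o ≡ T.second B → Orientation B → Pᴿ.place-charge v (mirror o) ≡ - Pᴿ.place-charge v o
        go B (inj₁ refl) (parallel p _ e) = trans (cong (Pᴿ.place-charge v) p) (trans (first-charge (ι B))
          (trans (opposite-charge e) (cong -_ (sym (first-charge B)))))
        go B (inj₂ refl) (parallel _ q e) = trans (cong (Pᴿ.place-charge v) q) (trans (second-charge (ι B))
          (cong -_ (trans (opposite-charge e) (sym (second-charge B)))))
        go B (inj₁ refl) (crossed p _ e) = trans (cong (Pᴿ.place-charge v) p) (trans (second-charge (ι B))
          (cong -_ (trans (cong ψ e) (sym (first-charge B)))))
        go B (inj₂ refl) (crossed _ q e) = trans (cong (Pᴿ.place-charge v) q) (trans (first-charge (ι B))
          (trans (cong ψ e) (sym (trans (cong -_ (second-charge B)) (ℤₚ.neg-involutive _)))))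

      σᴿ : R × ℤ → R × ℤ
      σᴿ (B , q) = ι B , - q

      pieces-mirror : ∀ r → Vec.lookup (Pᴿ.pieces v) (κ r) ≡ reverse (List.map σᴿ (Vec.lookup (Pᴿ.pieces v) r))
      pieces-mirror r = begin
        Vec.lookup (Pᴿ.pieces v) (κ r)
          ≡⟨ Pᴿ.pieces-tabulate v (κ r) ⟩
        tabulate (λ j → letterAt (κ r , j) , Pᴿ.place-charge v (κ r , j))
          ≡⟨ tabulate-reversed (length-κ r) (λ j → σᴿ (letterAt (r , j) , Pᴿ.place-charge v (r , j))) _
               (λ j → cong₂ _,_ (letterAt-mirror (r , j)) (charge-mirror (r , j))) ⟩
        reverse (tabulate (λ j → σᴿ (letterAt (r , j) , Pᴿ.place-charge v (r , j))))
          ≡⟨ cong reverse (sym (Listₚ.map-tabulate (λ j → letterAt (r , j) , Pᴿ.place-charge v (r , j)) σᴿ)) ⟩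
        reverse (List.map σᴿ (tabulate λ j → letterAt (r , j) , Pᴿ.place-charge v (r , j)))
          ≡⟨ cong (reverse ∘ List.map σᴿ) (sym (Pᴿ.pieces-tabulate v r)) ⟩
        reverse (List.map σᴿ (Vec.lookup (Pᴿ.pieces v) r)) ∎
        where open ≡-Reasoning

      X : Vec (List (Letter 𝒜)) (suc k)
      X = Vec.map ⟪_⟫ x
      V : Vec (List (Letter 𝒜)) k
      V = Vec.map ⟪_⟫ v

      X-letters : ∀ {A} → A ∈ flat X → ∃ λ (B : Letter (𝒜 ∖ ℬ)) → value B ≡ A
      X-letters A∈ with ∈ₚ.∈-map⁻ value (subst (_ ∈_) (flat-map value x) A∈)
      ... | B , _ , e = B , sym e
      V-letters : ∀ {A} → A ∈ flat V → ∃ λ (B : R) → value B ≡ A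
      V-letters A∈ with ∈ₚ.∈-map⁻ value (subst (_ ∈_) (flat-map value v) A∈)
      ... | B , _ , e = B , sym e

      disjoint : ∀ {A} → (∃ λ (B : Letter (𝒜 ∖ ℬ)) → value B ≡ A) → (∃ λ (B : R) → value B ≡ A) → ⊥
      disjoint (B , refl) (C , e) = irrelevant-absurd {P = ℬ} (subst (λ A → Irrelevant (ℬ A)) e (proof C)) (proof B)

      -- `ℬ` is a predicate that comes without a decision procedure. Where a letter belongs is read
      -- off from the decomposition of the word, in which every letter occurs.
      classify : ∀ A → (∃ λ (B : Letter (𝒜 ∖ ℬ)) → value B ≡ A) ⊎ (∃ λ (B : R) → value B ≡ A)
      classify A = Sum.map X-letters V-letters (∈-interleave⁻ X V
        (subst (A ∈_) decompose (subst (_∈ word w) (Twice.at-left (twice w A)) (∈ₚ.∈-lookup (Twice.left (twice w A))))))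

      extend : ∀ {A} → (∃ λ (B : Letter (𝒜 ∖ ℬ)) → value B ≡ A) ⊎ (∃ λ (B : R) → value B ≡ A) → Letter 𝒜
      extend {A} (inj₁ _)      = A
      extend     (inj₂ (B , _)) = value (ι B)

      extend-R : ∀ B s → extend {value B} s ≡ value (ι B)
      extend-R B (inj₁ s)       = ⊥-elim (disjoint s (B , refl))
      extend-R B (inj₂ (C , e)) = cong (value ∘ ι) (value-injective e)

      ι̂ : Letter 𝒜 → Letter 𝒜
      ι̂ A = extend (classify A)

      ι̂-R : ∀ B → ι̂ (value B) ≡ value (ι B)
      ι̂-R B = extend-R B (classify (value B))

      ι̂-cases : ∀ {ℓ} (Q : Letter 𝒜 → Letter 𝒜 → Set ℓ) → (∀ A → ι̂ A ≡ A → Q A A) → (∀ B → Q (value B) (value (ι B))) → ∀ A → Q A (ι̂ A)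
      ι̂-cases Q fixed moved A = go (classify A) refl
        where
        go : ∀ s → classify A ≡ s → Q A (extend (classify A))
        go (inj₁ p) e          = subst (Q A ∘ extend) (sym e) (fixed A (cong extend e))
        go (inj₂ (B , refl)) e = subst (Q A ∘ extend) (sym e) (moved B)

      ι̂-involutive : Involutive _≡_ ι̂
      ι̂-involutive = ι̂-cases (λ A C → ι̂ C ≡ A) (λ A e → e) λ B → trans (ι̂-R (ι B)) (cong value (ι-involutiveᴿ B))

      ι̂-label : ∀ A → label 𝒜 (ι̂ A) ∼ label 𝒜 A
      ι̂-label = ι̂-cases (λ A C → label 𝒜 C ∼ label 𝒜 A) (λ A _ → ∼-refl) λ B → from-orientation B (orientation B)
        where
        from-orientation : ∀ B → Orientation B → label 𝒜 (value (ι B)) ∼ label 𝒜 (value B)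
        from-orientation B (parallel _ _ e) = inj₂ e
        from-orientation B (crossed _ _ e)  = inj₁ e

      ι̂-kept : ∀ (B : Letter (𝒜 ∖ ℬ)) → ι̂ (value B) ≡ value B
      ι̂-kept B = go (classify (value B))
        where
        go : ∀ s → extend {value B} s ≡ value B
        go (inj₁ _) = refl
        go (inj₂ s) = ⊥-elim (disjoint (B , refl) s)

      open ChargedBridge α τ τ-involutive _≟_
      module W = ChargedWords _≟_

      symmetric : ∀ r → Vec.lookup (P.pieces V) (κ r) ≡ reverse (List.map (σ ι̂ ι̂-involutive) (Vec.lookup (P.pieces V) r))
      symmetric r = begin
        Vec.lookup (P.pieces V) (κ r)
          ≡⟨ lift (κ r) ⟩
        List.map rename (Vec.lookup (Pᴿ.pieces v) (κ r))
          ≡⟨ cong (List.map rename) (pieces-mirror r) ⟩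
        List.map rename (reverse (List.map σᴿ (Vec.lookup (Pᴿ.pieces v) r)))
          ≡⟨ Listₚ.reverse-map rename (List.map σᴿ (Vec.lookup (Pᴿ.pieces v) r)) ⟩
        reverse (List.map rename (List.map σᴿ (Vec.lookup (Pᴿ.pieces v) r)))
          ≡⟨ cong reverse (trans (sym (Listₚ.map-∘ (Vec.lookup (Pᴿ.pieces v) r)))
               (trans (Listₚ.map-cong (λ (B , q) → cong (_, - q) (sym (ι̂-R B))) (Vec.lookup (Pᴿ.pieces v) r))
                 (Listₚ.map-∘ (Vec.lookup (Pᴿ.pieces v) r)))) ⟩
        reverse (List.map (σ ι̂ ι̂-involutive) (List.map rename (Vec.lookup (Pᴿ.pieces v) r)))
          ≡⟨ cong (reverse ∘ List.map (σ ι̂ ι̂-involutive)) (sym (lift r)) ⟩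
        reverse (List.map (σ ι̂ ι̂-involutive) (Vec.lookup (P.pieces V) r)) ∎
        where
        open ≡-Reasoning
        rename : R × ℤ → Letter 𝒜 × ℤ
        rename = ChargedRenaming.rename _≟_ _≟ᴿ_ value
        later-map : ∀ {k} (v : Vec (List R) k) r → later (Vec.map ⟪_⟫ v) r ≡ ⟪ later v r ⟫
        later-map (u ∷ v) zero    = flat-map value v
        later-map (u ∷ v) (suc r) = later-map v r
        lift : ∀ r → Vec.lookup (P.pieces V) r ≡ List.map rename (Vec.lookup (Pᴿ.pieces v) r)
        lift r = trans (P.lookup-pieces V r) (trans
          (cong₂ (Charging.charges _≟_ (chargeOf w)) (later-map v r) (Vecₚ.lookup-map r ⟪_⟫ v))
          (trans (ChargeRenaming.charges-rename _≟_ _≟ᴿ_ (chargeOf w) chargeᴿ value value-injective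
                   (later v r) (Vec.lookup v r) (λ _ → refl))
            (cong (List.map rename) (sym (Pᴿ.lookup-pieces v r)))))

    reduction-bridge : ∀ {w′ : NanowordOver (𝒜 ∖ ℬ)} → word w′ ≡ concat (Vec.toList x) →
      Reduction ((arches ℕ.+ arches) ℕ.+ (arches ℕ.+ arches)) w w′
    reduction-bridge {w′} eq = record
      { kept = value ; kept-injective = value-injective ; kept-label = λ _ → ∼-refl
      ; ι = ι̂ ; ι-involutive = ι̂-involutive ; ι-label = ι̂-label ; ι-kept = ι̂-kept
      ; split = λ A → Sum.map₂ (λ s B e → disjoint (B , e) s) (classify A)
      ; twist = λ _ → 0ℤ
      ; low = low-cong (λ ((z , _) , c) ((z′ , _) , c′) → cong₂ (λ s t → 2ℤ * (s - t))
          (cong (λ s → W.form s z c z′ c′) charged-w)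
          (trans (formʷ-cong w′ (λ _ → refl) (ℤₚ.+-identityʳ c) (λ _ → refl) (ℤₚ.+-identityʳ c′))
            (trans (sym (form-kept w w′ value value-injective z c z′ c′))
              (cong (λ s → W.form s z c z′ c′) charged-w′))))
          (form-bridge ι̂ ι̂-involutive κ κ-involutive (P.pieces X) (P.pieces V) symmetric {P = ∃V} {Q = ∃R} disjoint
            (λ i → subst (All (∃V ∘ proj₁)) (sym (P.lookup-pieces X i))
              (Charging.charges-letters _≟_ (chargeOf w) (All.tabulate λ A∈ → X-letters (∈-flat⁺ X i A∈))))
            (λ r → subst (All (∃R ∘ proj₁)) (sym (P.lookup-pieces V r))
              (Charging.charges-letters _≟_ (chargeOf w) (All.tabulate λ A∈ → V-letters (∈-flat⁺ V r A∈)))))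
      }
      where
      ∃V ∃R : Letter 𝒜 → Set
      ∃V A = ∃ λ (B : Letter (𝒜 ∖ ℬ)) → value B ≡ A
      ∃R A = ∃ λ (B : R) → value B ≡ A
      charged-w : charged w ≡ interleave (P.pieces X) (P.pieces V)
      charged-w = trans (cong (Charging.charges _≟_ (chargeOf w) []) decompose)
        (charges-interleave _≟_ (chargeOf w) X V λ A∈X A∈V → disjoint (X-letters A∈X) (V-letters A∈V))
      charged-w′ : List.map (ChargedRenaming.rename _≟_ (letters≟ w′) value) (charged w′) ≡ concat (Vec.toList (P.pieces X))
      charged-w′ = trans (sym (charged-kept w w′ value value-injective (λ _ → refl)))
        (trans (cong (Charging.charges _≟_ (chargeOf w) []) (trans (cong (List.map value) eq) (sym (flat-map value x))))
          (sym (P.flat-pieces X)))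

  -- Four products per arch, in the shape in which `form-bridge` delivers them.
  cost : ℕ → ℕ
  cost n = (n ℕ.+ n) ℕ.+ (n ℕ.+ n)

  cost-+ : ∀ m n → cost m ℕ.+ cost n ≡ cost (m ℕ.+ n)
  cost-+ = expanded
    where
    expanded : ∀ m n → ((m ℕ.+ m) ℕ.+ (m ℕ.+ m)) ℕ.+ ((n ℕ.+ n) ℕ.+ (n ℕ.+ n)) ≡
               ((m ℕ.+ n) ℕ.+ (m ℕ.+ n)) ℕ.+ ((m ℕ.+ n) ℕ.+ (m ℕ.+ n))
    expanded = ℕ-RingSolver.solve-∀

  reduction : ∀ {w u : Nanoword} (m : Move w u) → Reduction (cost (g m)) (proj₂ w) (proj₂ u)
  reduction (isomorphism f f-label eq)           = reduction-isomorphism f f-label eq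
  reduction (homotopy₁ x y eq eq′)               = reduction-homotopy₁ x y eq eq′
  reduction (homotopy₂ x y z B~A eq eq′)         = reduction-homotopy₂ x y z B~A eq eq′
  reduction (homotopy₃ x y z t n₁ n₂ n₃ e₁ e₂ eq eq′) = reduction-homotopy₃ x y z t n₁ n₂ n₃ e₁ e₂ eq eq′
  reduction (shift x y eq eq′)                   = reduction-shift x y eq eq′
  reduction (bridge b eq)                        = reduction-bridge b eq

  link : ∀ {w v : Nanoword} (m : CircularMetamorphosis w v) → Link (cost (totalArches m)) (proj₂ w) (proj₂ v)
  link ε              = link-refl _
  link {w} {v} (fwd m ◅ rest) = subst (λ N → Link N (proj₂ w) (proj₂ v)) (cost-+ (g m) (totalArches rest)) (link-forward (reduction m) (link rest))
  link {w} {v} (bwd m ◅ rest) = subst (λ N → Link N (proj₂ w) (proj₂ v)) (cost-+ (g m) (totalArches rest)) (link-backward (reduction m) (link rest))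

-- From few products to the rank over ℚ.

module IntegralRank where

  open FiniteSums using (sum; sum-nil; sum-cons)
  open LowRank
  open CommutativeMonoidSum ℚₚ.+-0-commutativeMonoid using () renaming (sum to sumℚ)

  ⌜_⌝ : ℤ → ℚ
  ⌜ i ⌝ = i ℚ./ 1

  private
    toℚᵘ-⌜⌝ : ∀ i → ℚ.toℚᵘ ⌜ i ⌝ ℚᵘ.≃ ℚᵘ.mkℚᵘ i 0
    toℚᵘ-⌜⌝ i = ℚₚ.toℚᵘ-fromℚᵘ (ℚᵘ.mkℚᵘ i 0)

  ⌜⌝-+ : ∀ i j → ⌜ i ℤ.+ j ⌝ ≡ ⌜ i ⌝ ℚ.+ ⌜ j ⌝
  ⌜⌝-+ i j = ℚₚ.toℚᵘ-injective (ℚᵘₚ.≃-trans (toℚᵘ-⌜⌝ (i ℤ.+ j)) (ℚᵘₚ.≃-trans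
    (ℚᵘ.*≡* (cong₂ ℤ._*_ (sym (cong₂ ℤ._+_ (ℤₚ.*-identityʳ i) (ℤₚ.*-identityʳ j))) refl))
    (ℚᵘₚ.≃-sym (ℚᵘₚ.≃-trans (ℚₚ.toℚᵘ-homo-+ ⌜ i ⌝ ⌜ j ⌝) (ℚᵘₚ.+-cong (toℚᵘ-⌜⌝ i) (toℚᵘ-⌜⌝ j))))))

  ⌜⌝-* : ∀ i j → ⌜ i ℤ.* j ⌝ ≡ ⌜ i ⌝ ℚ.* ⌜ j ⌝
  ⌜⌝-* i j = ℚₚ.toℚᵘ-injective (ℚᵘₚ.≃-trans (toℚᵘ-⌜⌝ (i ℤ.* j))
    (ℚᵘₚ.≃-sym (ℚᵘₚ.≃-trans (ℚₚ.toℚᵘ-homo-* ⌜ i ⌝ ⌜ j ⌝) (ℚᵘₚ.*-cong (toℚᵘ-⌜⌝ i) (toℚᵘ-⌜⌝ j)))))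

  ⌜⌝-injective : ∀ {i j} → ⌜ i ⌝ ≡ ⌜ j ⌝ → i ≡ j
  ⌜⌝-injective {i} {j} e with ℚᵘₚ.≃-trans (ℚᵘₚ.≃-sym (toℚᵘ-⌜⌝ i)) (ℚᵘₚ.≃-trans (ℚᵘₚ.≃-reflexive (cong ℚ.toℚᵘ e)) (toℚᵘ-⌜⌝ j))
  ... | ℚᵘ.*≡* e′ = trans (sym (ℤₚ.*-identityʳ i)) (trans e′ (ℤₚ.*-identityʳ j))

  ⌜⌝-mono-≤ : ∀ {i j} → i ℤ.≤ j → ⌜ i ⌝ ℚ.≤ ⌜ j ⌝
  ⌜⌝-mono-≤ {i} {j} i≤j = ℚₚ.toℚᵘ-cancel-≤ (ℚᵘₚ.≤-trans (ℚᵘₚ.≤-reflexive (toℚᵘ-⌜⌝ i)) (ℚᵘₚ.≤-trans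
    (ℚᵘ.*≤* (subst₂ ℤ._≤_ (sym (ℤₚ.*-identityʳ i)) (sym (ℤₚ.*-identityʳ j)) i≤j))
    (ℚᵘₚ.≤-reflexive (ℚᵘₚ.≃-sym (toℚᵘ-⌜⌝ j)))))

  sumℚ-⌜⌝ : ∀ {n} (f : Fin n → ℤ) → sumℚ (λ i → ⌜ f i ⌝) ≡ ⌜ sum f ⌝
  sumℚ-⌜⌝ {zero}  f = cong ⌜_⌝ (sym (sum-nil f))
  sumℚ-⌜⌝ {suc n} f = trans (cong (⌜ f zero ⌝ ℚ.+_) (sumℚ-⌜⌝ (f ∘ suc)))
    (trans (sym (⌜⌝-+ (f zero) _)) (cong ⌜_⌝ (sym (sum-cons f))))

  sumℚ-cong : ∀ {n} {f g : Fin n → ℚ} → f ≗ g → sumℚ f ≡ sumℚ g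
  sumℚ-cong {zero}  e = refl
  sumℚ-cong {suc n} e = cong₂ ℚ._+_ (e zero) (sumℚ-cong (e ∘ suc))

  -- If the bound itself satisfies `P`, it is the maximum; assuming that there is no maximum, the
  -- bound can thus be lowered step by step down to 0, where `P0` gives one.
  ¬¬maximum : ∀ {p} (P : ℕ → Set p) → P 0 → ∀ M → (∀ k → P k → k ℕ.≤ M) → ¬ ¬ (∃ λ r → P r × (∀ k → P k → k ℕ.≤ r))
  ¬¬maximum P P0 zero    bound ¬max = ¬max (0 , P0 , bound)
  ¬¬maximum P P0 (suc M) bound ¬max = ¬¬maximum P P0 M
    (λ k Pk → ℕₚ.≤-pred (ℕₚ.≤∧≢⇒< (bound k Pk) λ { refl → ¬max (suc M , Pk , bound) })) ¬max

  module _ {ℓ} {A : Set ℓ} {N m : ℕ} (F : A → A → ℤ) (low : Low N F) (param : Fin m → A)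
           (G : Fin m → Fin m → ℤ) (k : ℤ) (k≢0 : k ≢ 0ℤ) (F≡kG : ∀ i j → F (param i) (param j) ≡ k ℤ.* G i j) where

    -- More than `N` rows satisfy a nontrivial integral relation. The nonzero factor `k` cancels
    -- from it, and read in ℚ it contradicts independence.
    independent-≤ : ∀ r (f : Fin r → Fin m) → LinearlyIndependent (λ i j → ⌜ G (f i) j ⌝) → r ℕ.≤ N
    independent-≤ r f independent with r ℕₚ.≤? N
    ... | yes r≤N = r≤N
    ... | no r≰N with low-dependent low (param ∘ f) (ℕₚ.≰⇒> r≰N)
    ...   | c , (i , ci≢0) , relation = contradiction (⌜⌝-injective (independent (⌜_⌝ ∘ c) rows i)) ci≢0
      where
      open ≡-Reasoning
      relation′ : ∀ j → sum (λ i → c i ℤ.* G (f i) j) ≡ 0ℤ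
      relation′ j = cancel (ℤₚ.i*j≡0⇒i≡0∨j≡0 k (begin
        k ℤ.* sum (λ i → c i ℤ.* G (f i) j)           ≡⟨ FiniteSums.sum-*ˡ k (λ i → c i ℤ.* G (f i) j) ⟨
        sum (λ i → k ℤ.* (c i ℤ.* G (f i) j))         ≡⟨ FiniteSums.sum-cong (λ i → trans (swap k (c i) (G (f i) j)) (cong (c i ℤ.*_) (sym (F≡kG (f i) j)))) ⟩
        sum (λ i → c i ℤ.* F (param (f i)) (param j)) ≡⟨ relation (param j) ⟩
        0ℤ                                            ∎))
        where
        swap : ∀ k c g → k ℤ.* (c ℤ.* g) ≡ c ℤ.* (k ℤ.* g)
        swap = solve-∀
        cancel : k ≡ 0ℤ ⊎ sum (λ i → c i ℤ.* G (f i) j) ≡ 0ℤ → sum (λ i → c i ℤ.* G (f i) j) ≡ 0ℤ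
        cancel (inj₁ k≡0) = contradiction k≡0 k≢0
        cancel (inj₂ e)   = e
      rows : ∀ j → sumℚ (λ i → ⌜ c i ⌝ ℚ.* ⌜ G (f i) j ⌝) ≡ ℚ.0ℚ
      rows j = trans (sumℚ-cong λ i → sym (⌜⌝-* (c i) (G (f i) j)))
        (trans (sumℚ-⌜⌝ (λ i → c i ℤ.* G (f i) j)) (cong ⌜_⌝ (relation′ j)))

    -- The double negation spares us a decision procedure for linear independence.
    ¬¬rank : ¬ ¬ (∃ λ r → HasRank (λ i j → ⌜ G i j ⌝) r × r ℕ.≤ N)
    ¬¬rank ¬rank = ¬¬maximum Independent ((λ ()) , λ c _ ()) N (λ k (f , ind) → independent-≤ k f ind)
      λ (r , (f , ind) , max) → ¬rank (r , ((f , ind) , λ k f′ ind′ → max k (f′ , ind′)) , independent-≤ r f ind)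
      where
      Independent : ℕ → Set
      Independent k = ∃ λ (f : Fin k → Fin m) → LinearlyIndependent (λ i j → ⌜ G (f i) j ⌝)

-- The filling defined by a link.

module LinkFilling {a} (α : Set a) (τ : α → α) (τ-involutive : Involutive _≡_ τ)
                   (φ : Nanowords.Π α τ τ-involutive → ℤ) (φ-additive : Nanowords.IsAdditive α τ τ-involutive φ)
                   (φ-unit : ∀ x → φ (Nanowords.gen x) ≡ 1ℤ ⊎ φ (Nanowords.gen x) ≡ -1ℤ) where

  open Nanowords α τ τ-involutive
  open NanowordForms α τ τ-involutive φ φ-additive φ-unit
  open PairingGram α τ τ-involutive φ φ-additive φ-unit
  open Cobordisms α τ τ-involutive φ φ-additive φ-unit
  open Alphabet
  open NanowordOver using (word; twice)
  open Conditionals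
  open FiniteSums using (2ℤ; sum-cons; sum-nil)
  open LowRank
  open import Data.Integer.Base using (_+_; _*_; -_; _-_)

  -- However many shifts occurred, they have added up to one start value `t a`, that is, to a
  -- multiple of the single functional `massF`; so the cost is two products.
  low-twist : ∀ {ℓ} {A : Set ℓ} {𝒜} (v : NanowordOver 𝒜) (z : A → Letter 𝒜 → ℤ) (c t : A → ℤ) →
    Low 2 (λ a b → formʷ v (z a) (c a + t a) (z b) (c b + t b) - formʷ v (z a) (c a) (z b) (c b))
  low-twist {A = A} v z c t = low-perturbed {X = λ a → V (z a) (c a + t a) (charged v)} {R = λ a → V (z a) (c a) (charged v)}
    (λ _ → t) (λ (_ : Fin 1) → massF (charged v)) λ a → ap-≡ λ f → trans (val-shift (z a) (c a) (t a) (charged v) f)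
      (cong (val (z a) (c a) (charged v) f +_) (sym (trans (sum-cons _) (trans (cong (t a * mass (charged v) f +_) (sum-nil _)) (ℤₚ.+-identityʳ _)))))
    where
    open ChargedWords (letters≟ v)
    open ChargedBridge α τ τ-involutive (letters≟ v)

  module _ {N : ℕ} {w v : Nanoword} (lk : Link N (proj₂ w) (proj₂ v)) where

    open Link lk

    private
      p : Pairing
      p = pairing w ⊕ opposite-pairing (pairing v)

    open Pairing p using (S°; S; label°; ẽ; ℤS; δ; Short; Filling) renaming (_≟_ to _≟ˢ_)

    private
      ww : NanowordOver (proj₁ w)
      ww = proj₂ w
      vv : NanowordOver (proj₁ v)
      vv = proj₂ v

      labels-label° : ∀ e → labels e ≡ label° e
      labels-label° (inj₁ _) = refl
      labels-label° (inj₂ _) = refl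

      χ : S° → ℤ
      χ e = ψ (label° e)

      χ-square : ∀ e → χ e * χ e ≡ 1ℤ
      χ-square e = ψ-square (label° e)

      δ-same : ∀ A → δ A A ≡ 1ℤ
      δ-same A = if-yes (A ≟ˢ A) refl

      δ-other : ∀ {A B} → A ≢ B → δ A B ≡ 0ℤ
      δ-other {A} {B} A≢B = if-no (A ≟ˢ B) A≢B

      δ-just-nothing : ∀ e → δ (just e) nothing ≡ 0ℤ
      δ-just-nothing e = δ-other {just e} {nothing} λ ()

      δ-nothing-just : ∀ e → δ nothing (just e) ≡ 0ℤ
      δ-nothing-just e = δ-other {nothing} {just e} λ ()

      Coordinates : Set
      Coordinates = (I → ℤ) × ℤ

      -- The factor χ(e) = ±1 is its own inverse and is what turns class functions into vectors of
      -- the signs that shortness prescribes.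
      vector : Coordinates → ℤS
      vector (z , c) nothing  = c
      vector (z , c) (just e) = χ e * z (cls e)

    -- 8 = 2 · 4: the factor 2 of Link.low and the 4 of gram-form.
    gram-low : Low (N ℕ.+ 2) (λ a b → ℤ.+ 8 * φ (ẽ (vector a) (vector b)))
    gram-low = low-cong expand (low-+ low
      (low-* 2ℤ (low-twist {A = Coordinates} vv (λ (z , _) → z ∘ cls ∘ inj₂) proj₂ (λ (z , _) → twist z))))
      where
      open ≡-Reasoning
      expand : ∀ ((z , c) (z′ , c′) : Coordinates) → ℤ.+ 8 * φ (ẽ (vector (z , c)) (vector (z′ , c′))) ≡
        2ℤ * (formʷ ww (z ∘ cls ∘ inj₁) c (z′ ∘ cls ∘ inj₁) c′
             - formʷ vv (z ∘ cls ∘ inj₂) (c + twist z) (z′ ∘ cls ∘ inj₂) (c′ + twist z′))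
        + 2ℤ * (formʷ vv (z ∘ cls ∘ inj₂) (c + twist z) (z′ ∘ cls ∘ inj₂) (c′ + twist z′)
               - formʷ vv (z ∘ cls ∘ inj₂) c (z′ ∘ cls ∘ inj₂) c′)
      expand (z , c) (z′ , c′) = begin
        ℤ.+ 8 * φ (ẽ (vector (z , c)) (vector (z′ , c′)))
          ≡⟨ eight (φ (ẽ (vector (z , c)) (vector (z′ , c′)))) ⟩
        2ℤ * (ℤ.+ 4 * φ (ẽ (vector (z , c)) (vector (z′ , c′))))
          ≡⟨ cong (2ℤ *_) (gram-form w v (vector (z , c)) (vector (z′ , c′)) (z ∘ cls ∘ inj₁) (z′ ∘ cls ∘ inj₁)
               (z ∘ cls ∘ inj₂) (z′ ∘ cls ∘ inj₂) (λ _ → refl) (λ _ → refl) (λ _ → refl) (λ _ → refl)) ⟩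
        2ℤ * (formʷ ww (z ∘ cls ∘ inj₁) c (z′ ∘ cls ∘ inj₁) c′ - formʷ vv (z ∘ cls ∘ inj₂) c (z′ ∘ cls ∘ inj₂) c′)
          ≡⟨ telescope (formʷ ww (z ∘ cls ∘ inj₁) c (z′ ∘ cls ∘ inj₁) c′)
               (formʷ vv (z ∘ cls ∘ inj₂) (c + twist z) (z′ ∘ cls ∘ inj₂) (c′ + twist z′))
               (formʷ vv (z ∘ cls ∘ inj₂) c (z′ ∘ cls ∘ inj₂) c′) ⟩
        _ ∎
        where
        eight : ∀ x → ℤ.+ 8 * x ≡ 2ℤ * (ℤ.+ 4 * x)
        eight = solve-∀
        telescope : ∀ x y z → 2ℤ * (x - z) ≡ 2ℤ * (x - y) + 2ℤ * (y - z)
        telescope = solve-∀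

    private
      elements : List S°
      elements = List.map inj₁ (word ww) ++ List.map inj₂ (word vv)

      ∈-word : ∀ {𝒜} (u : NanowordOver 𝒜) A → A ∈ word u
      ∈-word u A = subst (_∈ word u) (Twice.at-left (twice u A)) (∈ₚ.∈-lookup (Twice.left (twice u A)))

      ∈-elements : ∀ e → e ∈ elements
      ∈-elements (inj₁ A) = ∈ₚ.∈-++⁺ˡ (∈ₚ.∈-map⁺ inj₁ (∈-word ww A))
      ∈-elements (inj₂ A) = ∈ₚ.∈-++⁺ʳ (List.map inj₁ (word ww)) (∈ₚ.∈-map⁺ inj₂ (∈-word vv A))

      classes : List I
      classes = List.deduplicate _≟ᴵ_ (List.map cls elements)

      classes-unique : Unique classes
      classes-unique = DecUniqueₚ.deduplicate-! _≟ᴵ_ (List.map cls elements)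

      ∈-classes : ∀ e → cls e ∈ classes
      ∈-classes e = ∈ₚ.∈-deduplicate⁺ _≟ᴵ_ (∈ₚ.∈-map⁺ cls (∈-elements e))

      representative : ∀ i → ∃ λ e → List.lookup classes i ≡ cls e
      representative i with ∈ₚ.∈-map⁻ cls (∈ₚ.∈-deduplicate⁻ _≟ᴵ_ (List.map cls elements) (∈ₚ.∈-lookup {xs = classes} i))
      ... | e , _ , eq = e , eq

      rep : Fin (length classes) → S°
      rep i = proj₁ (representative i)

      size : ℕ
      size = suc (length classes)

      [_∈class_] : I → I → ℤ
      [ k ∈class l ] = if does (k ≟ᴵ l) then 1ℤ else 0ℤ

      -- Index `zero` gives `s`, the others one vector for each class. The factor χ(rep i) makes the
      -- coefficient of the representative its square, that is 1; the other member of the class then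
      -- has coefficient 1 or -1 according to its label.
      coordinates : Fin size → Coordinates
      coordinates zero    = (λ _ → 0ℤ) , 1ℤ
      coordinates (suc i) = (λ k → χ (rep i) * [ k ∈class cls (rep i) ]) , 0ℤ

      in-class : ∀ e r → cls e ≡ cls r → χ e * (χ r * [ cls e ∈class cls r ]) ≡ χ e * χ r
      in-class e r e∈ = cong (χ e *_) (trans (cong (χ r *_) (if-yes (cls e ≟ᴵ cls r) e∈)) (ℤₚ.*-identityʳ (χ r)))

      off-class : ∀ e r → cls e ≢ cls r → χ e * (χ r * [ cls e ∈class cls r ]) ≡ 0ℤ
      off-class e r e∉ = trans (cong (χ e *_) (trans (cong (χ r *_) (if-no (cls e ≟ᴵ cls r) e∉)) (ℤₚ.*-zeroʳ (χ r)))) (ℤₚ.*-zeroʳ (χ e))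

      S°-≟ : DecidableEquality S°
      S°-≟ = Sumₚ.≡-dec (letters≟ ww) (letters≟ vv)

      just-≢ : ∀ {e e′ : S°} → e ≢ e′ → just e ≢ just e′
      just-≢ e≢e′ refl = e≢e′ refl

      -- A class has its representative and, by `no-three`, at most one further member. For the
      -- latter `compat` leaves two possibilities: equal labels yield a sum, labels exchanged by τ a
      -- difference.
      short : ∀ i → Short (vector (coordinates (suc i)))
      short i with Any.any? (λ e → ¬? (S°-≟ r e) ×-dec (cls e ≟ᴵ cls r)) elements
        where
        r : S°
        r = rep i
      ... | no alone = Short.letter r λ where
          nothing  → sym (δ-just-nothing r)
          (just e) → single e (S°-≟ r e)
        where
        r : S°
        r = rep i
        single : ∀ e → Dec (r ≡ e) → χ e * (χ r * [ cls e ∈class cls r ]) ≡ δ (just r) (just e)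
        single e (yes refl) = trans (in-class r r refl) (trans (χ-square r) (sym (δ-same (just r))))
        single e (no r≢e)   = trans (off-class e r λ e∈ → alone (lose (∈-elements e) (r≢e , e∈)))
          (sym (δ-other (just-≢ r≢e)))
      ... | yes found with find found
      ...   | e , _ , r≢e , e∈ with compat (sym e∈)
      ...     | inj₁ same-label = Short.letter+ r e r≢e (trans (sym (labels-label° r)) (trans same-label (labels-label° e))) λ where
          nothing   → sym (cong₂ _+_ (δ-just-nothing r) (δ-just-nothing e))
          (just e′) → two e′ (S°-≟ r e′) (S°-≟ e e′)
        where
        r : S°
        r = rep i
        χe≡χr : χ e ≡ χ r
        χe≡χr = cong ψ (trans (sym (labels-label° e)) (trans (sym same-label) (labels-label° r)))
        two : ∀ e′ → Dec (r ≡ e′) → Dec (e ≡ e′) →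
              χ e′ * (χ r * [ cls e′ ∈class cls r ]) ≡ δ (just r) (just e′) + δ (just e) (just e′)
        two e′ (yes refl) _ = trans (in-class r r refl) (trans (χ-square r)
          (sym (cong₂ _+_ (δ-same (just r)) (δ-other (just-≢ (r≢e ∘ sym))))))
        two e′ (no r≢e′) (yes refl) = trans (in-class e r e∈) (trans (cong (_* χ r) χe≡χr) (trans (χ-square r)
          (sym (cong₂ _+_ (δ-other (just-≢ r≢e)) (δ-same (just e))))))
        two e′ (no r≢e′) (no e≢e′) = trans (off-class e′ r λ e′∈ → no-three r≢e r≢e′ e≢e′ (sym e∈) (sym e′∈))
          (sym (cong₂ _+_ (δ-other (just-≢ r≢e′)) (δ-other (just-≢ e≢e′))))
      ...     | inj₂ opposite-label = Short.letter- r e r≢e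
          (trans (sym (labels-label° r)) (trans opposite-label (cong τ (labels-label° e)))) λ where
          nothing   → sym (cong₂ _-_ (δ-just-nothing r) (δ-just-nothing e))
          (just e′) → two e′ (S°-≟ r e′) (S°-≟ e e′)
        where
        r : S°
        r = rep i
        χr≡-χe : χ r ≡ - χ e
        χr≡-χe = trans (cong ψ (trans (sym (labels-label° r)) (trans opposite-label (cong τ (labels-label° e))))) (ψ-τ (label° e))
        two : ∀ e′ → Dec (r ≡ e′) → Dec (e ≡ e′) →
              χ e′ * (χ r * [ cls e′ ∈class cls r ]) ≡ δ (just r) (just e′) - δ (just e) (just e′)
        two e′ (yes refl) _ = trans (in-class r r refl) (trans (χ-square r)
          (sym (cong₂ _-_ (δ-same (just r)) (δ-other (just-≢ (r≢e ∘ sym))))))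
        two e′ (no r≢e′) (yes refl) = trans (in-class e r e∈) (trans (cong (χ e *_) χr≡-χe)
          (trans (sym (ℤₚ.neg-distribʳ-* (χ e) (χ e))) (trans (cong -_ (χ-square e))
          (sym (cong₂ _-_ (δ-other (just-≢ r≢e)) (δ-same (just e)))))))
        two e′ (no r≢e′) (no e≢e′) = trans (off-class e′ r λ e′∈ → no-three r≢e r≢e′ e≢e′ (sym e∈) (sym e′∈))
          (sym (cong₂ _-_ (δ-other (just-≢ r≢e′)) (δ-other (just-≢ e≢e′))))

      covers : ∀ e → ∃! _≡_ λ i → vector (coordinates i) (just e) ≢ 0ℤ
      covers e = suc i₁ , nonzero , λ {j} → unique j
        where
        i₁ : Fin (length classes)
        i₁ = index (∈-classes e)
        e∈ : cls e ≡ cls (rep i₁)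
        e∈ = trans (Anyₚ.lookup-index (∈-classes e)) (proj₂ (representative i₁))
        unit-≢0 : ∀ d → χ d ≢ 0ℤ
        unit-≢0 d χ≡0 = contradiction (trans (sym (χ-square d)) (cong₂ _*_ χ≡0 χ≡0)) λ ()
        nonzero : χ e * (χ (rep i₁) * [ cls e ∈class cls (rep i₁) ]) ≢ 0ℤ
        nonzero eq with ℤₚ.i*j≡0⇒i≡0∨j≡0 (χ e) (trans (sym (in-class e (rep i₁) e∈)) eq)
        ... | inj₁ χ≡0 = unit-≢0 e χ≡0
        ... | inj₂ χ≡0 = unit-≢0 (rep i₁) χ≡0
        unique : ∀ j → vector (coordinates j) (just e) ≢ 0ℤ → suc i₁ ≡ j
        unique zero    ≢0 = contradiction (ℤₚ.*-zeroʳ (χ e)) ≢0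
        unique (suc j) ≢0 with cls e ≟ᴵ cls (rep j)
        ... | no e∉  = contradiction (trans (cong (χ e *_) (ℤₚ.*-zeroʳ (χ (rep j)))) (ℤₚ.*-zeroʳ (χ e))) ≢0
        ... | yes e∈j = cong suc (lookup-injective classes-unique i₁ j
          (trans (sym (Anyₚ.lookup-index (∈-classes e))) (trans e∈j (sym (proj₂ (representative j))))))

    filling : Filling
    filling = record
      { size = size ; λs = vector ∘ coordinates ; i₀ = zero
      ; is-s = λ where
          nothing  → sym (δ-same nothing)
          (just e) → trans (ℤₚ.*-zeroʳ (χ e)) (sym (δ-nothing-just e))
      ; short = λ where
          zero    0≢0 → contradiction refl 0≢0
          (suc i) _   → short i
      ; covers = covers }

    ¬¬filling-rank : ¬ ¬ (∃ λ r → HasRank (Filling.gram filling φ) r × r ℕ.≤ N ℕ.+ 2)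
    ¬¬filling-rank = IntegralRank.¬¬rank (λ a b → ℤ.+ 8 * φ (ẽ (vector a) (vector b))) gram-low coordinates
      (λ i j → φ (ẽ (vector (coordinates i)) (vector (coordinates j)))) (ℤ.+ 8) (λ ()) (λ _ _ → refl)

-- The numerical conclusion.

open import Data.Integer.Base using (+_)
open import Data.Rational.Base using (½; 1ℚ; _*_; _-_; _/_; _≥_)

theorem10p2p1 : ∀ {a} (α : Set a) (τ : α → α) (τ-involutive : Involutive _≡_ τ) →
    let open Nanowords α τ τ-involutive in
    (φ : Π → ℤ) → IsAdditive φ →
    (∀ x → φ (gen x) ≡ 1ℤ ⊎ φ (gen x) ≡ -1ℤ) →
    (w v : Nanoword) (ρ : ℕ) (σ : ℚ) →
    IsRhoWbr w v ρ →
    IsGenus φ (pairing w ⊕ opposite-pairing (pairing v)) σ →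
    + ρ / 1 ≥ ½ * (σ - 1ℚ)
theorem10p2p1 α τ τ-involutive φ φ-additive φ-unit w v ρ σ ((m , m≡ρ) , _) (_ , σ-minimal) =
  -- The rank of the Gram matrix is available only under a double negation, which may be removed
  -- here because the order on ℚ is decidable.
  decidable-stable (½ * (σ - 1ℚ) ℚₚ.≤? + ρ / 1) λ ¬bound →
    -- By minimality, σ is at most half the rank for this particular filling.
    ¬¬filling-rank (link m) λ (r , rank , r≤) → ¬bound (bound r r≤ (σ-minimal _ (filling (link m) , r , rank , refl)))
  where
  open Nanowords α τ τ-involutive using (totalArches)
  open BridgeReduction α τ τ-involutive φ φ-additive φ-unit
  open LinkFilling α τ τ-involutive φ φ-additive φ-unit
  open IntegralRank
  n : ℚ
  n = ⌜ + ρ ⌝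
  half-double : ∀ q → ½ * (q ℚ.+ q) ≡ q
  half-double q = trans (ℚₚ.*-distribˡ-+ ½ q q) (trans (sym (ℚₚ.*-distribʳ-+ q ½ ½)) (ℚₚ.*-identityˡ q))
  -- The rank bound 4ρ + 2 as the double of 2ρ + 1: one halving occurs in the genus, and after
  -- subtraction of 1 the other halving leaves ρ.
  total : ∀ k → k ≡ ρ → ⌜ + (cost k ℕ.+ 2) ⌝ ≡ (n ℚ.+ n ℚ.+ 1ℚ) ℚ.+ (n ℚ.+ n ℚ.+ 1ℚ)
  total _ refl = begin
    ⌜ + (cost ρ ℕ.+ 2) ⌝                              ≡⟨ cong (⌜_⌝ ∘ +_) (regroup ρ) ⟩
    ⌜ + ((ρ ℕ.+ ρ ℕ.+ 1) ℕ.+ (ρ ℕ.+ ρ ℕ.+ 1)) ⌝       ≡⟨ ⌜⌝-+ (+ (ρ ℕ.+ ρ ℕ.+ 1)) (+ (ρ ℕ.+ ρ ℕ.+ 1)) ⟩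
    ⌜ + (ρ ℕ.+ ρ ℕ.+ 1) ⌝ ℚ.+ ⌜ + (ρ ℕ.+ ρ ℕ.+ 1) ⌝   ≡⟨ cong₂ ℚ._+_ odd odd ⟩
    (n ℚ.+ n ℚ.+ 1ℚ) ℚ.+ (n ℚ.+ n ℚ.+ 1ℚ)             ∎
    where
    open ≡-Reasoning
    regroup : ∀ k → ((k ℕ.+ k) ℕ.+ (k ℕ.+ k)) ℕ.+ 2 ≡ (k ℕ.+ k ℕ.+ 1) ℕ.+ (k ℕ.+ k ℕ.+ 1)
    regroup = ℕ-RingSolver.solve-∀
    odd : ⌜ + (ρ ℕ.+ ρ ℕ.+ 1) ⌝ ≡ n ℚ.+ n ℚ.+ 1ℚ
    odd = trans (⌜⌝-+ (+ (ρ ℕ.+ ρ)) (+ 1)) (cong (ℚ._+ 1ℚ) (⌜⌝-+ (+ ρ) (+ ρ)))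
  bound : ∀ r → r ℕ.≤ cost (totalArches m) ℕ.+ 2 → σ ℚ.≤ ½ * ⌜ + r ⌝ → ½ * (σ - 1ℚ) ℚ.≤ n
  bound r r≤ σ≤ = begin
    ½ * (σ - 1ℚ)                                     ≤⟨ ℚₚ.*-monoˡ-≤-nonNeg ½ (ℚₚ.+-monoˡ-≤ (ℚ.- 1ℚ) σ≤′) ⟩
    ½ * ((n ℚ.+ n ℚ.+ 1ℚ) - 1ℚ)                      ≡⟨ cong (½ *_) (trans (ℚₚ.+-assoc (n ℚ.+ n) 1ℚ (ℚ.- 1ℚ)) (ℚₚ.+-identityʳ (n ℚ.+ n))) ⟩
    ½ * (n ℚ.+ n)                                    ≡⟨ half-double n ⟩
    n                                                ∎
    where
    open ℚₚ.≤-Reasoning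
    σ≤′ : σ ℚ.≤ n ℚ.+ n ℚ.+ 1ℚ
    σ≤′ = begin
      σ                                                   ≤⟨ σ≤ ⟩
      ½ * ⌜ + r ⌝                                         ≤⟨ ℚₚ.*-monoˡ-≤-nonNeg ½ (⌜⌝-mono-≤ (ℤ.+≤+ r≤)) ⟩
      ½ * ⌜ + (cost (totalArches m) ℕ.+ 2) ⌝              ≡⟨ cong (½ *_) (total (totalArches m) m≡ρ) ⟩
      ½ * ((n ℚ.+ n ℚ.+ 1ℚ) ℚ.+ (n ℚ.+ n ℚ.+ 1ℚ))         ≡⟨ half-double (n ℚ.+ n ℚ.+ 1ℚ) ⟩
      n ℚ.+ n ℚ.+ 1ℚ                                      ∎
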